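{- Let $p>3$ be an integer with $p\notin\{4,6\}$, and let $\lambda_p=2\cos\left(\frac{\pi}{p}\right)$. Then for no integer $m\ge 1$ is $\lambda_p^m$ an integer. -}

module Defs where

open import Algebra.Bundles using (RawSemiring)
open import Data.Integer.Base as ℤ using (ℤ; +_)
import Data.Integer.Properties as ℤ
open import Data.Nat.Base as ℕ using (ℕ; zero; suc; _!)
import Data.Nat.Properties as ℕ
import Data.Nat.Solver as ℕSolver
open import Data.Product.Base using (∃; ∃₂; _×_; _,_; proj₁; proj₂)
open import Data.Rational.Base as ℚ using (ℚ; 0ℚ; 1ℚ; ½)
import Data.Rational.Properties as ℚ
import Data.Rational.Solver as ℚSolver
import Data.Rational.Unnormalised.Base as ℚᵘ
import Data.Rational.Unnormalised.Properties as ℚᵘ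
open import Level using (0ℓ)
open import Relation.Binary.PropositionalEquality
  using (_≡_; refl; sym; trans; cong; cong₂; subst)
open import Relation.Nullary using (¬_)

open import Algebra.Definitions.RawSemiring ℚ.+-*-rawSemiring
  using () renaming (_^_ to _^ℚ_)

invFact : ℕ → ℚ
invFact n = ((+ 1) ℚ./ (n !)) {{n ℕ.!≢0}}

cosTerm : ℕ → ℚ → ℚ
cosTerm k q = (ℚ.- 1ℚ) ^ℚ k ℚ.* (q ^ℚ (2 ℕ.* k) ℚ.* invFact (2 ℕ.* k))

cosSum : ℕ → ℚ → ℚ
cosSum zero    q = 0ℚ
cosSum (suc n) q = cosSum n q ℚ.+ cosTerm n q

module Estimates where

  open import Data.Rational.Base hiding (_≃_)
  open ℚ.≤-Reasoning
  open ℚSolver.+-*-Solver using (solve; _:+_; _:*_; _:-_; :-_; _:=_; con)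

  *-mono-≤-nonNeg : ∀ {p q r s} → 0ℚ ≤ p → 0ℚ ≤ s →
                    p ≤ q → r ≤ s → p * r ≤ q * s
  *-mono-≤-nonNeg {p} {q} {r} {s} 0≤p 0≤s p≤q r≤s = begin
    p * r  ≤⟨ ℚ.*-monoˡ-≤-nonNeg p {{nonNegative 0≤p}} r≤s ⟩
    p * s  ≤⟨ ℚ.*-monoʳ-≤-nonNeg s {{nonNegative 0≤s}} p≤q ⟩
    q * s  ∎

  *-nonNeg : ∀ {p q} → 0ℚ ≤ p → 0ℚ ≤ q → 0ℚ ≤ p * q
  *-nonNeg {p} {q} 0≤p 0≤q =
    subst (_≤ p * q) (ℚ.*-zeroʳ p) (ℚ.*-monoˡ-≤-nonNeg p {{nonNegative 0≤p}} 0≤q)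

  *-pos : ∀ {p q} → 0ℚ < p → 0ℚ < q → 0ℚ < p * q
  *-pos {p} {q} 0<p 0<q =
    subst (_< p * q) (ℚ.*-zeroʳ p) (ℚ.*-monoʳ-<-pos p {{positive 0<p}} 0<q)

  +-nonNeg : ∀ {p q} → 0ℚ ≤ p → 0ℚ ≤ q → 0ℚ ≤ p + q
  +-nonNeg {p} {q} 0≤p 0≤q = subst (_≤ p + q) (ℚ.+-identityˡ 0ℚ) (ℚ.+-mono-≤ 0≤p 0≤q)

  p<p+q : ∀ p {q} → 0ℚ < q → p < p + q
  p<p+q p {q} 0<q = subst (_< p + q) (ℚ.+-identityʳ p) (ℚ.+-monoʳ-< p 0<q)

  p≤p+q : ∀ p {q} → 0ℚ ≤ q → p ≤ p + q
  p≤p+q p {q} 0≤q = subst (_≤ p + q) (ℚ.+-identityʳ p) (ℚ.+-monoʳ-≤ p 0≤q)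

  ∣p-p∣≡0 : ∀ p → ∣ p - p ∣ ≡ 0ℚ
  ∣p-p∣≡0 p = cong ∣_∣ (ℚ.+-inverseʳ p)

  ∣p-q∣≡∣q-p∣ : ∀ p q → ∣ p - q ∣ ≡ ∣ q - p ∣
  ∣p-q∣≡∣q-p∣ p q = trans (sym (ℚ.∣-p∣≡∣p∣ (p - q)))
    (cong ∣_∣ (solve 2 (λ p q → :- (p :- q) := q :- p) refl p q))

  ∣∣-triangle : ∀ p q r → ∣ p - r ∣ ≤ ∣ p - q ∣ + ∣ q - r ∣
  ∣∣-triangle p q r = begin
    ∣ p - r ∣              ≡⟨ cong ∣_∣ (solve 3 (λ p q r → p :- r := (p :- q) :+ (q :- r)) refl p q r) ⟩
    ∣ (p - q) + (q - r) ∣  ≤⟨ ℚ.∣p+q∣≤∣p∣+∣q∣ (p - q) (q - r) ⟩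
    ∣ p - q ∣ + ∣ q - r ∣  ∎

  ∣pr-qs∣≤ : ∀ p q r s → ∣ p * r - q * s ∣ ≤ ∣ p ∣ * ∣ r - s ∣ + ∣ s ∣ * ∣ p - q ∣
  ∣pr-qs∣≤ p q r s = begin
    ∣ p * r - q * s ∣                      ≡⟨ cong ∣_∣ (solve 4 (λ p q r s → p :* r :- q :* s := p :* (r :- s) :+ s :* (p :- q)) refl p q r s) ⟩
    ∣ p * (r - s) + s * (p - q) ∣          ≤⟨ ℚ.∣p+q∣≤∣p∣+∣q∣ (p * (r - s)) (s * (p - q)) ⟩
    ∣ p * (r - s) ∣ + ∣ s * (p - q) ∣      ≡⟨ cong₂ _+_ (ℚ.∣p*q∣≡∣p∣*∣q∣ p (r - s)) (ℚ.∣p*q∣≡∣p∣*∣q∣ s (p - q)) ⟩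
    ∣ p ∣ * ∣ r - s ∣ + ∣ s ∣ * ∣ p - q ∣  ∎

  third : ℚ → ℚ
  third ε = ε * (+ 1 / 3)

  third-pos : ∀ {ε} → 0ℚ < ε → 0ℚ < third ε
  third-pos 0<ε = *-pos 0<ε (ℚ.positive⁻¹ (+ 1 / 3))

  three-thirds : ∀ ε → third ε + third ε + third ε ≡ ε
  three-thirds ε = trans
    (solve 2 (λ ε t → ε :* t :+ ε :* t :+ ε :* t := ε :* (t :+ t :+ t)) refl ε (+ 1 / 3))
    (ℚ.*-identityʳ ε)

  shrink : ∀ {L ε} → 0ℚ ≤ L → 0ℚ < ε → ∃ λ δ → 0ℚ < δ × L * δ ≤ ε
  shrink {L} {ε} 0≤L 0<ε = δ , 0<δ , (begin
    L * δ                ≤⟨ ℚ.*-monoʳ-≤-nonNeg δ {{nonNegative (ℚ.<⇒≤ 0<δ)}} (p≤p+q L (ℚ.nonNegative⁻¹ 1ℚ)) ⟩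
    (L + 1ℚ) * (ε * r)   ≡⟨ solve 3 (λ a e r → a :* (e :* r) := e :* (a :* r)) refl (L + 1ℚ) ε r ⟩
    ε * ((L + 1ℚ) * r)   ≡⟨ cong (ε *_) (ℚ.*-inverseʳ (L + 1ℚ)) ⟩
    ε * 1ℚ               ≡⟨ ℚ.*-identityʳ ε ⟩
    ε                    ∎)
    where
    instance
      L+1>0 : Positive (L + 1ℚ)
      L+1>0 = ℚ.nonNeg+pos⇒pos L {{nonNegative 0≤L}} 1ℚ
      L+1≢0 : NonZero (L + 1ℚ)
      L+1≢0 = ℚ.pos⇒nonZero (L + 1ℚ)
    r = 1/ (L + 1ℚ)
    δ = ε * r
    0<δ : 0ℚ < δ
    0<δ = *-pos 0<ε (ℚ.positive⁻¹ r {{ℚ.1/pos⇒pos (L + 1ℚ)}})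

  fromℕ : ℕ → ℚ
  fromℕ n = + n / 1

  toℚᵘ-fromℕ : ∀ n → toℚᵘ (fromℕ n) ℚᵘ.≃ ℚᵘ.mkℚᵘ (+ n) 0
  toℚᵘ-fromℕ n = ℚ.toℚᵘ-fromℚᵘ (ℚᵘ.mkℚᵘ (+ n) 0)

  fromℕ-mono-≤ : ∀ {m n} → m ℕ.≤ n → fromℕ m ≤ fromℕ n
  fromℕ-mono-≤ {m} {n} m≤n = ℚ.toℚᵘ-cancel-≤
    (ℚᵘ.≤-respˡ-≃ (ℚᵘ.≃-sym (toℚᵘ-fromℕ m)) (ℚᵘ.≤-respʳ-≃ (ℚᵘ.≃-sym (toℚᵘ-fromℕ n))
      (ℚᵘ.*≤* (ℤ.*-monoʳ-≤-nonNeg (+ 1) (ℤ.+≤+ m≤n)))))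

  fromℕ-* : ∀ m n → fromℕ (m ℕ.* n) ≡ fromℕ m * fromℕ n
  fromℕ-* m n = ℚ.toℚᵘ-injective (ℚᵘ.≃-trans (toℚᵘ-fromℕ (m ℕ.* n))
    (ℚᵘ.≃-sym (ℚᵘ.≃-trans (ℚ.toℚᵘ-homo-* (fromℕ m) (fromℕ n))
      (ℚᵘ.≃-trans (ℚᵘ.*-cong (toℚᵘ-fromℕ m) (toℚᵘ-fromℕ n))
        (ℚᵘ.*≡* (cong (ℤ._* + 1) (sym (ℤ.pos-* m n))))))))

  fromℕ-+ : ∀ m n → fromℕ (m ℕ.+ n) ≡ fromℕ m + fromℕ n
  fromℕ-+ m n = ℚ.toℚᵘ-injective (ℚᵘ.≃-trans (toℚᵘ-fromℕ (m ℕ.+ n))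
    (ℚᵘ.≃-sym (ℚᵘ.≃-trans (ℚ.toℚᵘ-homo-+ (fromℕ m) (fromℕ n))
      (ℚᵘ.≃-trans (ℚᵘ.+-cong (toℚᵘ-fromℕ m) (toℚᵘ-fromℕ n))
        (ℚᵘ.*≡* (cong (ℤ._* + 1) (cong₂ ℤ._+_ (ℤ.*-identityʳ (+ m)) (ℤ.*-identityʳ (+ n)))))))))

  0≤fromℕ : ∀ n → 0ℚ ≤ fromℕ n
  0≤fromℕ n = fromℕ-mono-≤ {0} {n} ℕ.z≤n

  0<fromℕ-suc : ∀ n → 0ℚ < fromℕ (suc n)
  0<fromℕ-suc n = ℚ.<-≤-trans (ℚ.positive⁻¹ 1ℚ) (fromℕ-mono-≤ {1} {suc n} (ℕ.s≤s ℕ.z≤n))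

  archimedean : ∀ q → ∃ λ n → q ≤ fromℕ n
  archimedean q@(mkℚ n d-1 _) = ℤ.∣ n ∣ , ℚ.toℚᵘ-cancel-≤
    (ℚᵘ.≤-respʳ-≃ (ℚᵘ.≃-sym (toℚᵘ-fromℕ ℤ.∣ n ∣)) (ℚᵘ.*≤* (bound n)))
    where
    bound : ∀ n → n ℤ.* + 1 ℤ.≤ + ℤ.∣ n ∣ ℤ.* + suc d-1
    bound (+ n) = subst (ℤ._≤ + n ℤ.* + suc d-1) refl
      (ℤ.*-monoˡ-≤-nonNeg (+ n) (ℤ.+≤+ (ℕ.s≤s ℕ.z≤n)))
    bound ℤ.-[1+ n ] = ℤ.-≤+

  BoundedLipschitz : ℚ → (ℚ → ℚ) → Set
  BoundedLipschitz B f = ∃₂ λ M L → 0ℚ ≤ M × 0ℚ ≤ L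
    × (∀ x → ∣ x ∣ ≤ B → ∣ f x ∣ ≤ M)
    × (∀ x y → ∣ x ∣ ≤ B → ∣ y ∣ ≤ B → ∣ f x - f y ∣ ≤ L * ∣ x - y ∣)

  BL-const : ∀ {B} c → BoundedLipschitz B (λ _ → c)
  BL-const c = ∣ c ∣ , 0ℚ , ℚ.0≤∣p∣ c , ℚ.≤-refl , (λ _ _ → ℚ.≤-refl) ,
    (λ x y _ _ → ℚ.≤-reflexive (trans (∣p-p∣≡0 c) (sym (ℚ.*-zeroˡ ∣ x - y ∣))))

  BL-id : ∀ {B} → 0ℚ ≤ B → BoundedLipschitz B (λ x → x)
  BL-id {B} 0≤B = B , 1ℚ , 0≤B , ℚ.nonNegative⁻¹ 1ℚ , (λ _ ∣x∣≤B → ∣x∣≤B) ,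
    (λ x y _ _ → ℚ.≤-reflexive (sym (ℚ.*-identityˡ ∣ x - y ∣)))

  BL-+ : ∀ {B f g} → BoundedLipschitz B f → BoundedLipschitz B g →
         BoundedLipschitz B (λ x → f x + g x)
  BL-+ {f = f} {g} (M , L , 0≤M , 0≤L , bf , lf) (M′ , L′ , 0≤M′ , 0≤L′ , bg , lg) =
    M + M′ , L + L′ , +-nonNeg 0≤M 0≤M′ , +-nonNeg 0≤L 0≤L′ ,
    (λ x x≤ → ℚ.≤-trans (ℚ.∣p+q∣≤∣p∣+∣q∣ (f x) (g x)) (ℚ.+-mono-≤ (bf x x≤) (bg x x≤))) ,
    (λ x y x≤ y≤ → begin
      ∣ (f x + g x) - (f y + g y) ∣        ≡⟨ cong ∣_∣ (solve 4 (λ a b c d → (a :+ b) :- (c :+ d) := (a :- c) :+ (b :- d)) refl (f x) (g x) (f y) (g y)) ⟩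
      ∣ (f x - f y) + (g x - g y) ∣        ≤⟨ ℚ.∣p+q∣≤∣p∣+∣q∣ (f x - f y) (g x - g y) ⟩
      ∣ f x - f y ∣ + ∣ g x - g y ∣        ≤⟨ ℚ.+-mono-≤ (lf x y x≤ y≤) (lg x y x≤ y≤) ⟩
      L * ∣ x - y ∣ + L′ * ∣ x - y ∣       ≡⟨ ℚ.*-distribʳ-+ ∣ x - y ∣ L L′ ⟨
      (L + L′) * ∣ x - y ∣                 ∎)

  BL-* : ∀ {B f g} → BoundedLipschitz B f → BoundedLipschitz B g →
         BoundedLipschitz B (λ x → f x * g x)
  BL-* {f = f} {g} (M , L , 0≤M , 0≤L , bf , lf) (M′ , L′ , 0≤M′ , 0≤L′ , bg , lg) =
    M * M′ , M * L′ + M′ * L , *-nonNeg 0≤M 0≤M′ ,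
    +-nonNeg (*-nonNeg 0≤M 0≤L′) (*-nonNeg 0≤M′ 0≤L) ,
    (λ x x≤ → ℚ.≤-trans (ℚ.≤-reflexive (ℚ.∣p*q∣≡∣p∣*∣q∣ (f x) (g x)))
      (*-mono-≤-nonNeg (ℚ.0≤∣p∣ (f x)) 0≤M′ (bf x x≤) (bg x x≤))) ,
    (λ x y x≤ y≤ → let d = ∣ x - y ∣; 0≤d = ℚ.0≤∣p∣ (x - y) in begin
      ∣ f x * g x - f y * g y ∣                        ≤⟨ ∣pr-qs∣≤ (f x) (f y) (g x) (g y) ⟩
      ∣ f x ∣ * ∣ g x - g y ∣ + ∣ g y ∣ * ∣ f x - f y ∣
        ≤⟨ ℚ.+-mono-≤
             (*-mono-≤-nonNeg (ℚ.0≤∣p∣ (f x)) (*-nonNeg 0≤L′ 0≤d) (bf x x≤) (lg x y x≤ y≤))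
             (*-mono-≤-nonNeg (ℚ.0≤∣p∣ (g y)) (*-nonNeg 0≤L 0≤d) (bg y y≤) (lf x y x≤ y≤)) ⟩
      M * (L′ * d) + M′ * (L * d)
        ≡⟨ solve 5 (λ m l m′ l′ d → m :* (l′ :* d) :+ m′ :* (l :* d) := (m :* l′ :+ m′ :* l) :* d) refl M L M′ L′ d ⟩
      (M * L′ + M′ * L) * d                            ∎)

  BL-^ : ∀ {B} → 0ℚ ≤ B → ∀ n → BoundedLipschitz B (_^ℚ n)
  BL-^ 0≤B zero    = BL-const 1ℚ
  BL-^ 0≤B (suc n) = BL-* (BL-id 0≤B) (BL-^ 0≤B n)

  BL-cosSum : ∀ {B} → 0ℚ ≤ B → ∀ n → BoundedLipschitz B (cosSum n)
  BL-cosSum 0≤B zero    = BL-const 0ℚ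
  BL-cosSum 0≤B (suc n) = BL-+ (BL-cosSum 0≤B n)
    (BL-* (BL-const ((- 1ℚ) ^ℚ n)) (BL-* (BL-^ 0≤B (2 ℕ.* n)) (BL-const (invFact (2 ℕ.* n)))))

  0≤^ : ∀ {q} → 0ℚ ≤ q → ∀ n → 0ℚ ≤ q ^ℚ n
  0≤^ 0≤q zero    = ℚ.nonNegative⁻¹ 1ℚ
  0≤^ 0≤q (suc n) = *-nonNeg 0≤q (0≤^ 0≤q n)

  ∣^∣≤ : ∀ {B x} → 0ℚ ≤ B → ∣ x ∣ ≤ B → ∀ n → ∣ x ^ℚ n ∣ ≤ B ^ℚ n
  ∣^∣≤         0≤B ∣x∣≤B zero    = ℚ.≤-refl
  ∣^∣≤ {B} {x} 0≤B ∣x∣≤B (suc n) = begin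
    ∣ x * x ^ℚ n ∣      ≡⟨ ℚ.∣p*q∣≡∣p∣*∣q∣ x (x ^ℚ n) ⟩
    ∣ x ∣ * ∣ x ^ℚ n ∣  ≤⟨ *-mono-≤-nonNeg (ℚ.0≤∣p∣ x) (0≤^ 0≤B n) ∣x∣≤B (∣^∣≤ 0≤B ∣x∣≤B n) ⟩
    B * B ^ℚ n          ∎

  1^ : ∀ n → 1ℚ ^ℚ n ≡ 1ℚ
  1^ zero    = refl
  1^ (suc n) = trans (ℚ.*-identityˡ (1ℚ ^ℚ n)) (1^ n)

  0≤invFact : ∀ n → 0ℚ ≤ invFact n
  0≤invFact n = ℚ.nonNegative⁻¹ (invFact n) {{ℚ.normalize-nonNeg 1 (n !) {{n ℕ.!≢0}}}}

  fromℕ-!*invFact : ∀ n → fromℕ (n !) * invFact n ≡ 1ℚ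
  fromℕ-!*invFact n = inverse (n !) {{n ℕ.!≢0}}
    where
    inverse : ∀ m .{{_ : ℕ.NonZero m}} → fromℕ m * (+ 1 / m) ≡ 1ℚ
    inverse m@(suc m-1) = ℚ.toℚᵘ-injective
      (ℚᵘ.≃-trans (ℚ.toℚᵘ-homo-* (fromℕ m) (+ 1 / m))
        (ℚᵘ.≃-trans (ℚᵘ.*-cong (toℚᵘ-fromℕ m) (ℚ.toℚᵘ-fromℚᵘ (ℚᵘ.mkℚᵘ (+ 1) m-1)))
          (ℚᵘ.*≡* (cong +_ (ℕsolve 1 (λ m → m ⊛ κ 1 ⊛ κ 1 ⊜ κ 1 ⊛ (κ 1 ⊛ m)) refl m)))))
      where open ℕSolver.+-*-Solver using ()
              renaming (solve to ℕsolve; _:*_ to _⊛_; con to κ; _:=_ to _⊜_)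

  invFact-suc : ∀ n → invFact n ≡ fromℕ (suc n) * invFact (suc n)
  invFact-suc n = begin-equality
    invFact n                                             ≡⟨ ℚ.*-identityʳ (invFact n) ⟨
    invFact n * 1ℚ                                        ≡⟨ cong (invFact n *_) (fromℕ-!*invFact (suc n)) ⟨
    invFact n * (fromℕ (suc n ℕ.* n !) * invFact (suc n))
      ≡⟨ cong (λ z → invFact n * (z * invFact (suc n))) (fromℕ-* (suc n) (n !)) ⟩
    invFact n * (fromℕ (suc n) * fromℕ (n !) * invFact (suc n))
      ≡⟨ solve 4 (λ i s f j → i :* (s :* f :* j) := (f :* i) :* (s :* j)) refl
           (invFact n) (fromℕ (suc n)) (fromℕ (n !)) (invFact (suc n)) ⟩
    (fromℕ (n !) * invFact n) * (fromℕ (suc n) * invFact (suc n))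
      ≡⟨ cong (_* (fromℕ (suc n) * invFact (suc n))) (fromℕ-!*invFact n) ⟩
    1ℚ * (fromℕ (suc n) * invFact (suc n))                ≡⟨ ℚ.*-identityˡ _ ⟩
    fromℕ (suc n) * invFact (suc n)                       ∎

  majorant : ℕ → ℕ → ℚ
  majorant b k = fromℕ b ^ℚ (2 ℕ.* k) * invFact (2 ℕ.* k)

  0≤majorant : ∀ b k → 0ℚ ≤ majorant b k
  0≤majorant b k = *-nonNeg (0≤^ (0≤fromℕ b) (2 ℕ.* k)) (0≤invFact (2 ℕ.* k))

  ∣cosTerm∣≤ : ∀ b k {x} → ∣ x ∣ ≤ fromℕ b → ∣ cosTerm k x ∣ ≤ majorant b k
  ∣cosTerm∣≤ b k {x} x≤ = begin
    ∣ (- 1ℚ) ^ℚ k * (x ^ℚ 2k * invFact 2k) ∣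
      ≡⟨ trans (ℚ.∣p*q∣≡∣p∣*∣q∣ ((- 1ℚ) ^ℚ k) _)
               (cong (∣ (- 1ℚ) ^ℚ k ∣ *_) (ℚ.∣p*q∣≡∣p∣*∣q∣ (x ^ℚ 2k) (invFact 2k))) ⟩
    ∣ (- 1ℚ) ^ℚ k ∣ * (∣ x ^ℚ 2k ∣ * ∣ invFact 2k ∣)
      ≤⟨ *-mono-≤-nonNeg (ℚ.0≤∣p∣ ((- 1ℚ) ^ℚ k)) (0≤majorant b k)
           (subst (∣ (- 1ℚ) ^ℚ k ∣ ≤_) (1^ k) (∣^∣≤ {1ℚ} {(- 1ℚ)} (ℚ.nonNegative⁻¹ 1ℚ) ℚ.≤-refl k))
           (*-mono-≤-nonNeg (ℚ.0≤∣p∣ (x ^ℚ 2k)) (0≤invFact 2k)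
             (∣^∣≤ (0≤fromℕ b) x≤ 2k)
             (ℚ.≤-reflexive (ℚ.0≤p⇒∣p∣≡p (0≤invFact 2k)))) ⟩
    1ℚ * majorant b k  ≡⟨ ℚ.*-identityˡ (majorant b k) ⟩
    majorant b k       ∎
    where 2k = 2 ℕ.* k

  2*majorant-suc≤ : ∀ b k → b ℕ.≤ k →
                    majorant b (suc k) + majorant b (suc k) ≤ majorant b k
  2*majorant-suc≤ b k b≤k = begin
    majorant b (suc k) + majorant b (suc k)
      ≡⟨ cong (λ j → fromℕ b ^ℚ j * invFact j + fromℕ b ^ℚ j * invFact j) 2*suc ⟩
    fromℕ b ^ℚ suc (suc n) * I″ + fromℕ b ^ℚ suc (suc n) * I″
      ≡⟨ solve 3 (λ β P I → (β :* (β :* P)) :* I :+ (β :* (β :* P)) :* I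
                     := (β :* β :+ β :* β) :* (P :* I)) refl (fromℕ b) P I″ ⟩
    (fromℕ b * fromℕ b + fromℕ b * fromℕ b) * (P * I″)
      ≡⟨ cong (_* (P * I″)) (trans (fromℕ-+ (b ℕ.* b) (b ℕ.* b))
           (cong₂ _+_ (fromℕ-* b b) (fromℕ-* b b))) ⟨
    fromℕ (b ℕ.* b ℕ.+ b ℕ.* b) * (P * I″)
      ≤⟨ ℚ.*-monoʳ-≤-nonNeg (P * I″)
           {{nonNegative (*-nonNeg (0≤^ (0≤fromℕ b) n) (0≤invFact (suc (suc n))))}}
           (fromℕ-mono-≤ 2b²≤) ⟩
    fromℕ (suc n ℕ.* suc (suc n)) * (P * I″)
      ≡⟨ cong (_* (P * I″)) (fromℕ-* (suc n) (suc (suc n))) ⟩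
    fromℕ (suc n) * fromℕ (suc (suc n)) * (P * I″)
      ≡⟨ solve 4 (λ s t P I → s :* t :* (P :* I) := P :* (s :* (t :* I))) refl
           (fromℕ (suc n)) (fromℕ (suc (suc n))) P I″ ⟩
    P * (fromℕ (suc n) * (fromℕ (suc (suc n)) * I″))
      ≡⟨ cong (P *_) (trans (invFact-suc n) (cong (fromℕ (suc n) *_) (invFact-suc (suc n)))) ⟨
    majorant b k  ∎
    where
    n = 2 ℕ.* k
    P = fromℕ b ^ℚ n
    I″ = invFact (suc (suc n))
    2*suc : 2 ℕ.* suc k ≡ suc (suc n)
    2*suc = ℕ.*-suc 2 k
    b≤n : b ℕ.≤ n
    b≤n = ℕ.≤-trans b≤k (ℕ.m≤m+n k (k ℕ.+ 0))
    2b²≤ : b ℕ.* b ℕ.+ b ℕ.* b ℕ.≤ suc n ℕ.* suc (suc n)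
    2b²≤ = subst (ℕ._≤ suc n ℕ.* suc (suc n)) (ℕ.*-distribˡ-+ b b b)
      (ℕ.*-mono-≤ (ℕ.m≤n⇒m≤1+n b≤n) (ℕ.m≤n⇒m≤1+n (ℕ.m≤n⇒m≤1+n
        (ℕ.+-mono-≤ b≤k (ℕ.≤-trans b≤k (ℕ.m≤m+n k 0))))))

  cosSum-tail : ∀ b N {n x} → b ℕ.≤ N → N ℕ.≤ n → ∣ x ∣ ≤ fromℕ b →
                ∣ cosSum n x - cosSum N x ∣ ≤ majorant b N + majorant b N
  cosSum-tail b N {n} {x} b≤N N≤n x≤ =
    ℚ.≤-trans (p≤p+q _ (+-nonNeg (0≤majorant b n) (0≤majorant b n))) (go (ℕ.≤⇒≤′ N≤n))
    where
    go : ∀ {n} → N ℕ.≤′ n →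
         ∣ cosSum n x - cosSum N x ∣ + (majorant b n + majorant b n)
           ≤ majorant b N + majorant b N
    go ℕ.≤′-refl = ℚ.≤-reflexive
      (trans (cong (_+ (majorant b N + majorant b N)) (∣p-p∣≡0 (cosSum N x)))
             (ℚ.+-identityˡ (majorant b N + majorant b N)))
    go {suc n} (ℕ.≤′-step N≤′n) = begin
      ∣ cosSum n x + cosTerm n x - cosSum N x ∣ + (majorant b (suc n) + majorant b (suc n))
        ≤⟨ ℚ.+-mono-≤ step (2*majorant-suc≤ b n (ℕ.≤-trans b≤N (ℕ.≤′⇒≤ N≤′n))) ⟩
      (∣ cosSum n x - cosSum N x ∣ + majorant b n) + majorant b n
        ≡⟨ ℚ.+-assoc ∣ cosSum n x - cosSum N x ∣ (majorant b n) (majorant b n) ⟩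
      ∣ cosSum n x - cosSum N x ∣ + (majorant b n + majorant b n)
        ≤⟨ go N≤′n ⟩
      majorant b N + majorant b N  ∎
      where
      step : ∣ cosSum n x + cosTerm n x - cosSum N x ∣ ≤ ∣ cosSum n x - cosSum N x ∣ + majorant b n
      step = begin
        ∣ cosSum n x + cosTerm n x - cosSum N x ∣
          ≡⟨ cong ∣_∣ (solve 3 (λ s t u → s :+ t :- u := (s :- u) :+ t) refl
               (cosSum n x) (cosTerm n x) (cosSum N x)) ⟩
        ∣ (cosSum n x - cosSum N x) + cosTerm n x ∣
          ≤⟨ ℚ.∣p+q∣≤∣p∣+∣q∣ (cosSum n x - cosSum N x) (cosTerm n x) ⟩
        ∣ cosSum n x - cosSum N x ∣ + ∣ cosTerm n x ∣
          ≤⟨ ℚ.+-monoʳ-≤ ∣ cosSum n x - cosSum N x ∣ (∣cosTerm∣≤ b n x≤) ⟩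
        ∣ cosSum n x - cosSum N x ∣ + majorant b n  ∎

  majorant-decay : ∀ b j → fromℕ (suc j) * majorant b (b ℕ.+ j) ≤ majorant b b
  majorant-decay b zero = ℚ.≤-reflexive
    (trans (ℚ.*-identityˡ (majorant b (b ℕ.+ 0))) (cong (majorant b) (ℕ.+-identityʳ b)))
  majorant-decay b (suc j) = begin
    fromℕ (suc (suc j)) * a (b ℕ.+ suc j)
      ≡⟨ cong (λ i → fromℕ (suc (suc j)) * a i) (ℕ.+-suc b j) ⟩
    fromℕ (suc (suc j)) * a (suc (b ℕ.+ j))
      ≤⟨ ℚ.*-monoʳ-≤-nonNeg (a (suc (b ℕ.+ j))) {{nonNegative (0≤majorant b (suc (b ℕ.+ j)))}}
           (fromℕ-mono-≤ (ℕ.s≤s (ℕ.m≤n+m (suc j) j))) ⟩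
    fromℕ (suc j ℕ.+ suc j) * a (suc (b ℕ.+ j))
      ≡⟨ trans (cong (_* a (suc (b ℕ.+ j))) (fromℕ-+ (suc j) (suc j)))
           (solve 2 (λ s t → (s :+ s) :* t := s :* (t :+ t)) refl (fromℕ (suc j)) (a (suc (b ℕ.+ j)))) ⟩
    fromℕ (suc j) * (a (suc (b ℕ.+ j)) + a (suc (b ℕ.+ j)))
      ≤⟨ ℚ.*-monoˡ-≤-nonNeg (fromℕ (suc j)) {{nonNegative (0≤fromℕ (suc j))}}
           (2*majorant-suc≤ b (b ℕ.+ j) (ℕ.m≤m+n b j)) ⟩
    fromℕ (suc j) * a (b ℕ.+ j)
      ≤⟨ majorant-decay b j ⟩
    a b  ∎
    where a = majorant b

  majorant-small : ∀ b {ε} → 0ℚ < ε → ∃ λ N → b ℕ.≤ N × majorant b N + majorant b N < ε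
  majorant-small b {ε} 0<ε =
    b ℕ.+ j , ℕ.m≤m+n b j , ℚ.*-cancelˡ-<-nonNeg s {{nonNegative (0≤fromℕ (suc j))}} (begin-strict
      s * (a + a)                  ≡⟨ ℚ.*-distribˡ-+ s a a ⟩
      s * a + s * a                ≤⟨ ℚ.+-mono-≤ (majorant-decay b j) (majorant-decay b j) ⟩
      c                            ≡⟨ ℚ.*-identityʳ c ⟨
      c * 1ℚ                       ≡⟨ cong (c *_) (ℚ.*-inverseˡ ε) ⟨
      c * (1/ ε * ε)               ≡⟨ ℚ.*-assoc c (1/ ε) ε ⟨
      c * 1/ ε * ε                 ≤⟨ ℚ.*-monoʳ-≤-nonNeg ε {{nonNegative (ℚ.<⇒≤ 0<ε)}} (proj₂ (archimedean (c * 1/ ε))) ⟩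
      fromℕ j * ε                  <⟨ ℚ.*-monoˡ-<-pos ε (p<p+q (fromℕ j) (ℚ.positive⁻¹ 1ℚ)) ⟩
      (fromℕ j + fromℕ 1) * ε      ≡⟨ cong (_* ε) (trans (cong fromℕ (ℕ.+-comm 1 j)) (fromℕ-+ j 1)) ⟨
      s * ε                        ∎)
    where
    instance
      ε>0 : Positive ε
      ε>0 = positive 0<ε
      ε≢0 : NonZero ε
      ε≢0 = ℚ.pos⇒nonZero ε
    c = majorant b b + majorant b b
    j = proj₁ (archimedean (c * 1/ ε))
    s = fromℕ (suc j)
    a = majorant b (b ℕ.+ j)

  IsCauchy : (ℕ → ℚ) → Set
  IsCauchy x = ∀ ε → 0ℚ < ε →
    ∃ λ N → ∀ m n → N ℕ.≤ m → N ℕ.≤ n → ∣ x m - x n ∣ < ε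

  const-isCauchy : ∀ q → IsCauchy (λ _ → q)
  const-isCauchy q ε 0<ε = 0 , λ _ _ _ _ → subst (_< ε) (sym (∣p-p∣≡0 q)) 0<ε

  eventually-bounded : ∀ {x} → IsCauchy x →
                       ∃₂ λ b N → ∀ n → N ℕ.≤ n → ∣ x n ∣ ≤ fromℕ b
  eventually-bounded {x} x-cauchy with x-cauchy 1ℚ (ℚ.positive⁻¹ 1ℚ)
  ... | N , close = b , N , λ n N≤n → begin
    ∣ x n ∣                  ≡⟨ cong ∣_∣ (solve 2 (λ p q → p := (p :- q) :+ q) refl (x n) (x N)) ⟩
    ∣ (x n - x N) + x N ∣    ≤⟨ ℚ.∣p+q∣≤∣p∣+∣q∣ (x n - x N) (x N) ⟩
    ∣ x n - x N ∣ + ∣ x N ∣  ≤⟨ ℚ.+-monoˡ-≤ ∣ x N ∣ (ℚ.<⇒≤ (close n N N≤n ℕ.≤-refl)) ⟩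
    1ℚ + ∣ x N ∣             ≤⟨ proj₂ (archimedean (1ℚ + ∣ x N ∣)) ⟩
    fromℕ b                  ∎
    where b = proj₁ (archimedean (1ℚ + ∣ x N ∣))

  +-isCauchy : ∀ {x y} → IsCauchy x → IsCauchy y → IsCauchy (λ n → x n + y n)
  +-isCauchy {x} {y} x-cauchy y-cauchy ε 0<ε
    with x-cauchy (third ε) (third-pos 0<ε) | y-cauchy (third ε) (third-pos 0<ε)
  ... | N , close | N′ , close′ = N ℕ.⊔ N′ , λ m n m≥ n≥ → begin-strict
    ∣ (x m + y m) - (x n + y n) ∣
      ≡⟨ cong ∣_∣ (solve 4 (λ a b c d → (a :+ b) :- (c :+ d) := (a :- c) :+ (b :- d)) refl (x m) (y m) (x n) (y n)) ⟩
    ∣ (x m - x n) + (y m - y n) ∣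
      ≤⟨ ℚ.∣p+q∣≤∣p∣+∣q∣ (x m - x n) (y m - y n) ⟩
    ∣ x m - x n ∣ + ∣ y m - y n ∣
      <⟨ ℚ.+-mono-< (close m n (ℕ.m⊔n≤o⇒m≤o N N′ m≥) (ℕ.m⊔n≤o⇒m≤o N N′ n≥))
                    (close′ m n (ℕ.m⊔n≤o⇒n≤o N N′ m≥) (ℕ.m⊔n≤o⇒n≤o N N′ n≥)) ⟩
    third ε + third ε
      <⟨ p<p+q (third ε + third ε) (third-pos 0<ε) ⟩
    third ε + third ε + third ε
      ≡⟨ three-thirds ε ⟩
    ε ∎

  *-close : ∀ {B B′ δ δ′ ε} p q r s → 0ℚ < ε → B * δ ≤ third ε → B′ * δ′ ≤ third ε →
            ∣ p ∣ ≤ B → ∣ s ∣ ≤ B′ → ∣ r - s ∣ < δ → ∣ p - q ∣ < δ′ →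
            ∣ p * r - q * s ∣ < ε
  *-close {B} {B′} {δ} {δ′} {ε} p q r s 0<ε Bδ≤ B′δ′≤ p≤ s≤ rs< pq< = begin-strict
    ∣ p * r - q * s ∣                      ≤⟨ ∣pr-qs∣≤ p q r s ⟩
    ∣ p ∣ * ∣ r - s ∣ + ∣ s ∣ * ∣ p - q ∣  ≤⟨ ℚ.+-mono-≤
      (*-mono-≤-nonNeg (ℚ.0≤∣p∣ p) (ℚ.≤-trans (ℚ.0≤∣p∣ (r - s)) (ℚ.<⇒≤ rs<)) p≤ (ℚ.<⇒≤ rs<))
      (*-mono-≤-nonNeg (ℚ.0≤∣p∣ s) (ℚ.≤-trans (ℚ.0≤∣p∣ (p - q)) (ℚ.<⇒≤ pq<)) s≤ (ℚ.<⇒≤ pq<)) ⟩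
    B * δ + B′ * δ′                        ≤⟨ ℚ.+-mono-≤ Bδ≤ B′δ′≤ ⟩
    third ε + third ε                      <⟨ p<p+q (third ε + third ε) (third-pos 0<ε) ⟩
    third ε + third ε + third ε            ≡⟨ three-thirds ε ⟩
    ε                                      ∎

  -- `let` rather than `with` below: the latter normalises rational products.
  *-isCauchy : ∀ {x y} → IsCauchy x → IsCauchy y → IsCauchy (λ n → x n * y n)
  *-isCauchy {x} {y} x-cauchy y-cauchy ε 0<ε =
    let b  , B₁ , x-bound = eventually-bounded x-cauchy
        b′ , B₂ , y-bound = eventually-bounded y-cauchy
        δ  , 0<δ  , bδ≤   = shrink {fromℕ b} {third ε} (0≤fromℕ b) (third-pos 0<ε)
        δ′ , 0<δ′ , b′δ′≤ = shrink {fromℕ b′} {third ε} (0≤fromℕ b′) (third-pos 0<ε)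
        N₁ , x-close = x-cauchy δ′ 0<δ′
        N₂ , y-close = y-cauchy δ 0<δ
        B = B₁ ℕ.⊔ B₂
        N = N₁ ℕ.⊔ N₂
    in B ℕ.⊔ N , λ m n m≥ n≥ →
      *-close {fromℕ b} {fromℕ b′} {δ} {δ′} {ε} (x m) (x n) (y m) (y n) 0<ε bδ≤ b′δ′≤
        (x-bound m (ℕ.m⊔n≤o⇒m≤o B₁ B₂ (ℕ.m⊔n≤o⇒m≤o B N m≥)))
        (y-bound n (ℕ.m⊔n≤o⇒n≤o B₁ B₂ (ℕ.m⊔n≤o⇒m≤o B N n≥)))
        (y-close m n (ℕ.m⊔n≤o⇒n≤o N₁ N₂ (ℕ.m⊔n≤o⇒n≤o B N m≥))
                     (ℕ.m⊔n≤o⇒n≤o N₁ N₂ (ℕ.m⊔n≤o⇒n≤o B N n≥)))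
        (x-close m n (ℕ.m⊔n≤o⇒m≤o N₁ N₂ (ℕ.m⊔n≤o⇒n≤o B N m≥))
                     (ℕ.m⊔n≤o⇒m≤o N₁ N₂ (ℕ.m⊔n≤o⇒n≤o B N n≥)))

  cos-close : ∀ {b N L δ ε m n} p q → b ℕ.≤ N → N ℕ.≤ m → N ℕ.≤ n →
              majorant b N + majorant b N < third ε → 0ℚ ≤ L → L * δ ≤ third ε →
              ∣ cosSum N p - cosSum N q ∣ ≤ L * ∣ p - q ∣ →
              ∣ p ∣ ≤ fromℕ b → ∣ q ∣ ≤ fromℕ b → ∣ p - q ∣ < δ →
              ∣ cosSum m p - cosSum n q ∣ < ε
  cos-close {b} {N} {L} {δ} {ε} {m} {n} p q b≤N N≤m N≤n small 0≤L Lδ≤ lipschitz p≤ q≤ pq< = begin-strict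
    ∣ Sₘ - Sₙ ∣                              ≤⟨ ∣∣-triangle Sₘ S′ Sₙ ⟩
    ∣ Sₘ - S′ ∣ + ∣ S′ - Sₙ ∣                ≤⟨ ℚ.+-monoˡ-≤ ∣ S′ - Sₙ ∣ (∣∣-triangle Sₘ S S′) ⟩
    ∣ Sₘ - S ∣ + ∣ S - S′ ∣ + ∣ S′ - Sₙ ∣    <⟨ ℚ.+-mono-<
      (ℚ.+-mono-<-≤ (ℚ.≤-<-trans (cosSum-tail b N b≤N N≤m p≤) small) middle)
      (subst (_< third ε) (∣p-q∣≡∣q-p∣ Sₙ S′) (ℚ.≤-<-trans (cosSum-tail b N b≤N N≤n q≤) small)) ⟩
    third ε + third ε + third ε              ≡⟨ three-thirds ε ⟩
    ε                                        ∎
    where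
    Sₘ = cosSum m p
    Sₙ = cosSum n q
    S  = cosSum N p
    S′ = cosSum N q
    middle : ∣ S - S′ ∣ ≤ third ε
    middle = begin
      ∣ S - S′ ∣     ≤⟨ lipschitz ⟩
      L * ∣ p - q ∣  ≤⟨ ℚ.*-monoˡ-≤-nonNeg L {{nonNegative 0≤L}} (ℚ.<⇒≤ pq<) ⟩
      L * δ          ≤⟨ Lδ≤ ⟩
      third ε        ∎

  cos-isCauchy : ∀ {x} → IsCauchy x → IsCauchy (λ n → cosSum n (x n))
  cos-isCauchy {x} x-cauchy ε 0<ε =
    let b , N₁ , x-bound = eventually-bounded x-cauchy
        N₂ , b≤N₂ , small = majorant-small b {third ε} (third-pos 0<ε)
        _ , L , _ , 0≤L , _ , lipschitz = BL-cosSum (0≤fromℕ b) N₂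
        δ , 0<δ , Lδ≤ = shrink {L} {third ε} 0≤L (third-pos 0<ε)
        N₃ , close = x-cauchy δ 0<δ
        N = N₂ ℕ.⊔ N₃
    in N₁ ℕ.⊔ N , λ m n m≥ n≥ →
      let m₁ = x-bound m (ℕ.m⊔n≤o⇒m≤o N₁ N m≥)
          n₁ = x-bound n (ℕ.m⊔n≤o⇒m≤o N₁ N n≥)
          m₂₃ = ℕ.m⊔n≤o⇒n≤o N₁ N m≥
          n₂₃ = ℕ.m⊔n≤o⇒n≤o N₁ N n≥
      in cos-close {b} {N₂} {L} {δ} {ε} {m} {n} (x m) (x n)
           b≤N₂ (ℕ.m⊔n≤o⇒m≤o N₂ N₃ m₂₃) (ℕ.m⊔n≤o⇒m≤o N₂ N₃ n₂₃)
           small 0≤L Lδ≤ (lipschitz (x m) (x n) m₁ n₁) m₁ n₁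
           (close m n (ℕ.m⊔n≤o⇒n≤o N₂ N₃ m₂₃) (ℕ.m⊔n≤o⇒n≤o N₂ N₃ n₂₃))

open Estimates using (IsCauchy; const-isCauchy; +-isCauchy; *-isCauchy; cos-isCauchy)

record ℝ : Set where
  constructor mkℝ
  field
    seq      : ℕ → ℚ
    isCauchy : IsCauchy seq

open ℝ public

infix  4 _≃_ _<_
infixl 6 _+_
infixl 7 _*_

_≃_ : ℝ → ℝ → Set
x ≃ y = ∀ ε → 0ℚ ℚ.< ε →
  ∃ λ N → ∀ n → N ℕ.≤ n → ℚ.∣ seq x n ℚ.- seq y n ∣ ℚ.< ε

_<_ : ℝ → ℝ → Set
x < y = ∃ λ ε → 0ℚ ℚ.< ε ×
  ∃ λ N → ∀ n → N ℕ.≤ n → seq x n ℚ.+ ε ℚ.< seq y n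

fromℚ : ℚ → ℝ
fromℚ q = mkℝ (λ _ → q) (const-isCauchy q)

fromℤ : ℤ → ℝ
fromℤ k = fromℚ (k ℚ./ 1)

0ℝ 1ℝ 2ℝ : ℝ
0ℝ = fromℤ (+ 0)
1ℝ = fromℤ (+ 1)
2ℝ = fromℤ (+ 2)

_+_ : ℝ → ℝ → ℝ
x + y = mkℝ (λ n → seq x n ℚ.+ seq y n) (+-isCauchy {seq x} {seq y} (isCauchy x) (isCauchy y))

_*_ : ℝ → ℝ → ℝ
x * y = mkℝ (λ n → seq x n ℚ.* seq y n) (*-isCauchy {seq x} {seq y} (isCauchy x) (isCauchy y))

+-*-rawSemiring : RawSemiring 0ℓ 0ℓ
+-*-rawSemiring = record
  { Carrier = ℝ
  ; _≈_     = _≃_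
  ; _+_     = _+_
  ; _*_     = _*_
  ; 0#      = 0ℝ
  ; 1#      = 1ℝ
  }

open import Algebra.Definitions.RawSemiring +-*-rawSemiring public using (_^_)

-- The series is evaluated diagonally: its n-th partial sum is taken at the
-- n-th approximation of x.
cos : ℝ → ℝ
cos x = mkℝ (λ n → cosSum n (seq x n)) (cos-isCauchy {seq x} (isCauchy x))

-- π is twice the least positive zero of the cosine, which determines it up
-- to _≃_; negated equality suffices for minimality since _≃_ is ¬¬-stable.
record IsPi (π : ℝ) : Set where
  field
    positive  : 0ℝ < π
    cos[π/2]  : cos (π * fromℚ ½) ≃ 0ℝ
    leastZero : ∀ t → 0ℝ < t → t < π * fromℚ ½ → ¬ (cos t ≃ 0ℝ)

2cos[_/_] : ℝ → (p : ℕ) → .{{ℕ.NonZero p}} → ℝ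
2cos[ π / p ] = 2ℝ * cos (π * fromℚ ((+ 1) ℚ./ p))

IsInteger : ℝ → Set
IsInteger x = ∃ λ (k : ℤ) → x ≃ fromℤ k

{-# OPTIONS --safe #-}

-- Write λ = 2 cos (π / p). For each admissible p some positive power λ ^ e divides in ℤ[λ]
-- a positive integer t such that λ ^ e > t:
--   * if p = 2h + 1, then λ is a unit: cos ((2h + 1) φ) / cos φ is an integer polynomial in
--     2 cos 2φ with constant term ± 1, and it vanishes at φ = π / 2p;
--   * if 4 ∣ p, then λ ^ 2 ∣ 2, because 2 cos ((p / 2) φ) is an even integer polynomial in
--     2 cos φ with constant term ± 2, and it vanishes at φ = π / p;
--   * if p = 2 (2h + 1), then λ ^ 2h ∣ 2h + 1, since ± (2h + 1) is the product of the numbers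
--     (2 cos (j π / p)) ^ 2 with j < 2h + 1 odd, each divisible by λ ^ 2.
-- If λ ^ m = k ∈ ℤ, taking m-th powers gives k ^ e ∣ t ^ m, first in ℤ[λ] and then, ℤ[λ] being a
-- finitely generated ℤ-module, in ℤ. Hence λ ^ em = k ^ e ≤ t ^ m, contradicting λ ^ e > t.
-- The size of λ comes from π / 2 ≤ 17 / 10, that is, from an actual zero of the cosine in
-- [3/2, 17/10], obtained by iterating the contractions x ↦ x + (n-th partial sum of cos at x).

module Submission where

open import Defs hiding (_+_; _*_; _<_; _^_)

open import Algebra.Bundles using (CommutativeRing)
open import Algebra.Morphism.Structures using (module RingMorphisms)
import Algebra.Properties.CommutativeSemiring.Exp
import Algebra.Properties.Ring
import Algebra.Properties.Semiring.Exp
import Algebra.Solver.Ring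
import Algebra.Solver.Ring.AlmostCommutativeRing as ACR
open import Data.Integer.Base as ℤ using (ℤ; +_)
import Data.Integer.Properties as ℤ
open import Data.List.Base using (List; []; _∷_)
open import Data.List.Relation.Unary.All as All using (All; []; _∷_)
open import Data.Maybe.Base as Maybe using (Maybe)
open import Data.Nat.Base as ℕ using (ℕ; zero; suc)
import Data.Nat.Coprimality as ℕ
import Data.Nat.Divisibility as ℕ
import Data.Nat.DivMod as ℕ
import Data.Nat.GCD as ℕ
import Data.Nat.Properties as ℕ
open import Data.Nat.Solver using () renaming (module +-*-Solver to ℕ-Solver)
open import Data.Product.Base using (∃; ∃₂; _×_; _,_; proj₁; proj₂)
open import Data.Rational.Base as ℚ using (ℚ; 0ℚ; 1ℚ; ½; ∣_∣)
import Data.Rational.Properties as ℚ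
import Data.Rational.Solver as ℚSolver
import Data.Rational.Unnormalised.Base as ℚᵘ
import Data.Rational.Unnormalised.Properties as ℚᵘ
open import Data.Sum.Base using (_⊎_; inj₁; inj₂)
open import Level using (0ℓ)
import Relation.Binary.Reasoning.Setoid
open import Relation.Binary.PropositionalEquality as ≡ using (_≡_; _≢_; cong; cong₂; subst)
open import Relation.Nullary using (¬_; Dec; yes; no; contradiction)
open import Relation.Nullary.Decidable using (dec⇒maybe; from-yes)

open import Algebra.Definitions.RawSemiring ℚ.+-*-rawSemiring using () renaming (_^_ to _^ℚ_)
open ℕ-Solver using () renaming (solve to ℕ-solve; _:+_ to _⊕ℕ_; _:*_ to _⊛ℕ_; con to κ; _:=_ to _⊜_)

-- The inequality λ ^ e > t is split at the rational 3/2: λ ≥ 3/2 holds for every p ≥ 5, while t <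
-- (3/2) ^ e is checked in ℕ as t 2 ^ e < 3 ^ e. The margin is thin (80 < 81 for p = 10) and
-- explains the exclusions: 2 cos (π / 4) = √2 is below 3/2, and p = 6 would give t = 3 > 9/4.
-- Comparison of reals is undecidable, so decisions are taken on rational approximations, and
-- nonvanishing enters only as a negation. Minimality of π / 2 excludes zeros but yields no bound by
-- itself: bounding π from above requires exhibiting a zero. A contraction supplies one as a Cauchy
-- sequence, where bisection would need signs of reals. The angles run in steps of π / 2p rather
-- than π / p, because the odd case divides by cos (π / 2p). The algebra then uses only 2 cos 0 = 2,
-- the product formula, and the fact that the first zero has index p.

parity : ∀ n → ∃ λ h → n ≡ 2 ℕ.* h ⊎ n ≡ 1 ℕ.+ 2 ℕ.* h
parity zero    = 0 , inj₁ ≡.refl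
parity (suc n) with parity n
... | h , inj₁ ≡.refl = h , inj₂ ≡.refl
... | h , inj₂ ≡.refl = suc h , inj₁ (≡.sym (ℕ.*-suc 2 h))

-- The inequality t < (3/2) ^ e for p = 2 (2n + 1), where t = 2n + 1 and e = 2n. It starts at n = 2
-- with 80 < 81; at n = 1 it would read 12 < 9.
[1+2n]*4ⁿ<9ⁿ : ∀ i → let n = 2 ℕ.+ i in (1 ℕ.+ (n ℕ.+ n)) ℕ.* 2 ℕ.^ (n ℕ.+ n) ℕ.< 3 ℕ.^ (n ℕ.+ n)
[1+2n]*4ⁿ<9ⁿ zero    = ℕ.n<1+n 80
[1+2n]*4ⁿ<9ⁿ (suc i) = begin-strict
  (2 ℕ.+ (n ℕ.+ suc n)) ℕ.* 2 ℕ.^ (suc n ℕ.+ suc n)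
    ≡⟨ cong (λ k → (2 ℕ.+ k) ℕ.* 2 ℕ.^ suc k) (ℕ.+-suc n n) ⟩
  (3 ℕ.+ (n ℕ.+ n)) ℕ.* (2 ℕ.* (2 ℕ.* 2 ℕ.^ (n ℕ.+ n)))
    -- The slack is 9 (1 + 2n) - 4 (3 + 2n) = 10n - 3, rewritten with n = 2 + i.
    ≤⟨ ℕ.m≤m+n _ ((17 ℕ.+ 10 ℕ.* i) ℕ.* P) ⟩
  (3 ℕ.+ (n ℕ.+ n)) ℕ.* (2 ℕ.* (2 ℕ.* P)) ℕ.+ (17 ℕ.+ 10 ℕ.* i) ℕ.* P
    ≡⟨ ℕ-solve 2 (λ i P → let n = κ 2 ⊕ℕ i in
         (κ 3 ⊕ℕ (n ⊕ℕ n)) ⊛ℕ (κ 2 ⊛ℕ (κ 2 ⊛ℕ P)) ⊕ℕ (κ 17 ⊕ℕ κ 10 ⊛ℕ i) ⊛ℕ P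
           ⊜ κ 9 ⊛ℕ ((κ 1 ⊕ℕ (n ⊕ℕ n)) ⊛ℕ P)) ≡.refl i P ⟩
  9 ℕ.* ((1 ℕ.+ (n ℕ.+ n)) ℕ.* P)
    <⟨ ℕ.*-monoʳ-< 9 ([1+2n]*4ⁿ<9ⁿ i) ⟩
  9 ℕ.* 3 ℕ.^ (n ℕ.+ n)
    ≡⟨ ℕ.*-assoc 3 3 (3 ℕ.^ (n ℕ.+ n)) ⟩
  3 ℕ.^ (2 ℕ.+ (n ℕ.+ n))
    ≡⟨ cong (λ k → 3 ℕ.^ suc k) (ℕ.+-suc n n) ⟨
  3 ℕ.^ (suc n ℕ.+ suc n) ∎
  where
  open ℕ.≤-Reasoning
  n = 2 ℕ.+ i
  P = 2 ℕ.^ (n ℕ.+ n)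

[m*n]^o≡m^o*n^o : ∀ m n o → (m ℕ.* n) ℕ.^ o ≡ m ℕ.^ o ℕ.* n ℕ.^ o
[m*n]^o≡m^o*n^o m n zero    = ≡.refl
[m*n]^o≡m^o*n^o m n (suc o) = ≡.trans (cong (m ℕ.* n ℕ.*_) ([m*n]^o≡m^o*n^o m n o))
  (ℕ-solve 4 (λ m n p q → m ⊛ℕ n ⊛ℕ (p ⊛ℕ q) ⊜ m ⊛ℕ p ⊛ℕ (n ⊛ℕ q)) ≡.refl m n (m ℕ.^ o) (n ℕ.^ o))

-- Taking e-th roots of k ^ e ≤ t ^ m < (3/2) ^ em gives k < (3/2) ^ m. Strictness survives the m-th
-- power because m is nonzero.
kᵉ≤tᵐ⇒k*2ᵐ<3ᵐ : ∀ k t e m .{{_ : ℕ.NonZero m}} → t ℕ.* 2 ℕ.^ e ℕ.< 3 ℕ.^ e → k ℕ.^ e ℕ.≤ t ℕ.^ m →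
               k ℕ.* 2 ℕ.^ m ℕ.< 3 ℕ.^ m
kᵉ≤tᵐ⇒k*2ᵐ<3ᵐ k t e m t*2ᵉ<3ᵉ kᵉ≤tᵐ = ℕ.≰⇒> λ 3ᵐ≤k*2ᵐ → ℕ.<⇒≱ (ℕ.^-monoˡ-< m t*2ᵉ<3ᵉ) (begin
  (3 ℕ.^ e) ℕ.^ m                ≡⟨ ^-swap 3 e m ⟩
  (3 ℕ.^ m) ℕ.^ e                ≤⟨ ℕ.^-monoˡ-≤ e 3ᵐ≤k*2ᵐ ⟩
  (k ℕ.* 2 ℕ.^ m) ℕ.^ e          ≡⟨ [m*n]^o≡m^o*n^o k (2 ℕ.^ m) e ⟩
  k ℕ.^ e ℕ.* (2 ℕ.^ m) ℕ.^ e    ≤⟨ ℕ.*-monoˡ-≤ ((2 ℕ.^ m) ℕ.^ e) kᵉ≤tᵐ ⟩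
  t ℕ.^ m ℕ.* (2 ℕ.^ m) ℕ.^ e    ≡⟨ cong (t ℕ.^ m ℕ.*_) (^-swap 2 m e) ⟩
  t ℕ.^ m ℕ.* (2 ℕ.^ e) ℕ.^ m    ≡⟨ [m*n]^o≡m^o*n^o t (2 ℕ.^ e) m ⟨
  (t ℕ.* 2 ℕ.^ e) ℕ.^ m          ∎)
  where
  open ℕ.≤-Reasoning
  ^-swap : ∀ a i j → (a ℕ.^ i) ℕ.^ j ≡ (a ℕ.^ j) ℕ.^ i
  ^-swap a i j = ≡.trans (ℕ.^-*-assoc a i j)
    (≡.trans (cong (a ℕ.^_) (ℕ.*-comm i j)) (≡.sym (ℕ.^-*-assoc a j i)))

factor-gcd : ∀ m n .{{_ : ℕ.NonZero m}} → ∃ λ g → ∃₂ λ m′ n′ →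
             ℕ.NonZero g × m ≡ m′ ℕ.* g × n ≡ n′ ℕ.* g × ℕ.Coprime m′ n′
factor-gcd m n = g , m ℕ./ g , n ℕ./ g , ℕ.≢-nonZero (ℕ.gcd[m,n]≢0 m n (inj₁ (ℕ.≢-nonZero⁻¹ m))) ,
  ≡.sym (ℕ.m/n*n≡m (ℕ.gcd[m,n]∣m m n)) , ≡.sym (ℕ.m/n*n≡m (ℕ.gcd[m,n]∣n m n)) , ℕ.coprime-/gcd m n
  where
  g = ℕ.gcd m n
  instance
    g≢0 : ℕ.NonZero g
    g≢0 = ℕ.≢-nonZero (ℕ.gcd[m,n]≢0 m n (inj₁ (ℕ.≢-nonZero⁻¹ m)))

-- By Euclid's lemma the factors t can be discarded from the divisibility one at a time, until k
-- divides 1.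
∣power⇒≡1 : ∀ {k t} n {b} → ℕ.Coprime k t → (+ t) ℤ.^ n ≡ + k ℤ.* b → k ≡ 1
∣power⇒≡1 {k} {t} n {b} coprime eq = ℕ.∣1⇒≡1 (reduce n
  (subst (λ z → k ℕ.∣ ℤ.∣ z ∣) (≡.sym eq)
    (subst (k ℕ.∣_) (≡.sym (ℤ.∣i*j∣≡∣i∣*∣j∣ (+ k) b)) (ℕ.m∣m*n ℤ.∣ b ∣))))
  where
  reduce : ∀ n → k ℕ.∣ ℤ.∣ (+ t) ℤ.^ n ∣ → k ℕ.∣ 1
  reduce zero    k∣ = k∣
  reduce (suc n) k∣ = reduce n (ℕ.coprime-divisor coprime
    (subst (k ℕ.∣_) (ℤ.∣i*j∣≡∣i∣*∣j∣ (+ t) ((+ t) ℤ.^ n)) k∣))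

-- Integrality over ℤ in a commutative ring of characteristic zero

module CharacteristicZero
  (R : CommutativeRing 0ℓ 0ℓ)
  (ι : ℤ → CommutativeRing.Carrier R)
  (ι-isRingMonomorphism : RingMorphisms.IsRingMonomorphism ℤ.+-*-rawRing (CommutativeRing.rawRing R) ι)
  where

  open CommutativeRing R
  open RingMorphisms.IsRingMonomorphism ι-isRingMonomorphism
    renaming (injective to ι-injective; ⟦⟧-cong to ι-cong)
  open Algebra.Properties.CommutativeSemiring.Exp commutativeSemiring using (^-distrib-*)
  open Algebra.Properties.Semiring.Exp semiring
  open Algebra.Properties.Ring ring using (-0#≈0#; -‿involutive)
  open Relation.Binary.Reasoning.Setoid setoid

  private
    ι-morphism : ℤ.+-*-rawRing ACR.-Raw-AlmostCommutative⟶ ACR.fromCommutativeRing R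
    ι-morphism = record
      { ⟦_⟧ = ι ; +-homo = +-homo ; *-homo = *-homo ; -‿homo = -‿homo
      ; 0-homo = 0#-homo ; 1-homo = 1#-homo }

    ι≈? : ∀ a b → Maybe (ι a ≈ ι b)
    ι≈? a b = Maybe.map (λ a≡b → ι-cong a≡b) (dec⇒maybe (a ℤ.≟ b))

  open Algebra.Solver.Ring ℤ.+-*-rawRing (ACR.fromCommutativeRing R) ι-morphism ι≈?
    using (solve; _:+_; _:*_; _:-_; :-_; _:=_; con)

  -- The generator `w` is kept apart from the list: elimination removes all the others and must end
  -- with a relation on `w` alone.
  data Span (w : Carrier) : List Carrier → Carrier → Set where
    base : ∀ {y} a → y ≈ ι a * w → Span w [] y
    cons : ∀ {y v vs} a z → Span w vs z → y ≈ ι a * v + z → Span w (v ∷ vs) y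

  module _ {w : Carrier} where

    span-resp : ∀ {vs y z} → y ≈ z → Span w vs y → Span w vs z
    span-resp y≈z (base a y≈)     = base a (trans (sym y≈z) y≈)
    span-resp y≈z (cons a u s y≈) = cons a u s (trans (sym y≈z) y≈)

    span-+ : ∀ {vs y z} → Span w vs y → Span w vs z → Span w vs (y + z)
    span-+ {_} {y} {z} (base a y≈) (base b z≈) = base (a ℤ.+ b) (begin
      y + z              ≈⟨ +-cong y≈ z≈ ⟩
      ι a * w + ι b * w  ≈⟨ distribʳ w (ι a) (ι b) ⟨
      (ι a + ι b) * w    ≈⟨ *-congʳ (+-homo a b) ⟨
      ι (a ℤ.+ b) * w    ∎)
    span-+ {v ∷ _} {y} {z} (cons a y′ s y≈) (cons b z′ t z≈) =
      cons (a ℤ.+ b) (y′ + z′) (span-+ s t) (begin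
        y + z                              ≈⟨ +-cong y≈ z≈ ⟩
        (ι a * v + y′) + (ι b * v + z′)    ≈⟨ solve 5 (λ a b v y z → (a :* v :+ y) :+ (b :* v :+ z) := (a :+ b) :* v :+ (y :+ z)) refl (ι a) (ι b) v y′ z′ ⟩
        (ι a + ι b) * v + (y′ + z′)        ≈⟨ +-congʳ (*-congʳ (+-homo a b)) ⟨
        ι (a ℤ.+ b) * v + (y′ + z′)        ∎)

    span-ι* : ∀ {vs y} c → Span w vs y → Span w vs (ι c * y)
    span-ι* {_} {y} c (base a y≈) = base (c ℤ.* a) (begin
      ι c * y          ≈⟨ *-congˡ y≈ ⟩
      ι c * (ι a * w)  ≈⟨ *-assoc (ι c) (ι a) w ⟨
      ι c * ι a * w    ≈⟨ *-congʳ (*-homo c a) ⟨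
      ι (c ℤ.* a) * w  ∎)
    span-ι* {v ∷ _} {y} c (cons a y′ s y≈) = cons (c ℤ.* a) (ι c * y′) (span-ι* c s) (begin
      ι c * y                     ≈⟨ *-congˡ y≈ ⟩
      ι c * (ι a * v + y′)        ≈⟨ solve 4 (λ c a v y → c :* (a :* v :+ y) := c :* a :* v :+ c :* y) refl (ι c) (ι a) v y′ ⟩
      ι c * ι a * v + ι c * y′    ≈⟨ +-congʳ (*-congʳ (*-homo c a)) ⟨
      ι (c ℤ.* a) * v + ι c * y′  ∎)

    span-weaken : ∀ {v vs y} → Span w vs y → Span w (v ∷ vs) y
    span-weaken {v} {_} {y} s = cons (+ 0) y s
      (solve 2 (λ v y → y := con (+ 0) :* v :+ y) refl v y)

    span-0 : ∀ {vs} → Span w vs (ι (+ 0) * w)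
    span-0 {[]}     = base (+ 0) refl
    span-0 {v ∷ vs} = span-weaken span-0

    span-last : ∀ {vs} → Span w vs w
    span-last {[]}     = base (+ 1) (solve 1 (λ w → w := con (+ 1) :* w) refl w)
    span-last {v ∷ vs} = span-weaken span-last

    span-head : ∀ {v vs} → Span w (v ∷ vs) v
    span-head {v} = cons (+ 1) (ι (+ 0) * w) span-0
      (solve 2 (λ v w → v := con (+ 1) :* v :+ con (+ 0) :* w) refl v w)

    span-members : ∀ vs → All (Span w vs) vs
    span-members []       = []
    span-members (v ∷ vs) = span-head ∷ All.map span-weaken (span-members vs)

    -- Membership of s v in K · Span, the entrywise form of a matrix congruent
    -- to the scalar s modulo K that annihilates the generators.
    ScaledInto : ℤ → List Carrier → ℤ → Carrier → Set
    ScaledInto K vs s v = ∃ λ y → Span w vs y × ι s * v ≈ ι K * y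

    -- Eliminating u by means of (s - K b) u = K z.
    eliminate : ∀ {K u vs s v} → ScaledInto K (u ∷ vs) s u → Span w vs v →
                ScaledInto K (u ∷ vs) s v → ScaledInto K vs (s ℤ.* s) v
    eliminate {K} {u} {vs} {s} {v} (y , cons b z sz y≈ , su≈) sv (y′ , cons c z′ sz′ y′≈ , sv≈) =
      Y , span-Y , (begin
      ι (s ℤ.* s) * v                          ≈⟨ *-congʳ (*-homo s s) ⟩
      ι s * ι s * v                            ≈⟨ *-assoc (ι s) (ι s) v ⟩
      ι s * (ι s * v)                          ≈⟨ *-congˡ sv≈′ ⟩
      ι s * (ι K * (ι c * u + z′))             ≈⟨ solve 5 (λ s k c u z′ → s :* (k :* (c :* u :+ z′)) := k :* (c :* (s :* u) :+ s :* z′)) refl (ι s) (ι K) (ι c) u z′ ⟩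
      ι K * (ι c * (ι s * u) + ι s * z′)       ≈⟨ *-congˡ (+-congʳ (*-congˡ su≈′)) ⟩
      ι K * (ι c * (ι K * (ι b * u + z)) + ι s * z′)
        ≈⟨ solve 7 (λ s k c b u z z′ → k :* (c :* (k :* (b :* u :+ z)) :+ s :* z′)
             := k :* (b :* (k :* (c :* u :+ z′)) :+ (c :* (k :* z) :+ (s :* z′ :+ (:- b) :* (k :* z′)))))
             refl (ι s) (ι K) (ι c) (ι b) u z z′ ⟩
      ι K * (ι b * (ι K * (ι c * u + z′)) + (ι c * (ι K * z) + (ι s * z′ + - ι b * (ι K * z′))))
        ≈⟨ *-congˡ (+-cong (*-congˡ (sym sv≈′)) (+-congˡ (+-congˡ (*-congʳ (sym (-‿homo b)))))) ⟩
      ι K * Y ∎)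
      where
      -- After one substitution `u` survives only in `K c u`, which equals `s v - K z′`; it is
      -- traded for `v`, which lies in the smaller span.
      Y = ι b * (ι s * v) + (ι c * (ι K * z) + (ι s * z′ + ι (ℤ.- b) * (ι K * z′)))
      span-Y : Span w vs Y
      span-Y = span-+ (span-ι* b (span-ι* s sv))
        (span-+ (span-ι* c (span-ι* K sz)) (span-+ (span-ι* s sz′) (span-ι* (ℤ.- b) (span-ι* K sz′))))
      su≈′ : ι s * u ≈ ι K * (ι b * u + z)
      su≈′ = trans su≈ (*-congˡ y≈)
      sv≈′ : ι s * v ≈ ι K * (ι c * u + z′)
      sv≈′ = trans sv≈ (*-congˡ y′≈)

    -- Stands in for the determinant of a matrix congruent to the scalar `s` modulo `K`: each
    -- eliminated generator squares the scalar, and a single relation on `w` remains.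
    eliminate-all : ∀ {K} vs s → All (ScaledInto K vs s) vs → ScaledInto K vs s w →
                    ∃₂ λ n b → ι (s ℤ.^ n) * w ≈ ι K * (ι b * w)
    eliminate-all []       s _ (y , base b y≈ , sw≈) =
      1 , b , trans (*-congʳ (ι-cong (ℤ.*-identityʳ s))) (trans sw≈ (*-congˡ y≈))
    eliminate-all {K} (u ∷ vs) s (du ∷ dvs) dw =
      let n , b , eq = eliminate-all {K} vs (s ℤ.* s)
            (All.zipWith (λ (sv , dv) → eliminate du sv dv) (span-members vs , dvs))
            (eliminate du span-last dw)
      in n ℕ.+ n , b , trans (*-congʳ (ι-cong (s^[n+n] n))) eq
      where
      s^[n+n] : ∀ n → s ℤ.^ (n ℕ.+ n) ≡ (s ℤ.* s) ℤ.^ n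
      s^[n+n] zero    = ≡.refl
      s^[n+n] (suc n) = ≡.trans (cong (λ k → s ℤ.* s ℤ.^ k) (ℕ.+-suc n n))
        (≡.trans (≡.sym (ℤ.*-assoc s s _)) (cong (s ℤ.* s ℤ.*_) (s^[n+n] n)))

  -- The subring is given by closure rules, without a normal form, since the action of an element on
  -- a span is found by recursion on its derivation.
  data ℤ[_] (x : Carrier) : Carrier → Set where
    int  : ∀ a → ℤ[ x ] (ι a)
    gen  : ℤ[ x ] x
    _⊕_  : ∀ {a b} → ℤ[ x ] a → ℤ[ x ] b → ℤ[ x ] (a + b)
    _⊗_  : ∀ {a b} → ℤ[ x ] a → ℤ[ x ] b → ℤ[ x ] (a * b)
    resp : ∀ {a b} → a ≈ b → ℤ[ x ] a → ℤ[ x ] b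

  -- Highest power first, so that multiplication by `x` creates one new head; 1 is the separate
  -- generator of `Span`, to which a relation x ^ (n + 1) = k folds that head back.
  powers : Carrier → ℕ → List Carrier
  powers x zero    = []
  powers x (suc n) = x ^ suc n ∷ powers x n

  module _ {x : Carrier} where

    gen*-span-suc : ∀ n {y} → Span 1# (powers x n) y → Span 1# (powers x (suc n)) (x * y)
    gen*-span-suc zero {y} (base a y≈) = cons a (ι (+ 0) * 1#) (base (+ 0) refl)
      (trans (*-congˡ y≈) (solve 3 (λ x a o → x :* (a :* o) := a :* (x :* o) :+ con (+ 0) :* o) refl x (ι a) 1#))
    gen*-span-suc (suc n) (cons a z s y≈) = cons a (x * z) (gen*-span-suc n s)
      (trans (*-congˡ y≈) (solve 4 (λ x a v z → x :* (a :* v :+ z) := a :* (x :* v) :+ x :* z) refl x (ι a) (x ^ suc n) z))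

    module _ {k : ℤ} (n : ℕ) (x^[1+n]≈k : x ^ suc n ≈ ι k) where

      gen*-span : ∀ {y} → Span 1# (powers x n) y → Span 1# (powers x n) (x * y)
      gen*-span s with gen*-span-suc n s
      ... | cons a z s′ xy≈ = span-resp (sym (trans xy≈ (+-congʳ (begin
        ι a * x ^ suc n   ≈⟨ *-congˡ x^[1+n]≈k ⟩
        ι a * ι k         ≈⟨ *-congˡ (*-identityʳ (ι k)) ⟨
        ι a * (ι k * 1#)  ∎)))) (span-+ (span-ι* a (span-ι* k span-last)) s′)

      ℤ[]*-span : ∀ {β y} → ℤ[ x ] β → Span 1# (powers x n) y → Span 1# (powers x n) (β * y)
      ℤ[]*-span (int a)          s = span-ι* a s
      ℤ[]*-span gen              s = gen*-span s
      ℤ[]*-span {y = y} (_⊕_ {a} {b} p q) s = span-resp (sym (distribʳ y a b)) (span-+ (ℤ[]*-span p s) (ℤ[]*-span q s))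
      ℤ[]*-span {y = y} (_⊗_ {a} {b} p q) s = span-resp (sym (*-assoc a b y)) (ℤ[]*-span p (ℤ[]*-span q s))
      ℤ[]*-span (resp a≈b p)     s = span-resp (*-congʳ a≈b) (ℤ[]*-span p s)

      -- The span of 1, ..., x ^ n is stable under β, so T = K β maps it into K times itself.
      -- Elimination then makes a power of T divisible by K, not yet T itself.
      quotient⇒∣power : ∀ {β} K T → ℤ[ x ] β → ι T ≈ ι K * β → ∃₂ λ N b → T ℤ.^ N ≡ K ℤ.* b
      quotient⇒∣power {β} K T β∈ T≈Kβ =
        let N , b , eq = eliminate-all {1#} {K} (powers x n) T
              (All.map scaled (span-members (powers x n))) (scaled span-last)
        in N , b , ι-injective (begin
          ι (T ℤ.^ N)       ≈⟨ *-identityʳ (ι (T ℤ.^ N)) ⟨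
          ι (T ℤ.^ N) * 1#  ≈⟨ eq ⟩
          ι K * (ι b * 1#)  ≈⟨ *-congˡ (*-identityʳ (ι b)) ⟩
          ι K * ι b         ≈⟨ *-homo K b ⟨
          ι (K ℤ.* b)       ∎)
        where
        scaled : ∀ {v} → Span 1# (powers x n) v → ScaledInto {1#} K (powers x n) T v
        scaled {v} s = β * v , ℤ[]*-span β∈ s , trans (*-congʳ T≈Kβ) (*-assoc (ι K) β v)

  ι-^ : ∀ k n → ι (+ (k ℕ.^ n)) ≈ ι (+ k) ^ n
  ι-^ k zero    = 1#-homo
  ι-^ k (suc n) = trans (ι-cong (ℤ.pos-* k (k ℕ.^ n)))
    (trans (*-homo (+ k) (+ (k ℕ.^ n))) (*-congˡ (ι-^ k n)))

  ℤ[]-^ : ∀ {x g} n → ℤ[ x ] g → ℤ[ x ] (g ^ n)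
  ℤ[]-^ zero    g∈ = resp 1#-homo (int (+ 1))
  ℤ[]-^ (suc n) g∈ = g∈ ⊗ ℤ[]-^ n g∈

  x-y≈0⇒x≈y : ∀ {x y} → x - y ≈ 0# → x ≈ y
  x-y≈0⇒x≈y {x} {y} eq = trans (solve 2 (λ x y → x := x :- y :+ y) refl x y)
    (trans (+-congʳ eq) (+-identityˡ y))

  -- Polynomials, division by roots, and the polynomials V

  -- Poly b n f: f is a polynomial of formal degree n with leading coefficient b, in Horner form.
  data Poly (b : Carrier) : ℕ → (Carrier → Carrier) → Set where
    const  : ∀ {f} → (∀ z → f z ≈ b) → Poly b 0 f
    horner : ∀ {n f g} a → Poly b n g → (∀ z → f z ≈ a + z * g z) → Poly b (suc n) f

  poly-resp : ∀ {b c n f g} → b ≈ c → (∀ z → f z ≈ g z) → Poly b n f → Poly c n g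
  poly-resp b≈c f≈g (const f≈)      = const λ z → trans (sym (f≈g z)) (trans (f≈ z) b≈c)
  poly-resp b≈c f≈g (horner a p f≈) = horner a (poly-resp b≈c (λ _ → refl) p) λ z → trans (sym (f≈g z)) (f≈ z)

  poly-+ : ∀ {b c n f g} → Poly b n f → Poly c n g → Poly (b + c) n (λ z → f z + g z)
  poly-+ (const f≈) (const g≈) = const λ z → +-cong (f≈ z) (g≈ z)
  poly-+ (horner {g = f′} a p f≈) (horner {g = g′} a′ q g≈) = horner (a + a′) (poly-+ p q) λ z →
    trans (+-cong (f≈ z) (g≈ z))
      (solve 5 (λ a b z p q → (a :+ z :* p) :+ (b :+ z :* q) := (a :+ b) :+ z :* (p :+ q)) refl a a′ z (f′ z) (g′ z))

  poly-neg : ∀ {b n f} → Poly b n f → Poly (- b) n (λ z → - f z)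
  poly-neg (const f≈) = const λ z → -‿cong (f≈ z)
  poly-neg (horner {g = f′} a p f≈) = horner (- a) (poly-neg p) λ z →
    trans (-‿cong (f≈ z)) (solve 3 (λ a z p → :- (a :+ z :* p) := :- a :+ z :* (:- p)) refl a z (f′ z))

  -- Padding with a zero top coefficient, because `poly-+` adds only polynomials of equal formal
  -- degree.
  poly-raise : ∀ {b n f} → Poly b n f → Poly (ι (+ 0)) (suc n) f
  poly-raise {b} {f = f} (const f≈) = horner b (const {f = λ _ → ι (+ 0)} λ _ → refl) λ z →
    trans (f≈ z) (solve 2 (λ b z → b := b :+ z :* con (+ 0)) refl b z)
  poly-raise (horner a p f≈) = horner a (poly-raise p) f≈

  -- Synthetic division. The quotient keeps the leading coefficient, so a monic polynomial stays
  -- monic while its roots are stripped off.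
  poly-divide : ∀ {b n f} → Poly b (suc n) f → ∀ y →
                ∃ λ q → Poly b n q × ∀ z → f z - f y ≈ (z - y) * q z
  poly-divide {b} {f = f} (horner {g = g} a (const g≈) f≈) y = (λ _ → b) , const (λ _ → refl) , λ z → begin
    f z - f y                        ≈⟨ +-cong (f≈ z) (-‿cong (f≈ y)) ⟩
    (a + z * g z) - (a + y * g y)    ≈⟨ +-cong (+-congˡ (*-congˡ (g≈ z))) (-‿cong (+-congˡ (*-congˡ (g≈ y)))) ⟩
    (a + z * b) - (a + y * b)        ≈⟨ solve 4 (λ a b z y → (a :+ z :* b) :- (a :+ y :* b) := (z :- y) :* b) refl a b z y ⟩
    (z - y) * b                      ∎
  poly-divide {f = f} (horner {g = g} a p@(horner _ _ _) f≈) y =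
    let q , q-poly , g-eq = poly-divide p y
    in (λ z → g y + z * q z) , horner (g y) q-poly (λ _ → refl) , λ z → begin
      f z - f y                        ≈⟨ +-cong (f≈ z) (-‿cong (f≈ y)) ⟩
      (a + z * g z) - (a + y * g y)    ≈⟨ solve 5 (λ a z y u v → (a :+ z :* u) :- (a :+ y :* v) := z :* (u :- v) :+ (z :- y) :* v) refl a z y (g z) (g y) ⟩
      z * (g z - g y) + (z - y) * g y  ≈⟨ +-congʳ (*-congˡ (g-eq z)) ⟩
      z * ((z - y) * q z) + (z - y) * g y
        ≈⟨ solve 4 (λ z y q v → z :* ((z :- y) :* q) :+ (z :- y) :* v := (z :- y) :* (v :+ z :* q)) refl z y (q z) (g y) ⟩
      (z - y) * (g y + z * q z)        ∎

  ∏ : ℕ → (ℕ → Carrier) → Carrier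
  ∏ zero    f = ι (+ 1)
  ∏ (suc n) f = f n * ∏ n f

  -- V n (2 cos 2φ) = cos ((2n + 1) φ) / cos φ
  V : ℕ → Carrier → Carrier
  V 0             z = ι (+ 1)
  V 1             z = z - ι (+ 1)
  V (suc (suc n)) z = z * V (suc n) z - V n z

  ±1 : ℕ → ℤ
  ±1 zero    = + 1
  ±1 (suc n) = ℤ.- ±1 n

  ι±1² : ∀ n → ι (±1 n) * ι (±1 n) ≈ ι (+ 1)
  ι±1² zero    = solve 0 (con (+ 1) :* con (+ 1) := con (+ 1)) refl
  ι±1² (suc n) = begin
    ι (ℤ.- ±1 n) * ι (ℤ.- ±1 n)  ≈⟨ *-cong (-‿homo (±1 n)) (-‿homo (±1 n)) ⟩
    - ι (±1 n) * - ι (±1 n)      ≈⟨ solve 1 (λ s → (:- s) :* (:- s) := s :* s) refl (ι (±1 n)) ⟩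
    ι (±1 n) * ι (±1 n)          ≈⟨ ι±1² n ⟩
    ι (+ 1)                      ∎

  V-poly : ∀ n → Poly (ι (+ 1)) n (V n)
  V-poly 0             = const λ _ → refl
  V-poly 1             = horner (- ι (+ 1)) (V-poly 0) λ z → solve 1 (λ z → z :- con (+ 1) := :- con (+ 1) :+ z :* con (+ 1)) refl z
  V-poly (suc (suc n)) = poly-resp
    (solve 0 (con (+ 1) :- con (+ 0) := con (+ 1)) refl)
    (λ z → +-congʳ (+-identityˡ (z * V (suc n) z)))
    (poly-+ (horner 0# (V-poly (suc n)) (λ _ → refl)) (poly-neg (poly-raise (poly-raise (V-poly n)))))

  ℤ[]-neg : ∀ {x a} → ℤ[ x ] a → ℤ[ x ] (- a)
  ℤ[]-neg {a = a} a∈ = resp (solve 1 (λ a → con (ℤ.- + 1) :* a := :- a) refl a) (int (ℤ.- + 1) ⊗ a∈)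

  infix 4 _∣[_]_
  _∣[_]_ : Carrier → Carrier → Carrier → Set
  a ∣[ x ] b = ∃ λ g → ℤ[ x ] g × a * g ≈ b

  V∈ : ∀ {x z} → ℤ[ x ] z → ∀ n → ℤ[ x ] (V n z)
  V∈ z∈ 0             = int (+ 1)
  V∈ z∈ 1             = z∈ ⊕ ℤ[]-neg (int (+ 1))
  V∈ z∈ (suc (suc n)) = (z∈ ⊗ V∈ z∈ (suc n)) ⊕ ℤ[]-neg (V∈ z∈ n)

  -- At 0 the recurrence reads V (n + 2) = - V n, so the constant terms are 1, -1, -1, 1, ... The
  -- exponent of the sign is left existential, as only its square will matter.
  V-constantTerm : ∀ x n → ∃ λ k → x ∣[ x ] (ι (±1 k) - V n x)
  V-constantTerm x 0 = 0 , ι (+ 0) , int (+ 0) , solve 1 (λ x → x :* con (+ 0) := con (+ 1) :- con (+ 1)) refl x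
  V-constantTerm x 1 = 1 , ι (ℤ.- + 1) , int (ℤ.- + 1) , solve 1 (λ x → x :* con (ℤ.- + 1) := con (ℤ.- + 1) :- (x :- con (+ 1))) refl x
  V-constantTerm x (suc (suc n)) =
    let k , g , g∈ , eq = V-constantTerm x n
    in suc k , - (V (suc n) x + g) , ℤ[]-neg (V∈ gen (suc n) ⊕ g∈) , (begin
      x * - (V (suc n) x + g)                      ≈⟨ solve 3 (λ x v g → x :* (:- (v :+ g)) := :- (x :* v) :- x :* g) refl x (V (suc n) x) g ⟩
      - (x * V (suc n) x) - x * g                  ≈⟨ +-congˡ (-‿cong eq) ⟩
      - (x * V (suc n) x) - (ι (±1 k) - V n x)     ≈⟨ solve 3 (λ u s v → :- u :- (s :- v) := :- s :- (u :- v)) refl (x * V (suc n) x) (ι (±1 k)) (V n x) ⟩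
      - ι (±1 k) - (x * V (suc n) x - V n x)       ≈⟨ +-congʳ (-‿homo (±1 k)) ⟨
      ι (±1 (suc k)) - (x * V (suc n) x - V n x)   ∎)

  -- The value at φ = π / 2, where cos ((2n + 1) φ) / cos φ tends to (-1) ^ n (2n + 1). This is the
  -- origin of the multiple 2h + 1.
  V[-2] : ∀ n → V n (ι (ℤ.- + 2)) ≈ ι (±1 n) * ι (+ (1 ℕ.+ (n ℕ.+ n)))
  V[-2] 0 = solve 0 (con (+ 1) := con (+ 1) :* con (+ 1)) refl
  V[-2] 1 = solve 0 (con (ℤ.- + 2) :- con (+ 1) := con (ℤ.- + 1) :* con (+ 3)) refl
  V[-2] (suc (suc n)) = begin
    ι (ℤ.- + 2) * V (suc n) z - V n z
      ≈⟨ +-cong (*-congˡ (trans (V[-2] (suc n)) (*-cong (-‿homo (±1 n)) (step n)))) (-‿cong (V[-2] n)) ⟩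
    ι (ℤ.- + 2) * (- s * (ι (+ 2) + t)) - s * t
      ≈⟨ solve 2 (λ s t → con (ℤ.- + 2) :* ((:- s) :* (con (+ 2) :+ t)) :- s :* t
           := (:- (:- s)) :* (con (+ 2) :+ (con (+ 2) :+ t))) refl s t ⟩
    - (- s) * (ι (+ 2) + (ι (+ 2) + t))
      ≈⟨ *-cong (trans (-‿homo (ℤ.- ±1 n)) (-‿cong (-‿homo (±1 n)))) (trans (step (suc n)) (+-congˡ (step n))) ⟨
    ι (±1 (2 ℕ.+ n)) * ι (+ (1 ℕ.+ (2 ℕ.+ n ℕ.+ (2 ℕ.+ n)))) ∎
    where
    z = ι (ℤ.- + 2)
    s = ι (±1 n)
    t = ι (+ (1 ℕ.+ (n ℕ.+ n)))
    step : ∀ n → ι (+ (1 ℕ.+ (suc n ℕ.+ suc n))) ≈ ι (+ 2) + ι (+ (1 ℕ.+ (n ℕ.+ n)))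
    step n = trans (ι-cong (cong (λ k → + (2 ℕ.+ k)) (ℕ.+-suc n n))) (+-homo (+ 2) (+ (1 ℕ.+ (n ℕ.+ n))))

  -- Sequences 2 cos (n φ) and their divisibility in ℤ[2 cos φ]

  -- A sequence of the form n ↦ 2 cos (n φ).
  record TwiceCosine (c : ℕ → Carrier) : Set where
    field
      c[0]    : c 0 ≈ ι (+ 2)
      product : ∀ m n → c (m ℕ.+ n ℕ.+ n) + c m ≈ c (m ℕ.+ n) * c n

    -- The case of step 1 in `product`, whose indices m + n + n and m are the sum and the difference
    -- of m + n and n without truncated subtraction.
    recurrence : ∀ n → c (suc (suc n)) ≈ c 1 * c (suc n) - c n
    recurrence n = begin
      c (suc (suc n))                ≡⟨ cong c (≡.sym (≡.trans (cong (ℕ._+ 1) (ℕ.+-comm n 1)) (ℕ.+-comm (suc n) 1))) ⟩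
      c (n ℕ.+ 1 ℕ.+ 1)              ≈⟨ solve 2 (λ a b → a := a :+ b :- b) refl (c (n ℕ.+ 1 ℕ.+ 1)) (c n) ⟩
      c (n ℕ.+ 1 ℕ.+ 1) + c n - c n  ≈⟨ +-congʳ (product n 1) ⟩
      c (n ℕ.+ 1) * c 1 - c n        ≈⟨ +-congʳ (*-comm (c (n ℕ.+ 1)) (c 1)) ⟩
      c 1 * c (n ℕ.+ 1) - c n        ≡⟨ cong (λ k → c 1 * c k - c n) (ℕ.+-comm n 1) ⟩
      c 1 * c (suc n) - c n          ∎

    c∈ : ∀ n → ℤ[ c 1 ] (c n)
    c∈ 0             = resp (sym c[0]) (int (+ 2))
    c∈ 1             = gen
    c∈ (suc (suc n)) = resp (sym (recurrence n)) ((gen ⊗ c∈ (suc n)) ⊕ ℤ[]-neg (c∈ n))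

    -- An odd-index term is an odd polynomial in `c 1`; going up two indices at a time, the
    -- recurrence only adds a multiple of `c 1`.
    c[odd] : ∀ n → c 1 ∣[ c 1 ] c (1 ℕ.+ 2 ℕ.* n)
    c[odd] zero    = ι (+ 1) , int (+ 1) , solve 1 (λ x → x :* con (+ 1) := x) refl (c 1)
    c[odd] (suc n) =
      let g , g∈ , eq = c[odd] n
      in c (2 ℕ.+ 2 ℕ.* n) - g , (c∈ (2 ℕ.+ 2 ℕ.* n) ⊕ ℤ[]-neg g∈) , (begin
        c 1 * (c (2 ℕ.+ 2 ℕ.* n) - g)                    ≈⟨ solve 3 (λ x a g → x :* (a :- g) := x :* a :- x :* g) refl (c 1) (c (2 ℕ.+ 2 ℕ.* n)) g ⟩
        c 1 * c (2 ℕ.+ 2 ℕ.* n) - c 1 * g                ≈⟨ +-congˡ (-‿cong eq) ⟩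
        c 1 * c (2 ℕ.+ 2 ℕ.* n) - c (1 ℕ.+ 2 ℕ.* n)      ≈⟨ recurrence (1 ℕ.+ 2 ℕ.* n) ⟨
        c (3 ℕ.+ 2 ℕ.* n)                                ≡⟨ cong (λ k → c (suc k)) (ℕ.*-suc 2 n) ⟨
        c (1 ℕ.+ 2 ℕ.* suc n)                            ∎)

    -- An even-index term is an even polynomial in `c 1` with constant term ± 2. The recurrence
    -- shows one factor `c 1`; `c[odd]` supplies the second.
    c[even] : ∀ n → c 1 * c 1 ∣[ c 1 ] (ι (±1 n) * ι (+ 2) - c (2 ℕ.* n))
    c[even] zero    = ι (+ 0) , int (+ 0) , (begin
      c 1 * c 1 * ι (+ 0)                  ≈⟨ solve 1 (λ x → x :* x :* con (+ 0) := con (+ 1) :* con (+ 2) :- con (+ 2)) refl (c 1) ⟩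
      ι (+ 1) * ι (+ 2) - ι (+ 2)          ≈⟨ +-congˡ (-‿cong c[0]) ⟨
      ι (+ 1) * ι (+ 2) - c 0              ∎)
    c[even] (suc n) =
      let g , g∈ , eq = c[even] n
          h , h∈ , eq′ = c[odd] n
      in - (h + g) , ℤ[]-neg (h∈ ⊕ g∈) , (begin
        c 1 * c 1 * - (h + g)                             ≈⟨ solve 3 (λ x h g → x :* x :* (:- (h :+ g)) := :- (x :* (x :* h)) :- x :* x :* g) refl (c 1) h g ⟩
        - (c 1 * (c 1 * h)) - c 1 * c 1 * g               ≈⟨ +-cong (-‿cong (*-congˡ eq′)) (-‿cong eq) ⟩
        - (c 1 * c (1 ℕ.+ 2 ℕ.* n)) - (ι (±1 n) * ι (+ 2) - c (2 ℕ.* n))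
          ≈⟨ solve 3 (λ a s b → :- a :- (s :* con (+ 2) :- b) := (:- s) :* con (+ 2) :- (a :- b)) refl (c 1 * c (1 ℕ.+ 2 ℕ.* n)) (ι (±1 n)) (c (2 ℕ.* n)) ⟩
        - ι (±1 n) * ι (+ 2) - (c 1 * c (1 ℕ.+ 2 ℕ.* n) - c (2 ℕ.* n))
          ≈⟨ +-cong (*-congʳ (-‿homo (±1 n))) (-‿cong (recurrence (2 ℕ.* n))) ⟨
        ι (±1 (suc n)) * ι (+ 2) - c (2 ℕ.+ 2 ℕ.* n)
          ≡⟨ cong (λ k → ι (±1 (suc n)) * ι (+ 2) - c k) (ℕ.*-suc 2 n) ⟨
        ι (±1 (suc n)) * ι (+ 2) - c (2 ℕ.* suc n)        ∎)

    -- The trigonometric meaning of `V`, cleared of its denominator since `c k` may vanish. The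
    -- index is (2n + 1) k, arranged so that raising n adds k + k.
    V-cosine : ∀ n k → V n (c (k ℕ.+ k)) * c k ≈ c (k ℕ.+ n ℕ.* (k ℕ.+ k))
    V-cosine 0 k = trans (solve 1 (λ x → con (+ 1) :* x := x) refl (c k)) (reflexive (cong c (≡.sym (ℕ.+-identityʳ k))))
    V-cosine 1 k = begin
      (c (k ℕ.+ k) - ι (+ 1)) * c k     ≈⟨ solve 2 (λ a b → (a :- con (+ 1)) :* b := a :* b :- b) refl (c (k ℕ.+ k)) (c k) ⟩
      c (k ℕ.+ k) * c k - c k           ≈⟨ +-congʳ (product k k) ⟨
      c (k ℕ.+ k ℕ.+ k) + c k - c k     ≈⟨ solve 2 (λ a b → a :+ b :- b := a) refl (c (k ℕ.+ k ℕ.+ k)) (c k) ⟩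
      c (k ℕ.+ k ℕ.+ k)                 ≡⟨ cong c (ℕ.+-assoc k k k) ⟩
      c (k ℕ.+ (k ℕ.+ k))               ≡⟨ cong (λ j → c (k ℕ.+ j)) (ℕ.*-identityˡ (k ℕ.+ k)) ⟨
      c (k ℕ.+ 1 ℕ.* (k ℕ.+ k))         ∎
    V-cosine (suc (suc n)) k = begin
      (c (k ℕ.+ k) * V (suc n) z - V n z) * c k
        ≈⟨ solve 4 (λ a v w b → (a :* v :- w) :* b := (v :* b) :* a :- w :* b) refl (c (k ℕ.+ k)) (V (suc n) z) (V n z) (c k) ⟩
      V (suc n) z * c k * c (k ℕ.+ k) - V n z * c k
        ≈⟨ +-cong (*-congʳ (V-cosine (suc n) k)) (-‿cong (V-cosine n k)) ⟩
      c (k ℕ.+ suc n ℕ.* (k ℕ.+ k)) * c (k ℕ.+ k) - c m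
        ≡⟨ cong (λ j → c j * c (k ℕ.+ k) - c m) (shift k (k ℕ.+ k) (n ℕ.* (k ℕ.+ k))) ⟩
      c (m ℕ.+ (k ℕ.+ k)) * c (k ℕ.+ k) - c m
        ≈⟨ +-congʳ (product m (k ℕ.+ k)) ⟨
      c (m ℕ.+ (k ℕ.+ k) ℕ.+ (k ℕ.+ k)) + c m - c m
        ≈⟨ solve 2 (λ a b → a :+ b :- b := a) refl (c (m ℕ.+ (k ℕ.+ k) ℕ.+ (k ℕ.+ k))) (c m) ⟩
      c (m ℕ.+ (k ℕ.+ k) ℕ.+ (k ℕ.+ k))
        ≡⟨ cong c (≡.trans (cong (ℕ._+ (k ℕ.+ k)) (≡.sym (shift k (k ℕ.+ k) (n ℕ.* (k ℕ.+ k)))))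
             (≡.sym (shift k (k ℕ.+ k) (suc n ℕ.* (k ℕ.+ k))))) ⟩
      c (k ℕ.+ suc (suc n) ℕ.* (k ℕ.+ k)) ∎
      where
      z = c (k ℕ.+ k)
      m = k ℕ.+ n ℕ.* (k ℕ.+ k)
      shift : ∀ a b d → a ℕ.+ (b ℕ.+ d) ≡ a ℕ.+ d ℕ.+ b
      shift a b d = ≡.trans (cong (a ℕ.+_) (ℕ.+-comm b d)) (≡.sym (ℕ.+-assoc a d b))

  -- Rings without zero divisors: the three divisibility cases

  module Domain (cancel : ∀ {a b} → a * b ≈ 0# → ¬ a ≈ 0# → b ≈ 0#) where

    private
      ι[+n]≉0 : ∀ n .{{_ : ℕ.NonZero n}} → ¬ ι (+ n) ≈ 0#
      ι[+n]≉0 (suc n) eq with ι-injective {+ suc n} {+ 0} (trans eq (sym 0#-homo))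
      ... | ()

    -- Having K divide a power of T is decisive only for coprime numbers, so the gcd is cancelled
    -- first; what is left of K must then be 1.
    quotient⇒∣ : ∀ {x k β} n → x ^ suc n ≈ ι k → ∀ K T .{{_ : ℕ.NonZero K}} →
                 ℤ[ x ] β → ι (+ T) ≈ ι (+ K) * β → K ℕ.∣ T
    quotient⇒∣ {x} {k} {β} n xⁿ≈k K T β∈ T≈Kβ with factor-gcd K T
    ... | g , K′ , T′ , g≢0 , K≡ , T≡ , coprime =
      ≡.subst₂ ℕ._∣_ (≡.sym (≡.trans K≡ (≡.trans (cong (ℕ._* g) K′≡1) (ℕ.*-identityˡ g)))) (≡.sym T≡) (ℕ.n∣m*n T′)
      where
      split : ∀ {a a′} → a ≡ a′ ℕ.* g → ι (+ a) ≈ ι (+ a′) * ι (+ g)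
      split {a} {a′} a≡ = trans (ι-cong (≡.trans (cong +_ a≡) (ℤ.pos-* a′ g))) (*-homo (+ a′) (+ g))
      T′≈K′β : ι (+ T′) ≈ ι (+ K′) * β
      T′≈K′β = x-y≈0⇒x≈y (cancel (begin
        ι (+ g) * (ι (+ T′) - ι (+ K′) * β)
          ≈⟨ solve 4 (λ g t k b → g :* (t :- k :* b) := t :* g :- k :* g :* b) refl (ι (+ g)) (ι (+ T′)) (ι (+ K′)) β ⟩
        ι (+ T′) * ι (+ g) - ι (+ K′) * ι (+ g) * β
          ≈⟨ +-cong (split T≡) (-‿cong (*-congʳ (split K≡))) ⟨
        ι (+ T) - ι (+ K) * β
          ≈⟨ +-congʳ T≈Kβ ⟩
        ι (+ K) * β - ι (+ K) * β
          ≈⟨ -‿inverseʳ (ι (+ K) * β) ⟩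
        0# ∎) (ι[+n]≉0 g {{g≢0}}))
      K′≡1 : K′ ≡ 1
      K′≡1 = let N , b , eq = quotient⇒∣power n xⁿ≈k (+ K′) (+ T′) β∈ T′≈K′β
             in ∣power⇒≡1 N coprime eq

    -- If x^e divides t then, taking m-th powers, k^e = x^(em) divides t^m.
    divisor-power : ∀ {x g} n k e t .{{_ : ℕ.NonZero k}} → x ^ suc n ≈ ι (+ k) →
                    ℤ[ x ] g → x ^ e * g ≈ ι (+ t) → k ℕ.^ e ℕ.∣ t ℕ.^ suc n
    divisor-power {x} {g} n k e t xᵐ≈k g∈ xᵉg≈t =
      quotient⇒∣ n xᵐ≈k (k ℕ.^ e) (t ℕ.^ m) {{ℕ.m^n≢0 k e}} (ℤ[]-^ m g∈) (begin
        ι (+ (t ℕ.^ m))            ≈⟨ ι-^ t m ⟩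
        ι (+ t) ^ m                ≈⟨ ^-congˡ m xᵉg≈t ⟨
        (x ^ e * g) ^ m            ≈⟨ ^-distrib-* (x ^ e) g m ⟩
        (x ^ e) ^ m * g ^ m        ≈⟨ *-congʳ (^-assocʳ x e m) ⟩
        x ^ (e ℕ.* m) * g ^ m      ≈⟨ *-congʳ (^-congʳ x (ℕ.*-comm e m)) ⟩
        x ^ (m ℕ.* e) * g ^ m      ≈⟨ *-congʳ (^-assocʳ x m e) ⟨
        (x ^ m) ^ e * g ^ m        ≈⟨ *-congʳ (^-congˡ e xᵐ≈k) ⟩
        ι (+ k) ^ e * g ^ m        ≈⟨ *-congʳ (ι-^ k e) ⟨
        ι (+ (k ℕ.^ e)) * g ^ m    ∎)
      where m = suc n

    -- Dividing out one root leaves the others as roots of the quotient, because their differences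
    -- can be cancelled. The last quotient is the leading coefficient 1.
    poly-roots : ∀ {n f} → Poly (ι (+ 1)) n f → (y : ℕ → Carrier) →
                 (∀ i → i ℕ.< n → f (y i) ≈ 0#) →
                 (∀ i j → i ℕ.< j → j ℕ.< n → ¬ y i - y j ≈ 0#) →
                 ∀ z → f z ≈ ∏ n (λ i → z - y i)
    poly-roots (const f≈) y roots distinct z = f≈ z
    poly-roots {suc n} {f} p y roots distinct z =
      let q , q-poly , eq = poly-divide p (y n)
          fyₙ≈0 = roots n ℕ.≤-refl
          factor : ∀ z → f z ≈ (z - y n) * q z
          factor z = trans (trans (sym (+-identityʳ (f z))) (+-congˡ (sym (trans (-‿cong fyₙ≈0) -0#≈0#)))) (eq z)
      in trans (factor z) (*-congˡ (poly-roots q-poly y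
        (λ i i<n → cancel (trans (sym (factor (y i))) (roots i (ℕ.m<n⇒m<1+n i<n))) (distinct i n i<n ℕ.≤-refl))
        (λ i j i<j j<n → distinct i j i<j (ℕ.m<n⇒m<1+n j<n)) z))

    module Zeros {c : ℕ → Carrier} (cosine : TwiceCosine c) {N : ℕ}
                 (c[N]≈0 : c N ≈ 0#) (c≉0 : ∀ n → n ℕ.< N → ¬ c n ≈ 0#) where

      open TwiceCosine cosine

      c[n+2N] : ∀ n → c (n ℕ.+ N ℕ.+ N) ≈ - c n
      c[n+2N] n = begin
        c (n ℕ.+ N ℕ.+ N)                ≈⟨ solve 2 (λ a b → a := a :+ b :- b) refl (c (n ℕ.+ N ℕ.+ N)) (c n) ⟩
        c (n ℕ.+ N ℕ.+ N) + c n - c n    ≈⟨ +-congʳ (product n N) ⟩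
        c (n ℕ.+ N) * c N - c n          ≈⟨ +-congʳ (*-congˡ c[N]≈0) ⟩
        c (n ℕ.+ N) * 0# - c n           ≈⟨ +-congʳ (zeroʳ (c (n ℕ.+ N))) ⟩
        0# - c n                         ≈⟨ +-identityˡ (- c n) ⟩
        - c n                            ∎

      c[N*odd]≈0 : ∀ n → c (N ℕ.+ n ℕ.* (N ℕ.+ N)) ≈ 0#
      c[N*odd]≈0 zero    = trans (reflexive (cong c (ℕ.+-identityʳ N))) c[N]≈0
      c[N*odd]≈0 (suc n) = begin
        c (N ℕ.+ (N ℕ.+ N ℕ.+ n ℕ.* (N ℕ.+ N)))  ≡⟨ cong c (ℕ-solve 2 (λ a b → a ⊕ℕ (a ⊕ℕ a ⊕ℕ b) ⊜ a ⊕ℕ b ⊕ℕ a ⊕ℕ a) ≡.refl N (n ℕ.* (N ℕ.+ N))) ⟩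
        c (N ℕ.+ n ℕ.* (N ℕ.+ N) ℕ.+ N ℕ.+ N)    ≈⟨ c[n+2N] (N ℕ.+ n ℕ.* (N ℕ.+ N)) ⟩
        - c (N ℕ.+ n ℕ.* (N ℕ.+ N))              ≈⟨ -‿cong (c[N*odd]≈0 n) ⟩
        - 0#                                     ≈⟨ -0#≈0# ⟩
        0#                                       ∎

      -a≉0 : ∀ {a b} → ¬ a ≈ 0# → b ≈ - a → ¬ b ≈ 0#
      -a≉0 {a} {b} a≉0 b≈-a b≈0 = a≉0 (begin
        a      ≈⟨ -‿involutive a ⟨
        - - a  ≈⟨ -‿cong b≈-a ⟨
        - b    ≈⟨ -‿cong b≈0 ⟩
        - 0#   ≈⟨ -0#≈0# ⟩
        0#     ∎)

      -- N and 3N are consecutive zeros. The first half of the gap is reflected in N, c (N + n) = -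
      -- c (N - n), the second is shifted by 2N, c (N + n) = - c (n - N); both land below N.
      c[N+n]≉0 : ∀ n → 0 ℕ.< n → n ℕ.< N ℕ.+ N → ¬ c (N ℕ.+ n) ≈ 0#
      c[N+n]≉0 n 0<n n<2N with n ℕ.<? N
      ... | yes n<N = -a≉0 (c≉0 (N ℕ.∸ n) (ℕ.∸-monoʳ-< 0<n (ℕ.<⇒≤ n<N))) (begin
        c (N ℕ.+ n)                    ≡⟨ cong (λ k → c (k ℕ.+ n)) (ℕ.m∸n+n≡m (ℕ.<⇒≤ n<N)) ⟨
        c (k ℕ.+ n ℕ.+ n)              ≈⟨ solve 2 (λ a b → a := a :+ b :- b) refl (c (k ℕ.+ n ℕ.+ n)) (c k) ⟩
        c (k ℕ.+ n ℕ.+ n) + c k - c k  ≈⟨ +-congʳ (product k n) ⟩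
        c (k ℕ.+ n) * c n - c k        ≡⟨ cong (λ j → c j * c n - c k) (ℕ.m∸n+n≡m (ℕ.<⇒≤ n<N)) ⟩
        c N * c n - c k                ≈⟨ +-congʳ (trans (*-congʳ c[N]≈0) (zeroˡ (c n))) ⟩
        0# - c k                       ≈⟨ +-identityˡ (- c k) ⟩
        - c k                          ∎)
        where k = N ℕ.∸ n
      ... | no n≮N = -a≉0 (c≉0 k (ℕ.+-cancelʳ-< N k N (subst (ℕ._< N ℕ.+ N) (≡.sym k+N≡n) n<2N)))
        (trans (reflexive (cong c (≡.trans (ℕ.+-comm N n) (cong (ℕ._+ N) (≡.sym k+N≡n))))) (c[n+2N] k))
        where
        k = n ℕ.∸ N
        k+N≡n : k ℕ.+ N ≡ n
        k+N≡n = ℕ.m∸n+n≡m (ℕ.≮⇒≥ n≮N)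

    odd-unit : ∀ {c} → TwiceCosine c → ∀ n → c (1 ℕ.+ n ℕ.* 2) ≈ 0# → ¬ c 1 ≈ 0# →
               c 2 ∣[ c 2 ] ι (+ 1)
    odd-unit {c} cosine n c[2n+1]≈0 c[1]≉0 =
      let k , g , g∈ , eq = V-constantTerm (c 2) n
      in g * ι (±1 k) , g∈ ⊗ int (±1 k) , (begin
        c 2 * (g * ι (±1 k))                    ≈⟨ *-assoc (c 2) g (ι (±1 k)) ⟨
        c 2 * g * ι (±1 k)                      ≈⟨ *-congʳ eq ⟩
        (ι (±1 k) - V n (c 2)) * ι (±1 k)       ≈⟨ *-congʳ (+-congˡ (-‿cong V≈0)) ⟩
        (ι (±1 k) - 0#) * ι (±1 k)              ≈⟨ *-congʳ (trans (+-congˡ -0#≈0#) (+-identityʳ (ι (±1 k)))) ⟩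
        ι (±1 k) * ι (±1 k)                     ≈⟨ ι±1² k ⟩
        ι (+ 1)                                 ∎)
      where
      open TwiceCosine cosine
      V≈0 : V n (c 2) ≈ 0#
      -- `c 1` is twice the denominator cos φ of `V n`; cancelling it passes the zero of the
      -- numerator on to `V n`.
      V≈0 = cancel (trans (*-comm (c 1) (V n (c 2))) (trans (V-cosine n 1) c[2n+1]≈0)) c[1]≉0

    even-divides-2 : ∀ {c} → TwiceCosine c → ∀ n → c (2 ℕ.* n) ≈ 0# → c 1 * c 1 ∣[ c 1 ] ι (+ 2)
    even-divides-2 {c} cosine n c[2n]≈0 =
      let g , g∈ , eq = TwiceCosine.c[even] cosine n
          s = ι (±1 n)
      in g * s , g∈ ⊗ int (±1 n) , (begin
        c 1 * c 1 * (g * s)                ≈⟨ *-assoc (c 1 * c 1) g s ⟨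
        c 1 * c 1 * g * s                  ≈⟨ *-congʳ eq ⟩
        (s * ι (+ 2) - c (2 ℕ.* n)) * s    ≈⟨ *-congʳ (+-congˡ (trans (-‿cong c[2n]≈0) -0#≈0#)) ⟩
        (s * ι (+ 2) + 0#) * s             ≈⟨ *-congʳ (+-identityʳ (s * ι (+ 2))) ⟩
        s * ι (+ 2) * s                    ≈⟨ solve 1 (λ s → s :* con (+ 2) :* s := s :* s :* con (+ 2)) refl s ⟩
        s * s * ι (+ 2)                    ≈⟨ *-congʳ (ι±1² n) ⟩
        ι (+ 1) * ι (+ 2)                  ≈⟨ solve 0 (con (+ 1) :* con (+ 2) := con (+ 2)) refl ⟩
        ι (+ 2)                            ∎)

    ∏-divisible : ∀ {x a} n (f : ℕ → Carrier) → (∀ i → a ∣[ x ] f i) → a ^ n ∣[ x ] ∏ n f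
    ∏-divisible zero f a∣f = ι (+ 1) , int (+ 1) , *-identityˡ (ι (+ 1))
    ∏-divisible {x} {a} (suc n) f a∣f =
      let g , g∈ , eq = a∣f n
          h , h∈ , eq′ = ∏-divisible n f a∣f
      in g * h , g∈ ⊗ h∈ , trans
        (solve 4 (λ a b g h → a :* b :* (g :* h) := a :* g :* (b :* h)) refl a (a ^ n) g h)
        (*-cong eq eq′)

    -- The h distinct roots 2 cos ((4i + 2) φ) of V h, each congruent to -2 modulo (2 cos φ)².
    odd-divides : ∀ {c} → TwiceCosine c → ∀ h → c (1 ℕ.+ 2 ℕ.* h) ≈ 0# →
                  (∀ n → n ℕ.< 1 ℕ.+ 2 ℕ.* h → ¬ c n ≈ 0#) →
                  (c 1 * c 1) ^ h ∣[ c 1 ] ι (+ (1 ℕ.+ (h ℕ.+ h)))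
    odd-divides {c} cosine h c[N]≈0 c≉0 =
      let g , g∈ , eq = ∏-divisible h (λ i → z - root i) root-divisible
          s = ι (±1 h)
          t = ι (+ (1 ℕ.+ (h ℕ.+ h)))
      in s * g , int (±1 h) ⊗ g∈ , (begin
        (c 1 * c 1) ^ h * (s * g)     ≈⟨ solve 3 (λ a s g → a :* (s :* g) := s :* (a :* g)) refl ((c 1 * c 1) ^ h) s g ⟩
        s * ((c 1 * c 1) ^ h * g)     ≈⟨ *-congˡ eq ⟩
        s * ∏ h (λ i → z - root i)    ≈⟨ *-congˡ (poly-roots (V-poly h) root V[root]≈0 distinct z) ⟨
        s * V h z                     ≈⟨ *-congˡ (V[-2] h) ⟩
        s * (s * t)                   ≈⟨ *-assoc s s t ⟨
        s * s * t                     ≈⟨ *-congʳ (ι±1² h) ⟩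
        ι (+ 1) * t                   ≈⟨ solve 1 (λ t → con (+ 1) :* t := t) refl t ⟩
        t                             ∎)
      where
      open TwiceCosine cosine
      N = 1 ℕ.+ 2 ℕ.* h
      open Zeros cosine {N} c[N]≈0 c≉0
      z = ι (ℤ.- + 2)
      odd : ℕ → ℕ
      odd i = 1 ℕ.+ 2 ℕ.* i
      root : ℕ → Carrier
      root i = c (odd i ℕ.+ odd i)
      odd-< : ∀ {i} → i ℕ.< h → odd i ℕ.< N
      odd-< i<h = ℕ.s≤s (ℕ.*-monoʳ-< 2 i<h)
      V[root]≈0 : ∀ i → i ℕ.< h → V h (root i) ≈ 0#
      V[root]≈0 i i<h = cancel (begin
        c (odd i) * V h (root i)                   ≈⟨ *-comm (c (odd i)) (V h (root i)) ⟩
        V h (root i) * c (odd i)                   ≈⟨ V-cosine h (odd i) ⟩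
        -- Both indices are (2i + 1) (2h + 1), reread as an odd multiple of N.
        c (odd i ℕ.+ h ℕ.* (odd i ℕ.+ odd i))      ≡⟨ cong c (ℕ-solve 2 (λ i h → (κ 1 ⊕ℕ κ 2 ⊛ℕ i) ⊕ℕ h ⊛ℕ ((κ 1 ⊕ℕ κ 2 ⊛ℕ i) ⊕ℕ (κ 1 ⊕ℕ κ 2 ⊛ℕ i))
                                                       ⊜ (κ 1 ⊕ℕ κ 2 ⊛ℕ h) ⊕ℕ i ⊛ℕ ((κ 1 ⊕ℕ κ 2 ⊛ℕ h) ⊕ℕ (κ 1 ⊕ℕ κ 2 ⊛ℕ h))) ≡.refl i h) ⟩
        c (N ℕ.+ i ℕ.* (N ℕ.+ N))                  ≈⟨ c[N*odd]≈0 i ⟩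
        0#                                         ∎) (c≉0 (odd i) (odd-< i<h))
      -- Rests on -2 - 2 cos 2θ = - (2 cos θ) ^ 2, with θ an odd multiple of the base angle.
      root-divisible : ∀ i → c 1 * c 1 ∣[ c 1 ] (z - root i)
      root-divisible i =
        let g , g∈ , eq = c[odd] i
        in - (g * g) , ℤ[]-neg (g∈ ⊗ g∈) , (begin
          c 1 * c 1 * - (g * g)              ≈⟨ solve 2 (λ x g → x :* x :* (:- (g :* g)) := :- (x :* g :* (x :* g))) refl (c 1) g ⟩
          - (c 1 * g * (c 1 * g))            ≈⟨ -‿cong (*-cong eq eq) ⟩
          - (c (odd i) * c (odd i))          ≈⟨ -‿cong (product 0 (odd i)) ⟨
          - (root i + c 0)                   ≈⟨ -‿cong (+-congˡ c[0]) ⟩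
          - (root i + ι (+ 2))               ≈⟨ solve 1 (λ r → :- (r :+ con (+ 2)) := con (ℤ.- + 2) :- r) refl (root i) ⟩
          z - root i                         ∎)
      -- 2 cos x - 2 cos y = 4 sin ((x + y) / 2) sin ((y - x) / 2), each sine being a cosine shifted by N.
      difference : ∀ i δ → root i - root (i ℕ.+ δ) ≈ c (N ℕ.+ (2 ℕ.+ (4 ℕ.* i ℕ.+ 2 ℕ.* δ))) * c (N ℕ.+ 2 ℕ.* δ)
      difference i δ = begin
        root i - root (i ℕ.+ δ)                    ≈⟨ +-congˡ (c[n+2N] (odd (i ℕ.+ δ) ℕ.+ odd (i ℕ.+ δ))) ⟨
        root i + c (odd (i ℕ.+ δ) ℕ.+ odd (i ℕ.+ δ) ℕ.+ N ℕ.+ N)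
          ≡⟨ cong (λ k → root i + c k) (ℕ-solve 3 (λ i δ N → (κ 1 ⊕ℕ κ 2 ⊛ℕ (i ⊕ℕ δ)) ⊕ℕ (κ 1 ⊕ℕ κ 2 ⊛ℕ (i ⊕ℕ δ)) ⊕ℕ N ⊕ℕ N
               ⊜ (κ 1 ⊕ℕ κ 2 ⊛ℕ i) ⊕ℕ (κ 1 ⊕ℕ κ 2 ⊛ℕ i) ⊕ℕ (N ⊕ℕ κ 2 ⊛ℕ δ) ⊕ℕ (N ⊕ℕ κ 2 ⊛ℕ δ)) ≡.refl i δ N) ⟩
        root i + c (m ℕ.+ n ℕ.+ n)                 ≈⟨ +-comm (root i) (c (m ℕ.+ n ℕ.+ n)) ⟩
        c (m ℕ.+ n ℕ.+ n) + root i                 ≈⟨ product m n ⟩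
        c (m ℕ.+ n) * c n
          ≡⟨ cong (λ k → c k * c n) (ℕ-solve 3 (λ i δ N → (κ 1 ⊕ℕ κ 2 ⊛ℕ i) ⊕ℕ (κ 1 ⊕ℕ κ 2 ⊛ℕ i) ⊕ℕ (N ⊕ℕ κ 2 ⊛ℕ δ)
               ⊜ N ⊕ℕ (κ 2 ⊕ℕ (κ 4 ⊛ℕ i ⊕ℕ κ 2 ⊛ℕ δ))) ≡.refl i δ N) ⟩
        c (N ℕ.+ (2 ℕ.+ (4 ℕ.* i ℕ.+ 2 ℕ.* δ))) * c n ∎
        where
        m = odd i ℕ.+ odd i
        n = N ℕ.+ 2 ℕ.* δ
      -- Both factors of `difference` have the form c (N + a) with 0 < a < 2N, strictly between two
      -- consecutive zeros.
      distinct′ : ∀ i δ → 0 ℕ.< δ → i ℕ.+ δ ℕ.< h → ¬ root i - root (i ℕ.+ δ) ≈ 0#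
      distinct′ i δ 0<δ i+δ<h eq = c[N+n]≉0 (2 ℕ.* δ) (ℕ.*-monoʳ-< 2 0<δ)
        (ℕ.<-trans (ℕ.<-trans (ℕ.*-monoʳ-< 2 (ℕ.≤-<-trans (ℕ.m≤n+m δ i) i+δ<h)) (ℕ.n<1+n (2 ℕ.* h))) (ℕ.m<m+n N (ℕ.s≤s ℕ.z≤n)))
        (cancel (trans (sym (difference i δ)) eq) (c[N+n]≉0 (2 ℕ.+ (4 ℕ.* i ℕ.+ 2 ℕ.* δ)) (ℕ.s≤s ℕ.z≤n) (ℕ.≤-<-trans a≤2N-2 (ℕ.+-mono-< (ℕ.n<1+n (2 ℕ.* h)) (ℕ.n<1+n (2 ℕ.* h))))))
        where
        a≤2N-2 : 2 ℕ.+ (4 ℕ.* i ℕ.+ 2 ℕ.* δ) ℕ.≤ 2 ℕ.* h ℕ.+ 2 ℕ.* h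
        a≤2N-2 = ℕ.≤-trans (ℕ.≤-trans (ℕ.m≤m+n _ (2 ℕ.+ 2 ℕ.* δ))
          (ℕ.≤-reflexive (ℕ-solve 2 (λ i δ → κ 2 ⊕ℕ (κ 4 ⊛ℕ i ⊕ℕ κ 2 ⊛ℕ δ) ⊕ℕ (κ 2 ⊕ℕ κ 2 ⊛ℕ δ)
            ⊜ κ 2 ⊛ℕ (κ 1 ⊕ℕ (i ⊕ℕ δ)) ⊕ℕ κ 2 ⊛ℕ (κ 1 ⊕ℕ (i ⊕ℕ δ))) ≡.refl i δ)))
          (ℕ.+-mono-≤ (ℕ.*-monoʳ-≤ 2 i+δ<h) (ℕ.*-monoʳ-≤ 2 i+δ<h))
      distinct : ∀ i j → i ℕ.< j → j ℕ.< h → ¬ root i - root j ≈ 0#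
      distinct i j i<j j<h = subst (λ j → ¬ root i - root j ≈ 0#) i+δ≡j
        (distinct′ i (j ℕ.∸ i) (ℕ.m<n⇒0<n∸m i<j) (subst (ℕ._< h) (≡.sym i+δ≡j) j<h))
        where
        i+δ≡j : i ℕ.+ (j ℕ.∸ i) ≡ j
        i+δ≡j = ℕ.m+[n∸m]≡n (ℕ.<⇒≤ i<j)

    -- `bound` is multiple < (3/2) ^ exponent cleared of denominators, 3/2 being the lower bound for
    -- λ that serves all p ≥ 5.
    record SmallMultiple (x : Carrier) : Set where
      constructor smallMultiple
      field
        exponent multiple : ℕ
        {{multiple≢0}}    : ℕ.NonZero multiple
        bound             : multiple ℕ.* 2 ℕ.^ exponent ℕ.< 3 ℕ.^ exponent
        divides           : x ^ exponent ∣[ x ] ι (+ multiple)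

    -- Passes from the step φ = π / 2p to π / p, so that for even p the first term of the sequence
    -- is λ.
    double : ∀ {c} → TwiceCosine c → TwiceCosine (λ n → c (2 ℕ.* n))
    double {c} cosine = record
      { c[0]    = c[0]
      ; product = λ m n → trans
          (+-congʳ (reflexive (cong c (ℕ-solve 2 (λ m n → κ 2 ⊛ℕ (m ⊕ℕ n ⊕ℕ n) ⊜ κ 2 ⊛ℕ m ⊕ℕ κ 2 ⊛ℕ n ⊕ℕ κ 2 ⊛ℕ n) ≡.refl m n))))
          (trans (product (2 ℕ.* m) (2 ℕ.* n))
            (*-congʳ (reflexive (cong c (≡.sym (ℕ.*-distribˡ-+ 2 m n))))))
      }
      where open TwiceCosine cosine

    -- The pairs (e, t) are (1, 1) for odd p, (2, 2) for 4 ∣ p, and (2j, 2j + 1) for p = 2 (2j + 1)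
    -- with j ≥ 2. At p = 6 the pair (2, 3) would fail, since 3 > (3/2) ^ 2.
    c[2]-smallMultiple : ∀ {c} → TwiceCosine c → ∀ p → c p ≈ 0# → (∀ n → n ℕ.< p → ¬ c n ≈ 0#) →
                         3 ℕ.< p → p ≢ 4 → p ≢ 6 → SmallMultiple (c 2)
    c[2]-smallMultiple {c} cosine p c[p]≈0 c≉0 3<p p≢4 p≢6 with parity p
    ... | h , inj₂ ≡.refl =
      let g , g∈ , eq = odd-unit cosine h (trans (reflexive (cong (λ k → c (suc k)) (ℕ.*-comm h 2))) c[p]≈0)
                          (c≉0 1 (ℕ.≤-trans (ℕ.s≤s (ℕ.s≤s ℕ.z≤n)) 3<p))
      in smallMultiple 1 1 (ℕ.n<1+n 2) (g , g∈ , trans (*-congʳ (*-identityʳ (c 2))) eq)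
    ... | h , inj₁ ≡.refl with parity h
    ... | j , inj₁ ≡.refl =
      let g , g∈ , eq = even-divides-2 (double cosine) j c[p]≈0
      in smallMultiple 2 2 (ℕ.n<1+n 8) (g , g∈ , trans (*-congʳ (*-congˡ (*-identityʳ (c 2)))) eq)
    ... | 0 , inj₂ ≡.refl = contradiction 3<p λ { (ℕ.s≤s (ℕ.s≤s ())) }
    ... | 1 , inj₂ ≡.refl = contradiction ≡.refl p≢6
    ... | j@(suc (suc i)) , inj₂ ≡.refl =
      let g , g∈ , eq = odd-divides (double cosine) j c[p]≈0
                          (λ n n<h → c≉0 (2 ℕ.* n) (ℕ.*-monoʳ-< 2 n<h))
      in smallMultiple (j ℕ.+ j) (1 ℕ.+ (j ℕ.+ j)) ([1+2n]*4ⁿ<9ⁿ i)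
           (g , g∈ , trans (*-congʳ (trans (^-homo-* (c 2) j j) (sym (^-distrib-* (c 2) (c 2) j)))) eq)

    -- The upper bound k < (3/2) ^ m, to be set against λ ≥ 3/2. The case k = 0 is separate because
    -- `divisor-power` takes a nonzero k.
    integral-power-small : ∀ {x} → SmallMultiple x → ∀ n k → x ^ suc n ≈ ι (+ k) →
                           k ℕ.* 2 ℕ.^ suc n ℕ.< 3 ℕ.^ suc n
    integral-power-small (smallMultiple e t t*2ᵉ<3ᵉ (g , g∈ , eq)) n zero      xᵐ≈k = ℕ.m^n>0 3 (suc n)
    integral-power-small (smallMultiple e t t*2ᵉ<3ᵉ (g , g∈ , eq)) n k@(suc _) xᵐ≈k =
      kᵉ≤tᵐ⇒k*2ᵐ<3ᵐ k t e (suc n) t*2ᵉ<3ᵉ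
        (ℕ.∣⇒≤ {{ℕ.m^n≢0 t (suc n)}} (divisor-power n k e t xᵐ≈k g∈ eq))

-- The commutative ring of Cauchy reals

module Reals where

  open import Data.Rational.Base using (_+_; _*_; _-_; -_; _≤_; _<_; nonNegative)
  open Estimates
  open ℚ.≤-Reasoning
  open ℚSolver.+-*-Solver using (solve; _:+_; _:*_; _:-_; :-_; _:=_; con)

  +-cancelʳ-≤ : ∀ r {p q} → p + r ≤ q + r → p ≤ q
  +-cancelʳ-≤ r {p} {q} p+r≤q+r = ≡.subst₂ _≤_ (cancel-r p) (cancel-r q) (ℚ.+-monoˡ-≤ (- r) p+r≤q+r)
    where
    cancel-r : ∀ p → p + r - r ≡ p
    cancel-r p = solve 2 (λ p r → p :+ r :- r := p) ≡.refl p r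

  +-cancelʳ-< : ∀ r {p q} → p + r < q + r → p < q
  +-cancelʳ-< r {p} {q} p+r<q+r = ℚ.≰⇒> λ q≤p → ℚ.<-irrefl ≡.refl (ℚ.<-≤-trans p+r<q+r (ℚ.+-monoˡ-≤ r q≤p))

  -- `x ≃ y` unfolds to `Null` of the difference sequence, so the congruence laws reduce to sums and
  -- products of null sequences.
  Null : (ℕ → ℚ) → Set
  Null s = ∀ ε → 0ℚ < ε → ∃ λ N → ∀ n → N ℕ.≤ n → ∣ s n ∣ < ε

  null-resp : ∀ {s t} → (∀ n → s n ≡ t n) → Null s → Null t
  null-resp s≡t s-null ε 0<ε =
    let N , small = s-null ε 0<ε in N , λ n N≤n → subst (λ q → ∣ q ∣ < ε) (s≡t n) (small n N≤n)

  null-0 : ∀ {s} → (∀ n → s n ≡ 0ℚ) → Null s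
  null-0 s≡0 ε 0<ε = 0 , λ n _ → subst (λ q → ∣ q ∣ < ε) (≡.sym (s≡0 n)) 0<ε

  null-≤ : ∀ {s t} → (∃ λ N → ∀ n → N ℕ.≤ n → ∣ s n ∣ ≤ ∣ t n ∣) → Null t → Null s
  null-≤ (M , s≤t) t-null ε 0<ε =
    let N , small = t-null ε 0<ε
    in M ℕ.⊔ N , λ n n≥ → ℚ.≤-<-trans (s≤t n (ℕ.m⊔n≤o⇒m≤o M N n≥)) (small n (ℕ.m⊔n≤o⇒n≤o M N n≥))

  null-+ : ∀ {s t} → Null s → Null t → Null (λ n → s n + t n)
  null-+ {s} {t} s-null t-null ε 0<ε =
    let M , s< = s-null (third ε) (third-pos 0<ε)
        N , t< = t-null (third ε) (third-pos 0<ε)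
    in M ℕ.⊔ N , λ n n≥ → begin-strict
      ∣ s n + t n ∣                ≤⟨ ℚ.∣p+q∣≤∣p∣+∣q∣ (s n) (t n) ⟩
      ∣ s n ∣ + ∣ t n ∣            <⟨ ℚ.+-mono-< (s< n (ℕ.m⊔n≤o⇒m≤o M N n≥)) (t< n (ℕ.m⊔n≤o⇒n≤o M N n≥)) ⟩
      third ε + third ε            <⟨ p<p+q (third ε + third ε) (third-pos 0<ε) ⟩
      third ε + third ε + third ε  ≡⟨ three-thirds ε ⟩
      ε                            ∎

  null-* : ∀ {s t : ℕ → ℚ} → (∃₂ λ b N → ∀ n → N ℕ.≤ n → ∣ s n ∣ ≤ fromℕ b) → Null t → Null (λ n → s n * t n)
  null-* {s} {t} (b , M , s≤b) t-null ε 0<ε =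
    let δ , 0<δ , bδ≤ = shrink {fromℕ b} {third ε} (0≤fromℕ b) (third-pos 0<ε)
        N , t< = t-null δ 0<δ
    in M ℕ.⊔ N , λ n n≥ → begin-strict
      ∣ s n * t n ∣                ≡⟨ ℚ.∣p*q∣≡∣p∣*∣q∣ (s n) (t n) ⟩
      ∣ s n ∣ * ∣ t n ∣            ≤⟨ *-mono-≤-nonNeg (ℚ.0≤∣p∣ (s n)) (ℚ.<⇒≤ 0<δ)
                                        (s≤b n (ℕ.m⊔n≤o⇒m≤o M N n≥)) (ℚ.<⇒≤ (t< n (ℕ.m⊔n≤o⇒n≤o M N n≥))) ⟩
      fromℕ b * δ                  ≤⟨ bδ≤ ⟩
      third ε                      <⟨ p<p+q (third ε) (third-pos 0<ε) ⟩
      third ε + third ε            <⟨ p<p+q (third ε + third ε) (third-pos 0<ε) ⟩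
      third ε + third ε + third ε  ≡⟨ three-thirds ε ⟩
      ε                            ∎

  pointwise : ∀ {x y} → (∀ n → seq x n ≡ seq y n) → x ≃ y
  pointwise {x} {y} x≡y = null-0 λ n →
    ≡.trans (cong (_- seq y n) (x≡y n)) (ℚ.+-inverseʳ (seq y n))

  ≃-refl : ∀ {x} → x ≃ x
  ≃-refl {x} = pointwise {x} {x} λ _ → ≡.refl

  ≃-sym : ∀ {x y} → x ≃ y → y ≃ x
  ≃-sym {x} {y} x≃y = null-≤ {_} {λ n → seq x n - seq y n}
    (0 , λ n _ → ℚ.≤-reflexive (∣p-q∣≡∣q-p∣ (seq y n) (seq x n))) x≃y

  ≃-trans : ∀ {x y z} → x ≃ y → y ≃ z → x ≃ z
  ≃-trans {x} {y} {z} x≃y y≃z = null-resp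
    (λ n → solve 3 (λ x y z → (x :- y) :+ (y :- z) := x :- z) ≡.refl (seq x n) (seq y n) (seq z n))
    (null-+ {λ n → seq x n - seq y n} x≃y y≃z)

  +-cong : ∀ {x x′ y y′} → x ≃ x′ → y ≃ y′ → (x Defs.+ y) ≃ (x′ Defs.+ y′)
  +-cong {x} {x′} {y} {y′} x≃ y≃ = null-resp
    (λ n → solve 4 (λ a b c d → (a :- b) :+ (c :- d) := (a :+ c) :- (b :+ d)) ≡.refl (seq x n) (seq x′ n) (seq y n) (seq y′ n))
    (null-+ {λ n → seq x n - seq x′ n} x≃ y≃)

  *-cong : ∀ {x x′ y y′} → x ≃ x′ → y ≃ y′ → (x Defs.* y) ≃ (x′ Defs.* y′)
  *-cong {x} {x′} {y} {y′} x≃ y≃ = null-resp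
    (λ n → solve 4 (λ a b c d → a :* (c :- d) :+ d :* (a :- b) := a :* c :- b :* d) ≡.refl (seq x n) (seq x′ n) (seq y n) (seq y′ n))
    (null-+ {λ n → seq x n * (seq y n - seq y′ n)}
      (null-* {seq x} (eventually-bounded {seq x} (isCauchy x)) y≃)
      (null-* {seq y′} (eventually-bounded {seq y′} (isCauchy y′)) x≃))

  infix 8 ⊖_
  -- A multiple by -1, so that the Cauchy property comes from the product.
  ⊖_ : ℝ → ℝ
  ⊖ x = fromℤ (ℤ.- + 1) Defs.* x

  +-*-commutativeRing : CommutativeRing 0ℓ 0ℓ
  +-*-commutativeRing = record
    { Carrier = ℝ ; _≈_ = _≃_ ; _+_ = Defs._+_ ; _*_ = Defs._*_ ; -_ = ⊖_ ; 0# = 0ℝ ; 1# = 1ℝ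
    ; isCommutativeRing = record
      { isRing = record
        { +-isAbelianGroup = record
          { isGroup = record
            { isMonoid = record
              { isSemigroup = record
                { isMagma = record
                  { isEquivalence = record
                    { refl  = λ {x} → ≃-refl {x}
                    ; sym   = λ {x} {y} → ≃-sym {x} {y}
                    ; trans = λ {x} {y} {z} → ≃-trans {x} {y} {z}
                    }
                  ; ∙-cong = λ {x} {x′} {y} {y′} → +-cong {x} {x′} {y} {y′}
                  }
                ; assoc = λ x y z → pointwise {x Defs.+ y Defs.+ z} {x Defs.+ (y Defs.+ z)} λ n → ℚ.+-assoc (seq x n) (seq y n) (seq z n)
                }
              ; identity = (λ x → pointwise {0ℝ Defs.+ x} {x} λ n → ℚ.+-identityˡ (seq x n))
                         , (λ x → pointwise {x Defs.+ 0ℝ} {x} λ n → ℚ.+-identityʳ (seq x n))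
              }
            ; inverse = (λ x → pointwise {⊖ x Defs.+ x} {0ℝ} λ n → solve 1 (λ x → con (- 1ℚ) :* x :+ x := con 0ℚ) ≡.refl (seq x n))
                      , (λ x → pointwise {x Defs.+ ⊖ x} {0ℝ} λ n → solve 1 (λ x → x :+ con (- 1ℚ) :* x := con 0ℚ) ≡.refl (seq x n))
            ; ⁻¹-cong = λ {x} {y} x≃y → *-cong {fromℤ (ℤ.- + 1)} {fromℤ (ℤ.- + 1)} {x} {y} (≃-refl {fromℤ (ℤ.- + 1)}) x≃y
            }
          ; comm = λ x y → pointwise {x Defs.+ y} {y Defs.+ x} λ n → ℚ.+-comm (seq x n) (seq y n)
          }
        ; *-cong     = λ {x} {x′} {y} {y′} → *-cong {x} {x′} {y} {y′}
        ; *-assoc    = λ x y z → pointwise {x Defs.* y Defs.* z} {x Defs.* (y Defs.* z)} λ n → ℚ.*-assoc (seq x n) (seq y n) (seq z n)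
        ; *-identity = (λ x → pointwise {1ℝ Defs.* x} {x} λ n → ℚ.*-identityˡ (seq x n))
                     , (λ x → pointwise {x Defs.* 1ℝ} {x} λ n → ℚ.*-identityʳ (seq x n))
        ; distrib    = (λ x y z → pointwise {x Defs.* (y Defs.+ z)} {x Defs.* y Defs.+ x Defs.* z} λ n → ℚ.*-distribˡ-+ (seq x n) (seq y n) (seq z n))
                     , (λ x y z → pointwise {(y Defs.+ z) Defs.* x} {y Defs.* x Defs.+ z Defs.* x} λ n → ℚ.*-distribʳ-+ (seq x n) (seq y n) (seq z n))
        }
      ; *-comm = λ x y → pointwise {x Defs.* y} {y Defs.* x} λ n → ℚ.*-comm (seq x n) (seq y n)
      }
    }

  -- A mere negation of x ≃ 0 gives no lower bound for x. Instead, for each ε one rational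
  -- comparison decides: either y stays below ε, or y is bounded away from 0 and forces x ≃ 0.
  cancel : ∀ {x y} → (x Defs.* y) ≃ 0ℝ → ¬ x ≃ 0ℝ → y ≃ 0ℝ
  cancel {x} {y} xy≃0 x≄0 ε 0<ε with isCauchy y (third ε) (third-pos 0<ε)
  ... | N , close with ∣ seq y N ∣ ℚ.<? third ε + third ε
  ... | yes small = N , λ n N≤n → begin-strict
    ∣ seq y n - 0ℚ ∣                       ≡⟨ cong ∣_∣ (solve 2 (λ a b → a :- con 0ℚ := (a :- b) :+ b) ≡.refl (seq y n) (seq y N)) ⟩
    ∣ (seq y n - seq y N) + seq y N ∣      ≤⟨ ℚ.∣p+q∣≤∣p∣+∣q∣ (seq y n - seq y N) (seq y N) ⟩
    ∣ seq y n - seq y N ∣ + ∣ seq y N ∣    <⟨ ℚ.+-mono-< (close n N N≤n ℕ.≤-refl) small ⟩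
    third ε + (third ε + third ε)          ≡⟨ ℚ.+-assoc (third ε) (third ε) (third ε) ⟨
    third ε + third ε + third ε            ≡⟨ three-thirds ε ⟩
    ε                                      ∎
  ... | no large = contradiction x≃0 x≄0
    where
    -- Beyond N, |y| stays above ε / 3, so x inherits the decay of x y.
    y-large : ∀ n → N ℕ.≤ n → third ε ≤ ∣ seq y n ∣
    y-large n N≤n = +-cancelʳ-≤ (third ε) (begin
      third ε + third ε                    ≤⟨ ℚ.≮⇒≥ large ⟩
      ∣ seq y N ∣                          ≡⟨ cong ∣_∣ (solve 2 (λ a b → b := a :+ (b :- a)) ≡.refl (seq y n) (seq y N)) ⟩
      ∣ seq y n + (seq y N - seq y n) ∣    ≤⟨ ℚ.∣p+q∣≤∣p∣+∣q∣ (seq y n) (seq y N - seq y n) ⟩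
      ∣ seq y n ∣ + ∣ seq y N - seq y n ∣  ≤⟨ ℚ.+-monoʳ-≤ ∣ seq y n ∣ (ℚ.<⇒≤ (close N n ℕ.≤-refl N≤n)) ⟩
      ∣ seq y n ∣ + third ε                ∎)
    x≃0 : x ≃ 0ℝ
    x≃0 η 0<η with xy≃0 (η * third ε) (*-pos 0<η (third-pos 0<ε))
    ... | M , small = M ℕ.⊔ N , λ n n≥ → ℚ.*-cancelʳ-<-nonNeg (third ε) {{nonNegative (ℚ.<⇒≤ (third-pos 0<ε))}} (begin-strict
      ∣ seq x n - 0ℚ ∣ * third ε      ≤⟨ ℚ.*-monoˡ-≤-nonNeg ∣ seq x n - 0ℚ ∣ {{nonNegative (ℚ.0≤∣p∣ (seq x n - 0ℚ))}} (y-large n (ℕ.m⊔n≤o⇒n≤o M N n≥)) ⟩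
      ∣ seq x n - 0ℚ ∣ * ∣ seq y n ∣  ≡⟨ ℚ.∣p*q∣≡∣p∣*∣q∣ (seq x n - 0ℚ) (seq y n) ⟨
      ∣ (seq x n - 0ℚ) * seq y n ∣    ≡⟨ cong ∣_∣ (solve 2 (λ a b → (a :- con 0ℚ) :* b := a :* b :- con 0ℚ) ≡.refl (seq x n) (seq y n)) ⟩
      ∣ seq x n * seq y n - 0ℚ ∣      <⟨ small n (ℕ.m⊔n≤o⇒m≤o M N n≥) ⟩
      η * third ε                     ∎)

  fromℚ-injective : ∀ {p q} → fromℚ p ≃ fromℚ q → p ≡ q
  fromℚ-injective {p} {q} p≃q with p ℚ.≟ q
  ... | yes p≡q = p≡q
  ... | no p≢q =
    let N , small = p≃q ∣ p - q ∣ (ℚ.≰⇒> λ ∣p-q∣≤0 → p≢q (p-q≡0⇒p≡q (ℚ.∣p∣≡0⇒p≡0 (p - q) (ℚ.≤-antisym ∣p-q∣≤0 (ℚ.0≤∣p∣ (p - q))))))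
    in contradiction (small N ℕ.≤-refl) (ℚ.<-irrefl ≡.refl)
    where
    p-q≡0⇒p≡q : p - q ≡ 0ℚ → p ≡ q
    p-q≡0⇒p≡q eq = ≡.trans (solve 2 (λ p q → p := p :- q :+ q) ≡.refl p q)
      (≡.trans (cong (_+ q) eq) (ℚ.+-identityˡ q))

  toℚᵘ-/1 : ∀ i → ℚ.toℚᵘ (i ℚ./ 1) ℚᵘ.≃ ℚᵘ.mkℚᵘ i 0
  toℚᵘ-/1 i = ℚ.toℚᵘ-fromℚᵘ (ℚᵘ.mkℚᵘ i 0)

  /1-+ : ∀ i j → (i ℤ.+ j) ℚ./ 1 ≡ i ℚ./ 1 + j ℚ./ 1
  /1-+ i j = ℚ.toℚᵘ-injective (ℚᵘ.≃-trans (toℚᵘ-/1 (i ℤ.+ j))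
    (ℚᵘ.≃-sym (ℚᵘ.≃-trans (ℚ.toℚᵘ-homo-+ (i ℚ./ 1) (j ℚ./ 1))
      (ℚᵘ.≃-trans (ℚᵘ.+-cong (toℚᵘ-/1 i) (toℚᵘ-/1 j))
        (ℚᵘ.*≡* (cong (ℤ._* + 1) (cong₂ ℤ._+_ (ℤ.*-identityʳ i) (ℤ.*-identityʳ j))))))))

  /1-* : ∀ i j → (i ℤ.* j) ℚ./ 1 ≡ i ℚ./ 1 * (j ℚ./ 1)
  /1-* i j = ℚ.toℚᵘ-injective (ℚᵘ.≃-trans (toℚᵘ-/1 (i ℤ.* j))
    (ℚᵘ.≃-sym (ℚᵘ.≃-trans (ℚ.toℚᵘ-homo-* (i ℚ./ 1) (j ℚ./ 1))
      (ℚᵘ.*-cong (toℚᵘ-/1 i) (toℚᵘ-/1 j)))))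

  /1-injective : ∀ {i j} → i ℚ./ 1 ≡ j ℚ./ 1 → i ≡ j
  /1-injective {i} {j} eq with ℚᵘ.≃-trans (ℚᵘ.≃-sym (toℚᵘ-/1 i)) (ℚᵘ.≃-trans (ℚᵘ.≃-reflexive (cong ℚ.toℚᵘ eq)) (toℚᵘ-/1 j))
  ... | ℚᵘ.*≡* eq′ = ℤ.*-cancelʳ-≡ i j (+ 1) eq′

  fromℤ-isRingMonomorphism :
    RingMorphisms.IsRingMonomorphism ℤ.+-*-rawRing (CommutativeRing.rawRing +-*-commutativeRing) fromℤ
  fromℤ-isRingMonomorphism = record
    { isRingHomomorphism = record
      { isSemiringHomomorphism = record
        { isNearSemiringHomomorphism = record
          { +-isMonoidHomomorphism = record
            { isMagmaHomomorphism = record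
              { isRelHomomorphism = record { cong = λ {i} {j} i≡j → pointwise {fromℤ i} {fromℤ j} λ _ → cong (ℚ._/ 1) i≡j }
              ; homo = λ i j → pointwise {fromℤ (i ℤ.+ j)} {fromℤ i Defs.+ fromℤ j} λ _ → /1-+ i j
              }
            ; ε-homo = ≃-refl {0ℝ}
            }
          ; *-homo = λ i j → pointwise {fromℤ (i ℤ.* j)} {fromℤ i Defs.* fromℤ j} λ _ → /1-* i j
          }
        ; 1#-homo = ≃-refl {1ℝ}
        }
      ; -‿homo = λ i → pointwise {fromℤ (ℤ.- i)} {⊖ fromℤ i} λ _ →
          ≡.trans (cong (ℚ._/ 1) (≡.sym (ℤ.-1*i≡-i i))) (/1-* (ℤ.- + 1) i)
      }
    ; injective = λ {i} {j} eq → /1-injective {i} {j} (fromℚ-injective eq)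
    }

-- The product formula for cosines, by Cauchy products of series

module Convolution where

  open import Data.Rational.Base using (_+_; _*_; _-_; -_; _≤_; _<_; nonNegative; positive)
  open Estimates
  open ℚ.≤-Reasoning
  open ℚSolver.+-*-Solver using (solve; _:+_; _:*_; _:-_; :-_; _:=_; con)

  ∑ : ℕ → (ℕ → ℚ) → ℚ
  ∑ zero    f = 0ℚ
  ∑ (suc n) f = ∑ n f + f n

  ∑-head : ∀ n f → ∑ (suc n) f ≡ f 0 + ∑ n (λ k → f (suc k))
  ∑-head zero    f = solve 1 (λ a → con 0ℚ :+ a := a :+ con 0ℚ) ≡.refl (f 0)
  ∑-head (suc n) f = ≡.trans (cong (_+ f (suc n)) (∑-head n f)) (ℚ.+-assoc (f 0) _ (f (suc n)))

  ∑-cong : ∀ {f g} → (∀ n → f n ≡ g n) → ∀ n → ∑ n f ≡ ∑ n g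
  ∑-cong f≡g zero    = ≡.refl
  ∑-cong f≡g (suc n) = cong₂ _+_ (∑-cong f≡g n) (f≡g n)

  -- The Cauchy product, with recursion shifting `f`, so that no difference of indices appears.
  conv : (ℕ → ℚ) → (ℕ → ℚ) → ℕ → ℚ
  conv f g zero    = f 0 * g 0
  conv f g (suc n) = f 0 * g (suc n) + conv (λ k → f (suc k)) g n

  conv-cong : ∀ {f f′ g g′} → (∀ n → f n ≡ f′ n) → (∀ n → g n ≡ g′ n) → ∀ n → conv f g n ≡ conv f′ g′ n
  conv-cong f≡ g≡ zero    = cong₂ _*_ (f≡ 0) (g≡ 0)
  conv-cong f≡ g≡ (suc n) = cong₂ _+_ (cong₂ _*_ (f≡ 0) (g≡ (suc n))) (conv-cong (λ k → f≡ (suc k)) g≡ n)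

  conv-last : ∀ f g n → conv f g (suc n) ≡ conv f (λ k → g (suc k)) n + f (suc n) * g 0
  conv-last f g zero    = ≡.refl
  conv-last f g (suc n) = ≡.trans (cong (λ z → f 0 * g (2 ℕ.+ n) + z) (conv-last (λ k → f (suc k)) g n))
    (≡.sym (ℚ.+-assoc (f 0 * g (2 ℕ.+ n)) _ _))

  conv-+ˡ : ∀ f f′ g n → conv (λ k → f k + f′ k) g n ≡ conv f g n + conv f′ g n
  conv-+ˡ f f′ g zero    = ℚ.*-distribʳ-+ (g 0) (f 0) (f′ 0)
  conv-+ˡ f f′ g (suc n) = ≡.trans
    (cong (λ z → (f 0 + f′ 0) * g (suc n) + z) (conv-+ˡ (λ k → f (suc k)) (λ k → f′ (suc k)) g n))
    (solve 5 (λ a b g c d → (a :+ b) :* g :+ (c :+ d) := (a :* g :+ c) :+ (b :* g :+ d)) ≡.refl (f 0) (f′ 0) (g (suc n)) _ _)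

  conv-+ʳ : ∀ f g g′ n → conv f (λ k → g k + g′ k) n ≡ conv f g n + conv f g′ n
  conv-+ʳ f g g′ zero    = ℚ.*-distribˡ-+ (f 0) (g 0) (g′ 0)
  conv-+ʳ f g g′ (suc n) = ≡.trans
    (cong (λ z → f 0 * (g (suc n) + g′ (suc n)) + z) (conv-+ʳ (λ k → f (suc k)) g g′ n))
    (solve 5 (λ f a b c d → f :* (a :+ b) :+ (c :+ d) := (f :* a :+ c) :+ (f :* b :+ d)) ≡.refl (f 0) (g (suc n)) (g′ (suc n)) _ _)

  conv-*ˡ : ∀ c f g n → conv (λ k → c * f k) g n ≡ c * conv f g n
  conv-*ˡ c f g zero    = ℚ.*-assoc c (f 0) (g 0)
  conv-*ˡ c f g (suc n) = ≡.trans (cong (λ z → c * f 0 * g (suc n) + z) (conv-*ˡ c (λ k → f (suc k)) g n))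
    (solve 4 (λ c f g s → c :* f :* g :+ c :* s := c :* (f :* g :+ s)) ≡.refl c (f 0) (g (suc n)) _)

  conv-*ʳ : ∀ c f g n → conv f (λ k → c * g k) n ≡ c * conv f g n
  conv-*ʳ c f g zero    = solve 3 (λ c f g → f :* (c :* g) := c :* (f :* g)) ≡.refl c (f 0) (g 0)
  conv-*ʳ c f g (suc n) = ≡.trans (cong (λ z → f 0 * (c * g (suc n)) + z) (conv-*ʳ c (λ k → f (suc k)) g n))
    (solve 4 (λ c f g s → f :* (c :* g) :+ c :* s := c :* (f :* g :+ s)) ≡.refl c (f 0) (g (suc n)) _)

  conv-geometric : ∀ s f g n → conv (λ k → s ^ℚ k * f k) (λ k → s ^ℚ k * g k) n ≡ s ^ℚ n * conv f g n
  conv-geometric s f g zero    = solve 2 (λ f g → con 1ℚ :* f :* (con 1ℚ :* g) := con 1ℚ :* (f :* g)) ≡.refl (f 0) (g 0)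
  conv-geometric s f g (suc n) = begin-equality
    1ℚ * f 0 * (s ^ℚ suc n * g (suc n)) + conv (λ k → s * s ^ℚ k * f (suc k)) (λ k → s ^ℚ k * g k) n
      ≡⟨ cong (λ z → 1ℚ * f 0 * (s ^ℚ suc n * g (suc n)) + z) (≡.trans
           (conv-cong {g = λ k → s ^ℚ k * g k} (λ k → ℚ.*-assoc s (s ^ℚ k) (f (suc k))) (λ _ → ≡.refl) n)
           (≡.trans (conv-*ˡ s (λ k → s ^ℚ k * f (suc k)) (λ k → s ^ℚ k * g k) n)
             (cong (s *_) (conv-geometric s (λ k → f (suc k)) g n)))) ⟩
    1ℚ * f 0 * (s * s ^ℚ n * g (suc n)) + s * (s ^ℚ n * conv (λ k → f (suc k)) g n)
      ≡⟨ solve 5 (λ f s p g c → con 1ℚ :* f :* (s :* p :* g) :+ s :* (p :* c) := s :* p :* (f :* g :+ c)) ≡.refl (f 0) s (s ^ℚ n) (g (suc n)) _ ⟩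
    s ^ℚ suc n * conv f g (suc n) ∎

  conv-even : ∀ f g → (∀ n → g (suc (2 ℕ.* n)) ≡ 0ℚ) → ∀ n →
              conv f g (2 ℕ.* n) ≡ conv (λ k → f (2 ℕ.* k)) (λ k → g (2 ℕ.* k)) n
  conv-even f g g-odd zero    = ≡.refl
  conv-even f g g-odd (suc n) = begin-equality
    conv f g (2 ℕ.* suc n)
      ≡⟨ cong (conv f g) (ℕ.*-suc 2 n) ⟩
    f 0 * g (2 ℕ.+ 2 ℕ.* n) + (f 1 * g (suc (2 ℕ.* n)) + conv (λ k → f (2 ℕ.+ k)) g (2 ℕ.* n))
      ≡⟨ cong₂ (λ i q → f 0 * g i + (f 1 * q + conv (λ k → f (2 ℕ.+ k)) g (2 ℕ.* n))) (≡.sym (ℕ.*-suc 2 n)) (g-odd n) ⟩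
    f 0 * g (2 ℕ.* suc n) + (f 1 * 0ℚ + conv (λ k → f (2 ℕ.+ k)) g (2 ℕ.* n))
      ≡⟨ cong (λ z → f 0 * g (2 ℕ.* suc n) + z) (solve 2 (λ a b → a :* con 0ℚ :+ b := b) ≡.refl (f 1) _) ⟩
    f 0 * g (2 ℕ.* suc n) + conv (λ k → f (2 ℕ.+ k)) g (2 ℕ.* n)
      ≡⟨ cong (λ z → f 0 * g (2 ℕ.* suc n) + z) (≡.trans (conv-even (λ k → f (2 ℕ.+ k)) g g-odd n)
           (conv-cong {g = λ k → g (2 ℕ.* k)} (λ k → cong f (≡.sym (ℕ.*-suc 2 k))) (λ _ → ≡.refl) n)) ⟩
    conv (λ k → f (2 ℕ.* k)) (λ k → g (2 ℕ.* k)) (suc n) ∎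

  weighted : (ℕ → ℚ) → ℕ → ℚ
  weighted f n = fromℕ n * f n

  -- Leibniz rule for x d/dx on generating functions: the weights of the two indices add up to n.
  conv-weighted : ∀ f g n → conv (weighted f) g n + conv f (weighted g) n ≡ fromℕ n * conv f g n
  conv-weighted f g zero    = solve 2 (λ f g → con 0ℚ :* f :* g :+ f :* (con 0ℚ :* g) := con 0ℚ :* (f :* g)) ≡.refl (f 0) (g 0)
  conv-weighted f g (suc n) = begin-equality
    0ℚ * f 0 * gₙ + conv (λ k → fromℕ (suc k) * f′ k) g n + (f 0 * (fromℕ (suc n) * gₙ) + conv f′ (weighted g) n)
      ≡⟨ cong (λ q → 0ℚ * f 0 * gₙ + q + (f 0 * (fromℕ (suc n) * gₙ) + conv f′ (weighted g) n))
           (≡.trans (conv-cong {g = g} (λ k → ≡.trans (cong (_* f′ k) (fromℕ-+ 1 k))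
                       (solve 2 (λ k f → (con 1ℚ :+ k) :* f := f :+ k :* f) ≡.refl (fromℕ k) (f′ k))) (λ _ → ≡.refl) n)
              (conv-+ˡ f′ (weighted f′) g n)) ⟩
    0ℚ * f 0 * gₙ + (conv f′ g n + conv (weighted f′) g n) + (f 0 * (fromℕ (suc n) * gₙ) + conv f′ (weighted g) n)
      ≡⟨ solve 6 (λ f g a b s d → con 0ℚ :* f :* g :+ (a :+ b) :+ (f :* (s :* g) :+ d) := s :* (f :* g) :+ a :+ (b :+ d)) ≡.refl
           (f 0) gₙ (conv f′ g n) (conv (weighted f′) g n) (fromℕ (suc n)) (conv f′ (weighted g) n) ⟩
    fromℕ (suc n) * (f 0 * gₙ) + conv f′ g n + (conv (weighted f′) g n + conv f′ (weighted g) n)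
      ≡⟨ cong (λ z → fromℕ (suc n) * (f 0 * gₙ) + conv f′ g n + z) (conv-weighted f′ g n) ⟩
    fromℕ (suc n) * (f 0 * gₙ) + conv f′ g n + fromℕ n * conv f′ g n
      ≡⟨ cong (λ s → s * (f 0 * gₙ) + conv f′ g n + fromℕ n * conv f′ g n) (fromℕ-+ 1 n) ⟩
    (1ℚ + fromℕ n) * (f 0 * gₙ) + conv f′ g n + fromℕ n * conv f′ g n
      ≡⟨ solve 3 (λ n a c → (con 1ℚ :+ n) :* a :+ c :+ n :* c := (con 1ℚ :+ n) :* (a :+ c)) ≡.refl (fromℕ n) (f 0 * gₙ) (conv f′ g n) ⟩
    (1ℚ + fromℕ n) * (f 0 * gₙ + conv f′ g n)
      ≡⟨ cong (_* (f 0 * gₙ + conv f′ g n)) (fromℕ-+ 1 n) ⟨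
    fromℕ (suc n) * (f 0 * gₙ + conv f′ g n) ∎
    where
    f′ = λ k → f (suc k)
    gₙ = g (suc n)

  dividedPower : ℚ → ℕ → ℚ
  dividedPower x n = x ^ℚ n * invFact n

  suc*dividedPower : ∀ x n → fromℕ (suc n) * dividedPower x (suc n) ≡ x * dividedPower x n
  suc*dividedPower x n = ≡.trans
    (solve 4 (λ s x p i → s :* (x :* p :* i) := x :* (p :* (s :* i))) ≡.refl (fromℕ (suc n)) x (x ^ℚ n) (invFact (suc n)))
    (cong (λ q → x * (x ^ℚ n * q)) (≡.sym (invFact-suc n)))

  -- Divided powers avoid binomial coefficients: both sides satisfy (n + 1) e (n + 1) = (x + y) e n,
  -- the right one by the Leibniz rule.
  binomial : ∀ x y n → dividedPower (x + y) n ≡ conv (dividedPower x) (dividedPower y) n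
  binomial x y zero    = ≡.refl
  binomial x y (suc n) = fromℕ-suc-cancel n (begin-equality
    fromℕ (suc n) * e (x + y) (suc n)
      ≡⟨ suc*dividedPower (x + y) n ⟩
    (x + y) * e (x + y) n
      ≡⟨ cong ((x + y) *_) (binomial x y n) ⟩
    (x + y) * conv (e x) (e y) n
      ≡⟨ solve 3 (λ x y c → (x :+ y) :* c := x :* c :+ y :* c) ≡.refl x y (conv (e x) (e y) n) ⟩
    x * conv (e x) (e y) n + y * conv (e x) (e y) n
      ≡⟨ cong₂ _+_ (≡.sym (conv-*ˡ x (e x) (e y) n)) (≡.sym (conv-*ʳ y (e x) (e y) n)) ⟩
    conv (λ k → x * e x k) (e y) n + conv (e x) (λ k → y * e y k) n
      ≡⟨ cong₂ _+_ (conv-cong {g = e y} (λ k → ≡.sym (suc*dividedPower x k)) (λ _ → ≡.refl) n)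
                   (conv-cong {f = e x} (λ _ → ≡.refl) (λ k → ≡.sym (suc*dividedPower y k)) n) ⟩
    conv (λ k → weighted (e x) (suc k)) (e y) n + conv (e x) (λ k → weighted (e y) (suc k)) n
      -- Each convolution is extended to `suc n` by a summand of weight 0, to match the Leibniz
      -- rule.
      ≡⟨ solve 4 (λ a b c d → a :+ b := con 0ℚ :* c :* d :+ a :+ (b :+ con 0ℚ)) ≡.refl
           (conv (λ k → weighted (e x) (suc k)) (e y) n) (conv (e x) (λ k → weighted (e y) (suc k)) n) (e x 0) (e y (suc n)) ⟩
    0ℚ * e x 0 * e y (suc n) + conv (λ k → weighted (e x) (suc k)) (e y) n + (conv (e x) (λ k → weighted (e y) (suc k)) n + 0ℚ)
      ≡⟨ cong (λ q → 0ℚ * e x 0 * e y (suc n) + conv (λ k → weighted (e x) (suc k)) (e y) n + (conv (e x) (λ k → weighted (e y) (suc k)) n + q)) (≡.sym (ℚ.*-zeroʳ (e x (suc n)))) ⟩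
    conv (weighted (e x)) (e y) (suc n) + (conv (e x) (λ k → weighted (e y) (suc k)) n + e x (suc n) * weighted (e y) 0)
      ≡⟨ cong (λ z → conv (weighted (e x)) (e y) (suc n) + z) (conv-last (e x) (weighted (e y)) n) ⟨
    conv (weighted (e x)) (e y) (suc n) + conv (e x) (weighted (e y)) (suc n)
      ≡⟨ conv-weighted (e x) (e y) (suc n) ⟩
    fromℕ (suc n) * conv (e x) (e y) (suc n) ∎)
    where
    e = dividedPower
    fromℕ-suc-cancel : ∀ n {p q} → fromℕ (suc n) * p ≡ fromℕ (suc n) * q → p ≡ q
    fromℕ-suc-cancel n {p} {q} eq = begin-equality
      p                                       ≡⟨ ℚ.*-identityˡ p ⟨
      1ℚ * p                                  ≡⟨ cong (_* p) (ℚ.*-inverseˡ (fromℕ (suc n))) ⟨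
      ℚ.1/ fromℕ (suc n) * fromℕ (suc n) * p  ≡⟨ ℚ.*-assoc (ℚ.1/ fromℕ (suc n)) (fromℕ (suc n)) p ⟩
      ℚ.1/ fromℕ (suc n) * (fromℕ (suc n) * p)  ≡⟨ cong (ℚ.1/ fromℕ (suc n) *_) eq ⟩
      ℚ.1/ fromℕ (suc n) * (fromℕ (suc n) * q)  ≡⟨ ℚ.*-assoc (ℚ.1/ fromℕ (suc n)) (fromℕ (suc n)) q ⟨
      ℚ.1/ fromℕ (suc n) * fromℕ (suc n) * q  ≡⟨ cong (_* q) (ℚ.*-inverseˡ (fromℕ (suc n))) ⟩
      1ℚ * q                                  ≡⟨ ℚ.*-identityˡ q ⟩
      q                                       ∎
      where
      instance
        suc≢0 : ℚ.NonZero (fromℕ (suc n))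
        suc≢0 = ℚ.pos⇒nonZero (fromℕ (suc n)) {{positive (0<fromℕ-suc n)}}

  ^-neg-even : ∀ y n → (- y) ^ℚ (2 ℕ.* n) ≡ y ^ℚ (2 ℕ.* n)
  ^-neg-even y zero    = ≡.refl
  ^-neg-even y (suc n) = begin-equality
    (- y) ^ℚ (2 ℕ.* suc n)               ≡⟨ cong ((- y) ^ℚ_) (ℕ.*-suc 2 n) ⟩
    - y * (- y * (- y) ^ℚ (2 ℕ.* n))     ≡⟨ cong (λ z → - y * (- y * z)) (^-neg-even y n) ⟩
    - y * (- y * y ^ℚ (2 ℕ.* n))         ≡⟨ solve 2 (λ y p → :- y :* (:- y :* p) := y :* (y :* p)) ≡.refl y (y ^ℚ (2 ℕ.* n)) ⟩
    y ^ℚ (2 ℕ.+ 2 ℕ.* n)                 ≡⟨ cong (y ^ℚ_) (ℕ.*-suc 2 n) ⟨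
    y ^ℚ (2 ℕ.* suc n)                   ∎

  -- Adding the expansions for y and -y cancels the odd powers of y; the total degree being even,
  -- only even powers of x remain as well.
  even-binomial : ∀ x y n → dividedPower (x + y) (2 ℕ.* n) + dividedPower (x - y) (2 ℕ.* n)
                  ≡ fromℕ 2 * conv (λ k → dividedPower x (2 ℕ.* k)) (λ k → dividedPower y (2 ℕ.* k)) n
  even-binomial x y n = begin-equality
    e (x + y) (2 ℕ.* n) + e (x - y) (2 ℕ.* n)
      ≡⟨ cong₂ _+_ (binomial x y (2 ℕ.* n)) (binomial x (- y) (2 ℕ.* n)) ⟩
    conv (e x) (e y) (2 ℕ.* n) + conv (e x) (e (- y)) (2 ℕ.* n)
      ≡⟨ conv-+ʳ (e x) (e y) (e (- y)) (2 ℕ.* n) ⟨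
    conv (e x) (λ k → e y k + e (- y) k) (2 ℕ.* n)
      ≡⟨ conv-even (e x) (λ k → e y k + e (- y) k) odd n ⟩
    conv (λ k → e x (2 ℕ.* k)) (λ k → e y (2 ℕ.* k) + e (- y) (2 ℕ.* k)) n
      ≡⟨ conv-cong {f = λ k → e x (2 ℕ.* k)} (λ _ → ≡.refl) even n ⟩
    conv (λ k → e x (2 ℕ.* k)) (λ k → fromℕ 2 * e y (2 ℕ.* k)) n
      ≡⟨ conv-*ʳ (fromℕ 2) (λ k → e x (2 ℕ.* k)) (λ k → e y (2 ℕ.* k)) n ⟩
    fromℕ 2 * conv (λ k → e x (2 ℕ.* k)) (λ k → e y (2 ℕ.* k)) n ∎
    where
    e = dividedPower
    even : ∀ k → e y (2 ℕ.* k) + e (- y) (2 ℕ.* k) ≡ fromℕ 2 * e y (2 ℕ.* k)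
    even k = ≡.trans (cong (λ p → e y (2 ℕ.* k) + p * invFact (2 ℕ.* k)) (^-neg-even y k))
      (solve 1 (λ a → a :+ a := con (fromℕ 2) :* a) ≡.refl (e y (2 ℕ.* k)))
    odd : ∀ k → e y (suc (2 ℕ.* k)) + e (- y) (suc (2 ℕ.* k)) ≡ 0ℚ
    odd k = ≡.trans (cong (λ p → e y (suc (2 ℕ.* k)) + - y * p * invFact (suc (2 ℕ.* k))) (^-neg-even y k))
      (solve 3 (λ y p i → y :* p :* i :+ :- y :* p :* i := con 0ℚ) ≡.refl y (y ^ℚ (2 ℕ.* k)) (invFact (suc (2 ℕ.* k))))

  cosTerm-product : ∀ x y n → cosTerm n (x + y) + cosTerm n (x - y)
                    ≡ fromℕ 2 * conv (λ k → cosTerm k x) (λ k → cosTerm k y) n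
  cosTerm-product x y n = begin-equality
    s * e (x + y) (2 ℕ.* n) + s * e (x - y) (2 ℕ.* n)    ≡⟨ ℚ.*-distribˡ-+ s (e (x + y) (2 ℕ.* n)) (e (x - y) (2 ℕ.* n)) ⟨
    s * (e (x + y) (2 ℕ.* n) + e (x - y) (2 ℕ.* n))      ≡⟨ cong (s *_) (even-binomial x y n) ⟩
    s * (fromℕ 2 * conv (λ k → e x (2 ℕ.* k)) (λ k → e y (2 ℕ.* k)) n)
      ≡⟨ solve 3 (λ s t c → s :* (t :* c) := t :* (s :* c)) ≡.refl s (fromℕ 2) _ ⟩
    fromℕ 2 * (s * conv (λ k → e x (2 ℕ.* k)) (λ k → e y (2 ℕ.* k)) n)
      ≡⟨ cong (fromℕ 2 *_) (conv-geometric (- 1ℚ) (λ k → e x (2 ℕ.* k)) (λ k → e y (2 ℕ.* k)) n) ⟨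
    fromℕ 2 * conv (λ k → cosTerm k x) (λ k → cosTerm k y) n ∎
    where
    e = dividedPower
    s = (- 1ℚ) ^ℚ n

  cosSum-∑ : ∀ n x → cosSum n x ≡ ∑ n (λ k → cosTerm k x)
  cosSum-∑ zero    x = ≡.refl
  cosSum-∑ (suc n) x = cong (_+ cosTerm n x) (cosSum-∑ n x)

  -- Exact for every n, because the terms are grouped by total degree. Comparing this triangle with
  -- the square of partial sums is a separate matter.
  cosSum-product : ∀ x y n → cosSum n (x + y) + cosSum n (x - y)
                   ≡ fromℕ 2 * ∑ n (conv (λ k → cosTerm k x) (λ k → cosTerm k y))
  cosSum-product x y zero    = ≡.refl
  cosSum-product x y (suc n) = begin-equality
    cosSum n (x + y) + cosTerm n (x + y) + (cosSum n (x - y) + cosTerm n (x - y))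
      ≡⟨ solve 4 (λ a b c d → a :+ b :+ (c :+ d) := (a :+ c) :+ (b :+ d)) ≡.refl
           (cosSum n (x + y)) (cosTerm n (x + y)) (cosSum n (x - y)) (cosTerm n (x - y)) ⟩
    (cosSum n (x + y) + cosSum n (x - y)) + (cosTerm n (x + y) + cosTerm n (x - y))
      ≡⟨ cong₂ _+_ (cosSum-product x y n) (cosTerm-product x y n) ⟩
    fromℕ 2 * ∑ n A*B + fromℕ 2 * A*B n
      ≡⟨ ℚ.*-distribˡ-+ (fromℕ 2) (∑ n A*B) (A*B n) ⟨
    fromℕ 2 * ∑ (suc n) A*B ∎
    where A*B = conv (λ k → cosTerm k x) (λ k → cosTerm k y)

  ∑-nonNeg : ∀ {f} → (∀ n → 0ℚ ≤ f n) → ∀ n → 0ℚ ≤ ∑ n f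
  ∑-nonNeg 0≤f zero    = ℚ.≤-refl
  ∑-nonNeg 0≤f (suc n) = +-nonNeg (∑-nonNeg 0≤f n) (0≤f n)

  ∑-mono-+ : ∀ {f} → (∀ n → 0ℚ ≤ f n) → ∀ m n → ∑ n f ≤ ∑ (m ℕ.+ n) f
  ∑-mono-+ 0≤f zero    n = ℚ.≤-refl
  ∑-mono-+ {f} 0≤f (suc m) n = ℚ.≤-trans (∑-mono-+ 0≤f m n) (p≤p+q (∑ (m ℕ.+ n) f) (0≤f (m ℕ.+ n)))

  ∑-mono-≤ : ∀ {f g} → (∀ n → f n ≤ g n) → ∀ n → ∑ n f ≤ ∑ n g
  ∑-mono-≤ f≤g zero    = ℚ.≤-refl
  ∑-mono-≤ f≤g (suc n) = ℚ.+-mono-≤ (∑-mono-≤ f≤g n) (f≤g n)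

  ∑-conv-head : ∀ f g n → ∑ (suc n) (conv f g) ≡ f 0 * ∑ (suc n) g + ∑ n (conv (λ k → f (suc k)) g)
  ∑-conv-head f g zero    = solve 2 (λ f g → con 0ℚ :+ f :* g := f :* (con 0ℚ :+ g) :+ con 0ℚ) ≡.refl (f 0) (g 0)
  ∑-conv-head f g (suc n) = ≡.trans (cong (_+ conv f g (suc n)) (∑-conv-head f g n))
    (solve 5 (λ f s c g d → f :* s :+ c :+ (f :* g :+ d) := f :* (s :+ g) :+ (c :+ d)) ≡.refl
      (f 0) (∑ (suc n) g) (∑ n (conv (λ k → f (suc k)) g)) (g (suc n)) (conv (λ k → f (suc k)) g n))

  ∑-difference : ∀ {g b} → (∀ n → ∣ g n ∣ ≤ b n) → ∀ {m n} → m ℕ.≤′ n →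
                 ∣ ∑ n g - ∑ m g ∣ ≤ ∑ n b - ∑ m b
  ∑-difference {g} {b} g≤b {m} ℕ.≤′-refl = ℚ.≤-reflexive (≡.trans (∣p-p∣≡0 (∑ m g)) (≡.sym (ℚ.+-inverseʳ (∑ m b))))
  ∑-difference {g} {b} g≤b {m} {suc n} (ℕ.≤′-step m≤n) = begin
    ∣ ∑ n g + g n - ∑ m g ∣      ≡⟨ cong ∣_∣ (solve 3 (λ a b c → a :+ b :- c := (a :- c) :+ b) ≡.refl (∑ n g) (g n) (∑ m g)) ⟩
    ∣ (∑ n g - ∑ m g) + g n ∣    ≤⟨ ℚ.∣p+q∣≤∣p∣+∣q∣ (∑ n g - ∑ m g) (g n) ⟩
    ∣ ∑ n g - ∑ m g ∣ + ∣ g n ∣  ≤⟨ ℚ.+-mono-≤ (∑-difference g≤b m≤n) (g≤b n) ⟩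
    ∑ n b - ∑ m b + b n          ≡⟨ solve 3 (λ a b c → a :- c :+ b := a :+ b :- c) ≡.refl (∑ n b) (b n) (∑ m b) ⟩
    ∑ n b + b n - ∑ m b          ∎

  -- The left-hand side is the sum over the part of a square of indices that lies
  -- beyond the triangle, so termwise bounds carry over.
  square-triangle : ∀ {g b} → (∀ n → ∣ g n ∣ ≤ b n) → ∀ N n {f a} → (∀ k → ∣ f k ∣ ≤ a k) → n ℕ.≤ N →
                    ∣ ∑ n f * ∑ N g - ∑ n (conv f g) ∣ ≤ ∑ n a * ∑ N b - ∑ n (conv a b)
  square-triangle {g} {b} g≤b N zero f≤a n≤N = ℚ.≤-reflexive (≡.trans
    (cong ∣_∣ (solve 1 (λ a → con 0ℚ :* a :- con 0ℚ := con 0ℚ) ≡.refl (∑ N g)))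
    (solve 1 (λ a → con 0ℚ := con 0ℚ :* a :- con 0ℚ) ≡.refl (∑ N b)))
  square-triangle {g} {b} g≤b N (suc n) {f} {a} f≤a n<N = begin
    ∣ ∑ (suc n) f * ∑ N g - ∑ (suc n) (conv f g) ∣
      ≡⟨ cong ∣_∣ (split f g) ⟩
    ∣ f 0 * (∑ N g - ∑ (suc n) g) + (∑ n f′ * ∑ N g - ∑ n (conv f′ g)) ∣
      ≤⟨ ℚ.∣p+q∣≤∣p∣+∣q∣ (f 0 * (∑ N g - ∑ (suc n) g)) _ ⟩
    ∣ f 0 * (∑ N g - ∑ (suc n) g) ∣ + ∣ ∑ n f′ * ∑ N g - ∑ n (conv f′ g) ∣
      ≤⟨ ℚ.+-mono-≤ (ℚ.≤-trans (ℚ.≤-reflexive (ℚ.∣p*q∣≡∣p∣*∣q∣ (f 0) (∑ N g - ∑ (suc n) g)))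
           (*-mono-≤-nonNeg (ℚ.0≤∣p∣ (f 0)) (ℚ.≤-trans (ℚ.0≤∣p∣ (∑ N g - ∑ (suc n) g)) diff) (f≤a 0) diff))
           (square-triangle g≤b N n (λ k → f≤a (suc k)) (ℕ.<⇒≤ n<N)) ⟩
    a 0 * (∑ N b - ∑ (suc n) b) + (∑ n a′ * ∑ N b - ∑ n (conv a′ b))
      ≡⟨ split a b ⟨
    ∑ (suc n) a * ∑ N b - ∑ (suc n) (conv a b) ∎
    where
    f′ = λ k → f (suc k)
    a′ = λ k → a (suc k)
    diff : ∣ ∑ N g - ∑ (suc n) g ∣ ≤ ∑ N b - ∑ (suc n) b
    diff = ∑-difference g≤b (ℕ.≤⇒≤′ n<N)
    split : ∀ f g → ∑ (suc n) f * ∑ N g - ∑ (suc n) (conv f g)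
            ≡ f 0 * (∑ N g - ∑ (suc n) g) + (∑ n (λ k → f (suc k)) * ∑ N g - ∑ n (conv (λ k → f (suc k)) g))
    split f g = ≡.trans (cong₂ (λ u v → u * ∑ N g - v) (∑-head n f) (∑-conv-head f g n))
      (solve 5 (λ f s G t c → (f :+ s) :* G :- (f :* t :+ c) := f :* (G :- t) :+ (s :* G :- c)) ≡.refl
        (f 0) (∑ n (λ k → f (suc k))) (∑ N g) (∑ (suc n) g) (∑ n (conv (λ k → f (suc k)) g)))

  -- A rectangle of sides n and N lies inside the triangle of side n + N, whose further entries are
  -- nonnegative.
  square≤triangle : ∀ {b} → (∀ n → 0ℚ ≤ b n) → ∀ N n {a} → (∀ k → 0ℚ ≤ a k) →
                    ∑ n a * ∑ N b ≤ ∑ (n ℕ.+ N) (conv a b)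
  square≤triangle {b} 0≤b N zero {a} 0≤a = ℚ.≤-trans (ℚ.≤-reflexive (ℚ.*-zeroˡ (∑ N b))) (∑-nonNeg (0≤conv a 0≤a) N)
    where
    0≤conv : ∀ a → (∀ k → 0ℚ ≤ a k) → ∀ n → 0ℚ ≤ conv a b n
    0≤conv a 0≤a zero    = *-nonNeg (0≤a 0) (0≤b 0)
    0≤conv a 0≤a (suc n) = +-nonNeg (*-nonNeg (0≤a 0) (0≤b (suc n))) (0≤conv _ (λ k → 0≤a (suc k)) n)
  square≤triangle {b} 0≤b N (suc n) {a} 0≤a = begin
    ∑ (suc n) a * ∑ N b                        ≡⟨ cong (_* ∑ N b) (∑-head n a) ⟩
    (a 0 + ∑ n a′) * ∑ N b                     ≡⟨ ℚ.*-distribʳ-+ (∑ N b) (a 0) (∑ n a′) ⟩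
    a 0 * ∑ N b + ∑ n a′ * ∑ N b               ≤⟨ ℚ.+-mono-≤
      (ℚ.*-monoˡ-≤-nonNeg (a 0) {{nonNegative (0≤a 0)}} (∑-mono-+ 0≤b (suc n) N))
      (square≤triangle 0≤b N n (λ k → 0≤a (suc k))) ⟩
    a 0 * ∑ (suc n ℕ.+ N) b + ∑ (n ℕ.+ N) (conv a′ b)  ≡⟨ ∑-conv-head a b (n ℕ.+ N) ⟨
    ∑ (suc n ℕ.+ N) (conv a b)                 ∎
    where a′ = λ k → a (suc k)

  -- From index b on each majorant is at most half the one before, so the sum below n plus twice the
  -- n-th majorant never increases. Tails are thus at most twice their first term.
  majorant-halving : ∀ b N j → b ℕ.≤ N →
    ∑ (j ℕ.+ N) (majorant b) + (majorant b (j ℕ.+ N) + majorant b (j ℕ.+ N)) ≤ ∑ N (majorant b) + (majorant b N + majorant b N)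
  majorant-halving b N zero    b≤N = ℚ.≤-refl
  majorant-halving b N (suc j) b≤N = begin
    ∑ n m + m n + (m (suc n) + m (suc n))  ≤⟨ ℚ.+-monoʳ-≤ (∑ n m + m n) (2*majorant-suc≤ b n (ℕ.≤-trans b≤N (ℕ.m≤n+m N j))) ⟩
    ∑ n m + m n + m n                      ≡⟨ ℚ.+-assoc (∑ n m) (m n) (m n) ⟩
    ∑ n m + (m n + m n)                    ≤⟨ majorant-halving b N j b≤N ⟩
    ∑ N m + (m N + m N)                    ∎
    where
    m = majorant b
    n = j ℕ.+ N

  p≤∣p∣ : ∀ p → p ≤ ∣ p ∣
  p≤∣p∣ p with ℚ.≤-total 0ℚ p
  ... | inj₁ 0≤p = ℚ.≤-reflexive (≡.sym (ℚ.0≤p⇒∣p∣≡p 0≤p))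
  ... | inj₂ p≤0 = ℚ.≤-trans p≤0 (ℚ.0≤∣p∣ p)

  -- The majorants are the terms of cosh b, and 2 (cosh b) ^ 2 = cosh 2b + cosh 0 holds degree by
  -- degree; the terms of cosh 0 are at most those of cosh 2b.
  conv-majorant : ∀ b n → conv (majorant b) (majorant b) n ≤ majorant (b ℕ.+ b) n
  conv-majorant b n = ℚ.*-cancelˡ-≤-pos (fromℕ 2) (begin
    fromℕ 2 * conv (majorant b) (majorant b) n       ≡⟨ even-binomial β β n ⟨
    e (β + β) (2 ℕ.* n) + e (β - β) (2 ℕ.* n)        ≤⟨ ℚ.+-monoʳ-≤ (e (β + β) (2 ℕ.* n)) e[0]≤ ⟩
    e (β + β) (2 ℕ.* n) + e (β + β) (2 ℕ.* n)        ≡⟨ solve 1 (λ a → a :+ a := con (fromℕ 2) :* a) ≡.refl (e (β + β) (2 ℕ.* n)) ⟩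
    fromℕ 2 * e (β + β) (2 ℕ.* n)                    ≡⟨ cong (λ x → fromℕ 2 * e x (2 ℕ.* n)) (fromℕ-+ b b) ⟨
    fromℕ 2 * majorant (b ℕ.+ b) n                   ∎)
    where
    e = dividedPower
    β = fromℕ b
    0≤2β : 0ℚ ≤ β + β
    0≤2β = +-nonNeg (0≤fromℕ b) (0≤fromℕ b)
    e[0]≤ : e (β - β) (2 ℕ.* n) ≤ e (β + β) (2 ℕ.* n)
    e[0]≤ = ℚ.*-monoʳ-≤-nonNeg (invFact (2 ℕ.* n)) {{nonNegative (0≤invFact (2 ℕ.* n))}}
      (ℚ.≤-trans (p≤∣p∣ ((β - β) ^ℚ (2 ℕ.* n))) (∣^∣≤ 0≤2β (subst (λ z → ∣ z ∣ ≤ β + β) (≡.sym (ℚ.+-inverseʳ β)) 0≤2β) (2 ℕ.* n)))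

  -- In majorants, the square minus the triangle of side N sits inside the triangle of side 2N minus
  -- that of side N, which is dominated by a tail of the series of cosh 2b.
  cosSum-product-remainder : ∀ b N {x y} → b ℕ.+ b ℕ.≤ N → ∣ x ∣ ≤ fromℕ b → ∣ y ∣ ≤ fromℕ b →
    ∣ fromℕ 2 * (cosSum N x * cosSum N y) - (cosSum N (x + y) + cosSum N (x - y)) ∣
      ≤ fromℕ 2 * (majorant (b ℕ.+ b) N + majorant (b ℕ.+ b) N)
  cosSum-product-remainder b N {x} {y} 2b≤N x≤ y≤ = begin
    ∣ fromℕ 2 * (cosSum N x * cosSum N y) - (cosSum N (x + y) + cosSum N (x - y)) ∣
      ≡⟨ cong ∣_∣ (cong₂ _-_ (cong (fromℕ 2 *_) (cong₂ _*_ (cosSum-∑ N x) (cosSum-∑ N y))) (cosSum-product x y N)) ⟩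
    ∣ fromℕ 2 * (∑ N A * ∑ N B) - fromℕ 2 * ∑ N (conv A B) ∣
      ≡⟨ cong ∣_∣ (solve 3 (λ t a b → t :* a :- t :* b := t :* (a :- b)) ≡.refl (fromℕ 2) (∑ N A * ∑ N B) (∑ N (conv A B))) ⟩
    ∣ fromℕ 2 * (∑ N A * ∑ N B - ∑ N (conv A B)) ∣
      ≡⟨ ℚ.∣p*q∣≡∣p∣*∣q∣ (fromℕ 2) (∑ N A * ∑ N B - ∑ N (conv A B)) ⟩
    fromℕ 2 * ∣ ∑ N A * ∑ N B - ∑ N (conv A B) ∣
      ≤⟨ ℚ.*-monoˡ-≤-nonNeg (fromℕ 2) (begin
           ∣ ∑ N A * ∑ N B - ∑ N (conv A B) ∣
             ≤⟨ square-triangle (λ k → ∣cosTerm∣≤ b k y≤) N N (λ k → ∣cosTerm∣≤ b k x≤) ℕ.≤-refl ⟩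
           ∑ N m * ∑ N m - ∑ N (conv m m)
             ≤⟨ ℚ.+-monoˡ-≤ (- ∑ N (conv m m)) (square≤triangle (0≤majorant b) N N (0≤majorant b)) ⟩
           ∑ (N ℕ.+ N) (conv m m) - ∑ N (conv m m)
             ≤⟨ ∑-gap-mono N ⟩
           ∑ (N ℕ.+ N) M - ∑ N M
             ≤⟨ ℚ.+-monoˡ-≤ (- ∑ N M) (p≤p+q (∑ (N ℕ.+ N) M) (+-nonNeg (0≤majorant (b ℕ.+ b) (N ℕ.+ N)) (0≤majorant (b ℕ.+ b) (N ℕ.+ N)))) ⟩
           ∑ (N ℕ.+ N) M + (M (N ℕ.+ N) + M (N ℕ.+ N)) - ∑ N M
             ≤⟨ ℚ.+-monoˡ-≤ (- ∑ N M) (majorant-halving (b ℕ.+ b) N N 2b≤N) ⟩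
           ∑ N M + (M N + M N) - ∑ N M
             ≡⟨ solve 2 (λ a b → a :+ b :- a := b) ≡.refl (∑ N M) (M N + M N) ⟩
           M N + M N ∎) ⟩
    fromℕ 2 * (M N + M N) ∎
    where
    A = λ k → cosTerm k x
    B = λ k → cosTerm k y
    m = majorant b
    M = majorant (b ℕ.+ b)
    ∑-gap-mono : ∀ j → ∑ (j ℕ.+ N) (conv m m) - ∑ N (conv m m) ≤ ∑ (j ℕ.+ N) M - ∑ N M
    ∑-gap-mono zero    = ℚ.≤-reflexive (≡.trans (ℚ.+-inverseʳ (∑ N (conv m m))) (≡.sym (ℚ.+-inverseʳ (∑ N M))))
    ∑-gap-mono (suc j) = ≡.subst₂ _≤_ (rearrange (conv m m)) (rearrange M) (ℚ.+-mono-≤ (∑-gap-mono j) (conv-majorant b (j ℕ.+ N)))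
      where
      rearrange : ∀ f → ∑ (j ℕ.+ N) f - ∑ N f + f (j ℕ.+ N) ≡ ∑ (suc j ℕ.+ N) f - ∑ N f
      rearrange f = solve 3 (λ a b c → a :- b :+ c := a :+ c :- b) ≡.refl (∑ (j ℕ.+ N) f) (∑ N f) (f (j ℕ.+ N))

  majorant-antitone : ∀ b {m n} → b ℕ.≤ m → m ℕ.≤ n → majorant b n ≤ majorant b m
  majorant-antitone b {m} b≤m m≤n = go (ℕ.≤⇒≤′ m≤n)
    where
    go : ∀ {n} → m ℕ.≤′ n → majorant b n ≤ majorant b m
    go ℕ.≤′-refl = ℚ.≤-refl
    go (ℕ.≤′-step {n} m≤′n) = ℚ.≤-trans (p≤p+q (majorant b (suc n)) (0≤majorant b (suc n)))
      (ℚ.≤-trans (2*majorant-suc≤ b n (ℕ.≤-trans b≤m (ℕ.≤′⇒≤ m≤′n))) (go m≤′n))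

  -- `z` agrees termwise with x - y, so the n-th partial sums are taken at exactly p + q and p - q
  -- and the finite remainder bound applies.
  cos-product : ∀ x y z → (∀ n → seq x n - seq y n ≡ seq z n) →
                cos (x Defs.+ y) Defs.+ cos z ≃ 2ℝ Defs.* (cos x Defs.* cos y)
  cos-product x y z x-y≡z ε 0<ε =
    let b  , N₁ , x≤ = Estimates.eventually-bounded {seq x} (isCauchy x)
        b′ , N₂ , y≤ = Estimates.eventually-bounded {seq y} (isCauchy y)
        B = b ℕ.⊔ b′
        N₃ , 2B≤N₃ , small = majorant-small (B ℕ.+ B) (*-pos (ℚ.positive⁻¹ ½) 0<ε)
    in N₁ ℕ.⊔ N₂ ℕ.⊔ N₃ , λ n n≥ →
      let N₁≤n = ℕ.m⊔n≤o⇒m≤o N₁ N₂ (ℕ.m⊔n≤o⇒m≤o (N₁ ℕ.⊔ N₂) N₃ n≥)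
          N₂≤n = ℕ.m⊔n≤o⇒n≤o N₁ N₂ (ℕ.m⊔n≤o⇒m≤o (N₁ ℕ.⊔ N₂) N₃ n≥)
          N₃≤n = ℕ.m⊔n≤o⇒n≤o (N₁ ℕ.⊔ N₂) N₃ n≥
          p = seq x n
          q = seq y n
          M≤ = majorant-antitone (B ℕ.+ B) 2B≤N₃ N₃≤n
      in begin-strict
        ∣ cosSum n (p + q) + cosSum n (seq z n) - fromℕ 2 * (cosSum n p * cosSum n q) ∣
          ≡⟨ cong (λ r → ∣ cosSum n (p + q) + cosSum n r - fromℕ 2 * (cosSum n p * cosSum n q) ∣) (x-y≡z n) ⟨
        ∣ cosSum n (p + q) + cosSum n (p - q) - fromℕ 2 * (cosSum n p * cosSum n q) ∣
          ≡⟨ ∣p-q∣≡∣q-p∣ (cosSum n (p + q) + cosSum n (p - q)) (fromℕ 2 * (cosSum n p * cosSum n q)) ⟩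
        ∣ fromℕ 2 * (cosSum n p * cosSum n q) - (cosSum n (p + q) + cosSum n (p - q)) ∣
          ≤⟨ cosSum-product-remainder B n (ℕ.≤-trans 2B≤N₃ N₃≤n)
               (ℚ.≤-trans (x≤ n N₁≤n) (fromℕ-mono-≤ (ℕ.m≤m⊔n b b′)))
               (ℚ.≤-trans (y≤ n N₂≤n) (fromℕ-mono-≤ (ℕ.m≤n⊔m b b′))) ⟩
        fromℕ 2 * (majorant (B ℕ.+ B) n + majorant (B ℕ.+ B) n)
          ≤⟨ ℚ.*-monoˡ-≤-nonNeg (fromℕ 2) (ℚ.+-mono-≤ M≤ M≤) ⟩
        fromℕ 2 * (majorant (B ℕ.+ B) N₃ + majorant (B ℕ.+ B) N₃)
          <⟨ ℚ.*-monoʳ-<-pos (fromℕ 2) small ⟩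
        fromℕ 2 * (½ * ε)
          ≡⟨ ℚ.*-assoc (fromℕ 2) ½ ε ⟨
        1ℚ * ε
          ≡⟨ ℚ.*-identityˡ ε ⟩
        ε ∎

-- A zero of the cosine in [3/2, 17/10] and the upper bound on π

module CosineZero where

  open import Data.Rational.Base using (_+_; _*_; _-_; -_; _≤_; _<_; _/_; nonNegative; positive)
  open Estimates
  open Convolution using (majorant-antitone; p≤∣p∣)
  open Reals using (+-cancelʳ-≤; +-cancelʳ-<)
  open ℚ.≤-Reasoning
  open ℚSolver.+-*-Solver using (solve; _:+_; _:*_; _:-_; :-_; _:=_; con)

  -- The divided difference (x ^ m - y ^ m) / (x - y) written as a polynomial; it is increasing in
  -- both arguments when they are nonnegative.
  ^-quotient : ℚ → ℚ → ℕ → ℚ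
  ^-quotient x y zero    = 0ℚ
  ^-quotient x y (suc m) = x * ^-quotient x y m + y ^ℚ m

  ^-difference : ∀ x y m → x ^ℚ m - y ^ℚ m ≡ (x - y) * ^-quotient x y m
  ^-difference x y zero    = solve 1 (λ d → con 0ℚ := d :* con 0ℚ) ≡.refl (x - y)
  ^-difference x y (suc m) = begin-equality
    x * x ^ℚ m - y * y ^ℚ m
      ≡⟨ solve 4 (λ x y p q → x :* p :- y :* q := x :* (p :- q) :+ (x :- y) :* q) ≡.refl x y (x ^ℚ m) (y ^ℚ m) ⟩
    x * (x ^ℚ m - y ^ℚ m) + (x - y) * y ^ℚ m
      ≡⟨ cong (λ d → x * d + (x - y) * y ^ℚ m) (^-difference x y m) ⟩
    x * ((x - y) * ^-quotient x y m) + (x - y) * y ^ℚ m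
      ≡⟨ solve 4 (λ x y q p → x :* ((x :- y) :* q) :+ (x :- y) :* p := (x :- y) :* (x :* q :+ p)) ≡.refl x y (^-quotient x y m) (y ^ℚ m) ⟩
    (x - y) * ^-quotient x y (suc m) ∎

  ^-mono-≤ : ∀ {x y} → 0ℚ ≤ x → x ≤ y → ∀ m → x ^ℚ m ≤ y ^ℚ m
  ^-mono-≤ 0≤x x≤y zero    = ℚ.≤-refl
  ^-mono-≤ 0≤x x≤y (suc m) = *-mono-≤-nonNeg 0≤x (0≤^ (ℚ.≤-trans 0≤x x≤y) m) x≤y (^-mono-≤ 0≤x x≤y m)

  0≤^-quotient : ∀ {x y} → 0ℚ ≤ x → 0ℚ ≤ y → ∀ m → 0ℚ ≤ ^-quotient x y m
  0≤^-quotient 0≤x 0≤y zero    = ℚ.≤-refl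
  0≤^-quotient 0≤x 0≤y (suc m) = +-nonNeg (*-nonNeg 0≤x (0≤^-quotient 0≤x 0≤y m)) (0≤^ 0≤y m)

  ^-quotient-mono : ∀ {x x′ y y′} → 0ℚ ≤ x → x ≤ x′ → 0ℚ ≤ y → y ≤ y′ → ∀ m → ^-quotient x y m ≤ ^-quotient x′ y′ m
  ^-quotient-mono 0≤x x≤ 0≤y y≤ zero    = ℚ.≤-refl
  ^-quotient-mono 0≤x x≤ 0≤y y≤ (suc m) = ℚ.+-mono-≤
    (*-mono-≤-nonNeg 0≤x (0≤^-quotient (ℚ.≤-trans 0≤x x≤) (ℚ.≤-trans 0≤y y≤) m) x≤ (^-quotient-mono 0≤x x≤ 0≤y y≤ m))
    (^-mono-≤ 0≤y y≤ m)

  -- The ball of radius 1/10 about `centre` = 8/5, containing π / 2 ≈ 1.571.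
  I : ℚ → Set
  I x = + 3 / 2 ≤ x × x ≤ + 17 / 10

  I⇒0≤ : ∀ {x} → I x → 0ℚ ≤ x
  I⇒0≤ (l , _) = ℚ.≤-trans (from-yes (0ℚ ℚ.≤? + 3 / 2)) l

  I⇒∣∣≤2 : ∀ {x} → I x → ∣ x ∣ ≤ fromℕ 2
  I⇒∣∣≤2 x∈ = ℚ.≤-trans (ℚ.≤-reflexive (ℚ.0≤p⇒∣p∣≡p (I⇒0≤ x∈)))
    (ℚ.≤-trans (proj₂ x∈) (from-yes (+ 17 / 10 ℚ.≤? fromℕ 2)))

  quotientTerm : ℚ → ℚ → ℕ → ℚ
  quotientTerm x y k = ^-quotient x y (2 ℕ.* k) * invFact (2 ℕ.* k)

  quotientTerm-mono : ∀ {x x′ y y′} → 0ℚ ≤ x → x ≤ x′ → 0ℚ ≤ y → y ≤ y′ → ∀ k → quotientTerm x y k ≤ quotientTerm x′ y′ k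
  quotientTerm-mono 0≤x x≤ 0≤y y≤ k = ℚ.*-monoʳ-≤-nonNeg (invFact (2 ℕ.* k)) {{nonNegative (0≤invFact (2 ℕ.* k))}}
    (^-quotient-mono 0≤x x≤ 0≤y y≤ (2 ℕ.* k))

  cosTerm-difference : ∀ x y k → cosTerm k x - cosTerm k y ≡ (x - y) * ((- 1ℚ) ^ℚ k * quotientTerm x y k)
  cosTerm-difference x y k = begin-equality
    s * (x ^ℚ (2 ℕ.* k) * i) - s * (y ^ℚ (2 ℕ.* k) * i)
      ≡⟨ solve 4 (λ s p q i → s :* (p :* i) :- s :* (q :* i) := s :* ((p :- q) :* i)) ≡.refl s (x ^ℚ (2 ℕ.* k)) (y ^ℚ (2 ℕ.* k)) i ⟩
    s * ((x ^ℚ (2 ℕ.* k) - y ^ℚ (2 ℕ.* k)) * i)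
      ≡⟨ cong (λ d → s * (d * i)) (^-difference x y (2 ℕ.* k)) ⟩
    s * ((x - y) * ^-quotient x y (2 ℕ.* k) * i)
      ≡⟨ solve 4 (λ s d q i → s :* (d :* q :* i) := d :* (s :* (q :* i))) ≡.refl s (x - y) (^-quotient x y (2 ℕ.* k)) i ⟩
    (x - y) * (s * quotientTerm x y k) ∎
    where
    s = (- 1ℚ) ^ℚ k
    i = invFact (2 ℕ.* k)

  -- The divided difference of x + cosSum 5 x, a finite stand-in for 1 - sin. The leading 1 comes
  -- from x; the term k = 0 is constant.
  slope₅ : ℚ → ℚ → ℚ
  slope₅ x y = 1ℚ - t 1 + t 2 - t 3 + t 4
    where t = quotientTerm x y

  cosSum₅-slope : ∀ x y → (x + cosSum 5 x) - (y + cosSum 5 y) ≡ (x - y) * slope₅ x y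
  cosSum₅-slope x y = begin-equality
    (x + cosSum 5 x) - (y + cosSum 5 y)
      ≡⟨ regroup x y (c x 0) (c x 1) (c x 2) (c x 3) (c x 4) (c y 0) (c y 1) (c y 2) (c y 3) (c y 4) ⟩
    (x - y) + (c x 0 - c y 0) + (c x 1 - c y 1) + (c x 2 - c y 2) + (c x 3 - c y 3) + (c x 4 - c y 4)
      ≡⟨ cong₂ _+_ (cong₂ _+_ (cong₂ _+_ (cong₂ _+_ (cong (λ z → (x - y) + z) (d 0)) (d 1)) (d 2)) (d 3)) (d 4) ⟩
    (x - y) + (x - y) * (1ℚ * (0ℚ * 1ℚ)) + (x - y) * ((- 1ℚ) ^ℚ 1 * t 1) + (x - y) * ((- 1ℚ) ^ℚ 2 * t 2)
      + (x - y) * ((- 1ℚ) ^ℚ 3 * t 3) + (x - y) * ((- 1ℚ) ^ℚ 4 * t 4)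
      ≡⟨ solve 5 (λ d a b c e → d :+ d :* (con 1ℚ :* (con 0ℚ :* con 1ℚ)) :+ d :* (con (- 1ℚ) :* a) :+ d :* (con 1ℚ :* b) :+ d :* (con (- 1ℚ) :* c) :+ d :* (con 1ℚ :* e)
           := d :* (con 1ℚ :- a :+ b :- c :+ e)) ≡.refl (x - y) (t 1) (t 2) (t 3) (t 4) ⟩
    (x - y) * slope₅ x y ∎
    where
    t = quotientTerm x y
    c : ℚ → ℕ → ℚ
    c z k = cosTerm k z
    d : ∀ k → c x k - c y k ≡ (x - y) * ((- 1ℚ) ^ℚ k * t k)
    d = cosTerm-difference x y
    regroup : ∀ x y a b c d e a′ b′ c′ d′ e′ →
      (x + (0ℚ + a + b + c + d + e)) - (y + (0ℚ + a′ + b′ + c′ + d′ + e′))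
      ≡ (x - y) + (a - a′) + (b - b′) + (c - c′) + (d - d′) + (e - e′)
    regroup = solve 12 (λ x y a b c d e a′ b′ c′ d′ e′ →
      (x :+ (con 0ℚ :+ a :+ b :+ c :+ d :+ e)) :- (y :+ (con 0ℚ :+ a′ :+ b′ :+ c′ :+ d′ :+ e′))
      := (x :- y) :+ (a :- a′) :+ (b :- b′) :+ (c :- c′) :+ (d :- d′) :+ (e :- e′)) ≡.refl

  ∣∣≤ : ∀ {p q} → - q ≤ p → p ≤ q → ∣ p ∣ ≤ q
  ∣∣≤ {p} {q} -q≤p p≤q with ℚ.∣p∣≡p∨∣p∣≡-p p
  ... | inj₁ eq = subst (_≤ q) (≡.sym eq) p≤q
  ... | inj₂ eq = subst (_≤ q) (≡.sym eq) (subst (- p ≤_) (neg-neg q) (ℚ.neg-antimono-≤ -q≤p))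
    where
    neg-neg : ∀ q → - (- q) ≡ q
    neg-neg q = solve 1 (λ q → :- (:- q) := q) ≡.refl q

  -- Interval arithmetic: `quotientTerm` is increasing, so each term is replaced by its value at the
  -- end of `I` that its sign calls for.
  ∣slope₅∣≤ : ∀ {x y} → I x → I y → ∣ slope₅ x y ∣ ≤ + 2 / 5
  ∣slope₅∣≤ {x} {y} x∈ y∈ = ∣∣≤
    (ℚ.≤-trans (from-yes (- (+ 2 / 5) ℚ.≤? 1ℚ - hi 1 + lo 2 - hi 3 + lo 4))
      (ℚ.+-mono-≤ (ℚ.+-mono-≤ (ℚ.+-mono-≤ (ℚ.+-monoʳ-≤ 1ℚ (ℚ.neg-antimono-≤ (t≤hi 1))) (lo≤t 2)) (ℚ.neg-antimono-≤ (t≤hi 3))) (lo≤t 4)))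
    (ℚ.≤-trans
      (ℚ.+-mono-≤ (ℚ.+-mono-≤ (ℚ.+-mono-≤ (ℚ.+-monoʳ-≤ 1ℚ (ℚ.neg-antimono-≤ (lo≤t 1))) (t≤hi 2)) (ℚ.neg-antimono-≤ (lo≤t 3))) (t≤hi 4))
      (from-yes (1ℚ - lo 1 + hi 2 - lo 3 + hi 4 ℚ.≤? + 2 / 5)))
    where
    lo hi : ℕ → ℚ
    lo = quotientTerm (+ 3 / 2) (+ 3 / 2)
    hi = quotientTerm (+ 17 / 10) (+ 17 / 10)
    0≤3/2 : 0ℚ ≤ + 3 / 2
    0≤3/2 = from-yes (0ℚ ℚ.≤? + 3 / 2)
    lo≤t : ∀ k → lo k ≤ quotientTerm x y k
    lo≤t = quotientTerm-mono 0≤3/2 (proj₁ x∈) 0≤3/2 (proj₁ y∈)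
    t≤hi : ∀ k → quotientTerm x y k ≤ hi k
    t≤hi = quotientTerm-mono (I⇒0≤ x∈) (proj₂ x∈) (I⇒0≤ y∈) (proj₂ y∈)

  -- The natural Lipschitz constant m b ^ (m - 1) is relaxed to (b + 1) ^ m, so that the resulting
  -- term bound is again a `majorant`.
  ∣^-difference∣≤ : ∀ b {x y} → ∣ x ∣ ≤ fromℕ b → ∣ y ∣ ≤ fromℕ b → ∀ m →
                    ∣ x ^ℚ m - y ^ℚ m ∣ ≤ ∣ x - y ∣ * fromℕ (suc b) ^ℚ m
  ∣^-difference∣≤ b {x} {y} x≤ y≤ zero    = ℚ.≤-trans (ℚ.0≤∣p∣ (x - y)) (ℚ.≤-reflexive (≡.sym (ℚ.*-identityʳ ∣ x - y ∣)))
  ∣^-difference∣≤ b {x} {y} x≤ y≤ (suc m) = begin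
    ∣ x * x ^ℚ m - y * y ^ℚ m ∣
      ≤⟨ ∣pr-qs∣≤ x y (x ^ℚ m) (y ^ℚ m) ⟩
    ∣ x ∣ * ∣ x ^ℚ m - y ^ℚ m ∣ + ∣ y ^ℚ m ∣ * d
      ≤⟨ ℚ.+-mono-≤
           (*-mono-≤-nonNeg (ℚ.0≤∣p∣ x) (*-nonNeg 0≤d (0≤^ (0≤fromℕ (suc b)) m)) x≤ (∣^-difference∣≤ b x≤ y≤ m))
           (ℚ.*-monoʳ-≤-nonNeg d {{nonNegative 0≤d}}
             (ℚ.≤-trans (∣^∣≤ (0≤fromℕ b) y≤ m) (^-mono-≤ (0≤fromℕ b) (fromℕ-mono-≤ (ℕ.n≤1+n b)) m))) ⟩
    fromℕ b * (d * fromℕ (suc b) ^ℚ m) + fromℕ (suc b) ^ℚ m * d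
      ≡⟨ solve 3 (λ b d p → b :* (d :* p) :+ p :* d := d :* ((con 1ℚ :+ b) :* p)) ≡.refl (fromℕ b) d (fromℕ (suc b) ^ℚ m) ⟩
    d * ((1ℚ + fromℕ b) * fromℕ (suc b) ^ℚ m)
      ≡⟨ cong (λ s → d * (s * fromℕ (suc b) ^ℚ m)) (fromℕ-+ 1 b) ⟨
    d * fromℕ (suc b) ^ℚ suc m ∎
    where
    d = ∣ x - y ∣
    0≤d = ℚ.0≤∣p∣ (x - y)

  ∣cosTerm-difference∣≤ : ∀ b {x y} → ∣ x ∣ ≤ fromℕ b → ∣ y ∣ ≤ fromℕ b → ∀ k →
                          ∣ cosTerm k x - cosTerm k y ∣ ≤ ∣ x - y ∣ * majorant (suc b) k
  ∣cosTerm-difference∣≤ b {x} {y} x≤ y≤ k = begin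
    ∣ s * (x ^ℚ (2 ℕ.* k) * i) - s * (y ^ℚ (2 ℕ.* k) * i) ∣
      ≡⟨ cong ∣_∣ (solve 4 (λ s p q i → s :* (p :* i) :- s :* (q :* i) := s :* ((p :- q) :* i)) ≡.refl s (x ^ℚ (2 ℕ.* k)) (y ^ℚ (2 ℕ.* k)) i) ⟩
    ∣ s * ((x ^ℚ (2 ℕ.* k) - y ^ℚ (2 ℕ.* k)) * i) ∣
      ≡⟨ ≡.trans (ℚ.∣p*q∣≡∣p∣*∣q∣ s _) (cong (∣ s ∣ *_) (ℚ.∣p*q∣≡∣p∣*∣q∣ (x ^ℚ (2 ℕ.* k) - y ^ℚ (2 ℕ.* k)) i)) ⟩
    ∣ s ∣ * (∣ x ^ℚ (2 ℕ.* k) - y ^ℚ (2 ℕ.* k) ∣ * ∣ i ∣)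
      ≤⟨ *-mono-≤-nonNeg (ℚ.0≤∣p∣ s) (*-nonNeg (*-nonNeg (ℚ.0≤∣p∣ (x - y)) (0≤^ (0≤fromℕ (suc b)) (2 ℕ.* k))) (0≤invFact (2 ℕ.* k)))
           (subst (∣ s ∣ ≤_) (1^ k) (∣^∣≤ {1ℚ} {(- 1ℚ)} (ℚ.nonNegative⁻¹ 1ℚ) ℚ.≤-refl k))
           (*-mono-≤-nonNeg (ℚ.0≤∣p∣ (x ^ℚ (2 ℕ.* k) - y ^ℚ (2 ℕ.* k))) (0≤invFact (2 ℕ.* k))
             (∣^-difference∣≤ b x≤ y≤ (2 ℕ.* k)) (ℚ.≤-reflexive (ℚ.0≤p⇒∣p∣≡p (0≤invFact (2 ℕ.* k))))) ⟩
    1ℚ * (∣ x - y ∣ * fromℕ (suc b) ^ℚ (2 ℕ.* k) * i)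
      ≡⟨ solve 3 (λ d p i → con 1ℚ :* (d :* p :* i) := d :* (p :* i)) ≡.refl ∣ x - y ∣ (fromℕ (suc b) ^ℚ (2 ℕ.* k)) i ⟩
    ∣ x - y ∣ * majorant (suc b) k ∎
    where
    s = (- 1ℚ) ^ℚ k
    i = invFact (2 ℕ.* k)

  -- The two tails are subtracted term by term: bounding them separately would lose the factor |x -
  -- y| that a contraction needs.
  cosSum-tail-difference : ∀ b N {x y} → suc b ℕ.≤ N → ∣ x ∣ ≤ fromℕ b → ∣ y ∣ ≤ fromℕ b → ∀ {n} → N ℕ.≤ n →
    ∣ (cosSum n x - cosSum n y) - (cosSum N x - cosSum N y) ∣ ≤ ∣ x - y ∣ * (majorant (suc b) N + majorant (suc b) N)
  cosSum-tail-difference b N {x} {y} b<N x≤ y≤ {n} N≤n = ℚ.≤-trans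
    (p≤p+q _ (*-nonNeg 0≤d (+-nonNeg (0≤majorant (suc b) n) (0≤majorant (suc b) n)))) (go (ℕ.≤⇒≤′ N≤n))
    where
    d = ∣ x - y ∣
    0≤d = ℚ.0≤∣p∣ (x - y)
    M = majorant (suc b)
    D = cosSum N x - cosSum N y
    go : ∀ {n} → N ℕ.≤′ n → ∣ (cosSum n x - cosSum n y) - D ∣ + d * (M n + M n) ≤ d * (M N + M N)
    go ℕ.≤′-refl = ℚ.≤-reflexive (≡.trans (cong (_+ d * (M N + M N)) (∣p-p∣≡0 D)) (ℚ.+-identityˡ (d * (M N + M N))))
    go {suc n} (ℕ.≤′-step N≤′n) = begin
      ∣ (cosSum n x + cosTerm n x - (cosSum n y + cosTerm n y)) - D ∣ + d * (M (suc n) + M (suc n))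
        ≡⟨ cong (λ z → ∣ z ∣ + d * (M (suc n) + M (suc n))) (solve 5 (λ a b c e f → (a :+ b :- (c :+ e)) :- f := ((a :- c) :- f) :+ (b :- e)) ≡.refl
             (cosSum n x) (cosTerm n x) (cosSum n y) (cosTerm n y) D) ⟩
      ∣ ((cosSum n x - cosSum n y) - D) + (cosTerm n x - cosTerm n y) ∣ + d * (M (suc n) + M (suc n))
        ≤⟨ ℚ.+-mono-≤
             (ℚ.≤-trans (ℚ.∣p+q∣≤∣p∣+∣q∣ ((cosSum n x - cosSum n y) - D) (cosTerm n x - cosTerm n y))
               (ℚ.+-monoʳ-≤ ∣ (cosSum n x - cosSum n y) - D ∣ (∣cosTerm-difference∣≤ b x≤ y≤ n)))
             (ℚ.*-monoˡ-≤-nonNeg d {{nonNegative 0≤d}} (2*majorant-suc≤ (suc b) n (ℕ.≤-trans b<N (ℕ.≤′⇒≤ N≤′n)))) ⟩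
      ∣ (cosSum n x - cosSum n y) - D ∣ + d * M n + d * M n
        ≡⟨ solve 3 (λ a d m → a :+ d :* m :+ d :* m := a :+ d :* (m :+ m)) ≡.refl ∣ (cosSum n x - cosSum n y) - D ∣ d (M n) ⟩
      ∣ (cosSum n x - cosSum n y) - D ∣ + d * (M n + M n)
        ≤⟨ go N≤′n ⟩
      d * (M N + M N) ∎

  -- The derivative 1 - sin of this map is small on I, and its fixed point there is π / 2.
  step : ℕ → ℚ → ℚ
  step n x = x + cosSum n x

  -- Slope 2/5 from the first five terms and 1/10 from the tail make 1/2, uniformly in n ≥ 5.
  step-contracts : ∀ {n x y} → 5 ℕ.≤ n → I x → I y → ∣ step n x - step n y ∣ ≤ ½ * ∣ x - y ∣
  step-contracts {n} {x} {y} 5≤n x∈ y∈ = begin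
    ∣ step n x - step n y ∣
      ≡⟨ cong ∣_∣ (solve 6 (λ x y a b c e → (x :+ a) :- (y :+ b) := ((x :+ c) :- (y :+ e)) :+ ((a :- b) :- (c :- e))) ≡.refl
           x y (cosSum n x) (cosSum n y) (cosSum 5 x) (cosSum 5 y)) ⟩
    ∣ (step 5 x - step 5 y) + T ∣
      ≤⟨ ℚ.∣p+q∣≤∣p∣+∣q∣ (step 5 x - step 5 y) T ⟩
    ∣ step 5 x - step 5 y ∣ + ∣ T ∣
      ≡⟨ cong (λ z → ∣ z ∣ + ∣ T ∣) (cosSum₅-slope x y) ⟩
    ∣ (x - y) * slope₅ x y ∣ + ∣ T ∣
      ≡⟨ cong (_+ ∣ T ∣) (ℚ.∣p*q∣≡∣p∣*∣q∣ (x - y) (slope₅ x y)) ⟩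
    d * ∣ slope₅ x y ∣ + ∣ T ∣
      ≤⟨ ℚ.+-mono-≤ (ℚ.*-monoˡ-≤-nonNeg d {{nonNegative (ℚ.0≤∣p∣ (x - y))}} (∣slope₅∣≤ x∈ y∈))
           (ℚ.≤-trans (cosSum-tail-difference 2 5 (ℕ.m≤m+n 3 2) (I⇒∣∣≤2 x∈) (I⇒∣∣≤2 y∈) 5≤n)
             (ℚ.*-monoˡ-≤-nonNeg d {{nonNegative (ℚ.0≤∣p∣ (x - y))}} (from-yes (majorant 3 5 + majorant 3 5 ℚ.≤? + 1 / 10)))) ⟩
    d * (+ 2 / 5) + d * (+ 1 / 10)
      ≡⟨ solve 1 (λ d → d :* con (+ 2 / 5) :+ d :* con (+ 1 / 10) := con ½ :* d) ≡.refl d ⟩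
    ½ * d ∎
    where
    d = ∣ x - y ∣
    T = (cosSum n x - cosSum n y) - (cosSum 5 x - cosSum 5 y)

  centre : ℚ
  centre = + 8 / 5

  centre∈I : I centre
  centre∈I = from-yes (+ 3 / 2 ℚ.≤? centre) , from-yes (centre ℚ.≤? + 17 / 10)

  near-centre⇒I : ∀ {x} → ∣ x - centre ∣ ≤ + 1 / 10 → I x
  near-centre⇒I {x} near =
    subst (+ 3 / 2 ≤_) (shift x) (ℚ.+-monoʳ-≤ centre (ℚ.≤-trans (ℚ.neg-antimono-≤ near) (-∣p∣≤p (x - centre)))) ,
    subst (_≤ + 17 / 10) (shift x) (ℚ.+-monoʳ-≤ centre (ℚ.≤-trans (p≤∣p∣ (x - centre)) near))
    where
    shift : ∀ x → centre + (x - centre) ≡ x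
    shift x = solve 2 (λ x c → c :+ (x :- c) := x) ≡.refl x centre
    -∣p∣≤p : ∀ p → - ∣ p ∣ ≤ p
    -∣p∣≤p p = subst (- ∣ p ∣ ≤_) (solve 1 (λ p → :- (:- p) := p) ≡.refl p)
      (ℚ.neg-antimono-≤ (subst (- p ≤_) (ℚ.∣-p∣≡∣p∣ p) (p≤∣p∣ (- p))))

  I⇒near-centre : ∀ {x} → I x → ∣ x - centre ∣ ≤ + 1 / 10
  I⇒near-centre (l , u) = ∣∣≤ (ℚ.+-monoˡ-≤ (- centre) l) (ℚ.+-monoˡ-≤ (- centre) u)

  -- The contraction shrinks the radius 1/10 to 1/20, and the centre itself moves by |cos (8/5)|,
  -- less than the other 1/20.
  step-I : ∀ {n x} → 5 ℕ.≤ n → I x → I (step n x)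
  step-I {n} {x} 5≤n x∈ = near-centre⇒I (begin
    ∣ step n x - centre ∣
      ≡⟨ cong ∣_∣ (solve 3 (λ a b c → a :- c := (a :- (c :+ b)) :+ b) ≡.refl (step n x) (cosSum n centre) centre) ⟩
    ∣ (step n x - step n centre) + cosSum n centre ∣
      ≤⟨ ℚ.∣p+q∣≤∣p∣+∣q∣ (step n x - step n centre) (cosSum n centre) ⟩
    ∣ step n x - step n centre ∣ + ∣ cosSum n centre ∣
      ≤⟨ ℚ.+-mono-≤ (ℚ.≤-trans (step-contracts {n} 5≤n x∈ centre∈I) (ℚ.*-monoˡ-≤-nonNeg ½ (I⇒near-centre x∈))) cos≤ ⟩
    ½ * (+ 1 / 10) + + 1 / 20
      ≡⟨⟩
    + 1 / 10 ∎)
    where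
    cos≤ : ∣ cosSum n centre ∣ ≤ + 1 / 20
    cos≤ = begin
      ∣ cosSum n centre ∣
        ≡⟨ cong ∣_∣ (solve 2 (λ a b → a := (a :- b) :+ b) ≡.refl (cosSum n centre) (cosSum 5 centre)) ⟩
      ∣ (cosSum n centre - cosSum 5 centre) + cosSum 5 centre ∣
        ≤⟨ ℚ.∣p+q∣≤∣p∣+∣q∣ (cosSum n centre - cosSum 5 centre) (cosSum 5 centre) ⟩
      ∣ cosSum n centre - cosSum 5 centre ∣ + ∣ cosSum 5 centre ∣
        ≤⟨ ℚ.+-monoˡ-≤ ∣ cosSum 5 centre ∣ (cosSum-tail 2 5 (ℕ.m≤m+n 2 3) 5≤n (I⇒∣∣≤2 centre∈I)) ⟩
      majorant 2 5 + majorant 2 5 + ∣ cosSum 5 centre ∣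
        ≤⟨ from-yes (majorant 2 5 + majorant 2 5 + ∣ cosSum 5 centre ∣ ℚ.≤? + 1 / 20) ⟩
      + 1 / 20 ∎

  iterate : ℕ → ℕ → ℚ
  iterate n zero    = centre
  iterate n (suc j) = step n (iterate n j)

  iterate-I : ∀ {n} → 5 ℕ.≤ n → ∀ j → I (iterate n j)
  iterate-I 5≤n zero        = centre∈I
  iterate-I {n} 5≤n (suc j) = step-I {n} 5≤n (iterate-I 5≤n j)

  residual : ℕ → ℕ → ℚ
  residual n j = ∣ cosSum n (iterate n j) ∣

  -- Since `step n x - x` is `cosSum n x`, the residual is the displacement of a point, which the
  -- contraction halves.
  residual-halves : ∀ {n} → 5 ℕ.≤ n → ∀ j → residual n (suc j) ≤ ½ * residual n j
  residual-halves {n} 5≤n j = begin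
    ∣ cosSum n (step n x) ∣          ≡⟨ cong ∣_∣ (solve 2 (λ a b → b := (a :+ b) :- a) ≡.refl (step n x) (cosSum n (step n x))) ⟩
    ∣ step n (step n x) - step n x ∣ ≤⟨ step-contracts {n} 5≤n (iterate-I 5≤n (suc j)) (iterate-I 5≤n j) ⟩
    ½ * ∣ step n x - x ∣             ≡⟨ cong (λ z → ½ * ∣ z ∣) (solve 2 (λ x c → x :+ c :- x := c) ≡.refl x (cosSum n x)) ⟩
    ½ * ∣ cosSum n x ∣               ∎
    where x = iterate n j

  -- Halving beats the factor (j + 2) / (j + 1) ≤ 2. Linear decay is enough and combines directly
  -- with the Archimedean property.
  residual-decay : ∀ {n} → 5 ℕ.≤ n → ∀ j → fromℕ (suc j) * residual n j ≤ fromℕ 1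
  residual-decay {n} 5≤n zero = begin
    1ℚ * ∣ cosSum n centre ∣   ≡⟨ ℚ.*-identityˡ ∣ cosSum n centre ∣ ⟩
    ∣ cosSum n centre ∣        ≡⟨ cong ∣_∣ (solve 2 (λ x c → c := x :+ c :- x) ≡.refl centre (cosSum n centre)) ⟩
    ∣ step n centre - centre ∣ ≤⟨ I⇒near-centre (step-I {n} 5≤n centre∈I) ⟩
    + 1 / 10                   ≤⟨ from-yes (+ 1 / 10 ℚ.≤? fromℕ 1) ⟩
    fromℕ 1                    ∎
  residual-decay {n} 5≤n (suc j) = begin
    fromℕ (2 ℕ.+ j) * residual n (suc j)
      ≤⟨ *-mono-≤-nonNeg (0≤fromℕ (2 ℕ.+ j)) (*-nonNeg (from-yes (0ℚ ℚ.≤? ½)) (ℚ.0≤∣p∣ (cosSum n (iterate n j))))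
           (fromℕ-mono-≤ (ℕ.s≤s (ℕ.m≤n+m (suc j) j))) (residual-halves 5≤n j) ⟩
    fromℕ (suc j ℕ.+ suc j) * (½ * residual n j)
      ≡⟨ cong (_* (½ * residual n j)) (fromℕ-+ (suc j) (suc j)) ⟩
    (fromℕ (suc j) + fromℕ (suc j)) * (½ * residual n j)
      ≡⟨ solve 2 (λ s r → (s :+ s) :* (con ½ :* r) := s :* r) ≡.refl (fromℕ (suc j)) (residual n j) ⟩
    fromℕ (suc j) * residual n j
      ≤⟨ residual-decay 5≤n j ⟩
    fromℕ 1 ∎

  -- The diagonal fits the definition of `cos`: the n-th approximation nearly annihilates the n-th
  -- partial sum, the one evaluated there.
  zeroSeq : ℕ → ℚ
  zeroSeq n = iterate n n

  zeroSeq-I : ∀ {n} → 5 ℕ.≤ n → I (zeroSeq n)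
  zeroSeq-I {n} 5≤n = iterate-I 5≤n n

  residual-small : ∀ ε → 0ℚ < ε → ∃ λ N → 5 ℕ.≤ N × ∀ n → N ℕ.≤ n → ∣ cosSum n (zeroSeq n) ∣ < ε
  residual-small ε 0<ε = 5 ℕ.⊔ N , ℕ.m≤m⊔n 5 N , λ n n≥ → ℚ.*-cancelˡ-<-nonNeg (fromℕ (suc n)) {{nonNegative (0≤fromℕ (suc n))}} (begin-strict
    fromℕ (suc n) * residual n n  ≤⟨ residual-decay (ℕ.m⊔n≤o⇒m≤o 5 N n≥) n ⟩
    1ℚ                            ≡⟨ ℚ.*-inverseˡ ε ⟨
    ℚ.1/ ε * ε                    ≤⟨ ℚ.*-monoʳ-≤-nonNeg ε {{nonNegative (ℚ.<⇒≤ 0<ε)}} (proj₂ (archimedean (ℚ.1/ ε))) ⟩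
    fromℕ N * ε                   ≤⟨ ℚ.*-monoʳ-≤-nonNeg ε {{nonNegative (ℚ.<⇒≤ 0<ε)}} (fromℕ-mono-≤ (ℕ.m⊔n≤o⇒n≤o 5 N n≥)) ⟩
    fromℕ n * ε                   <⟨ ℚ.*-monoˡ-<-pos ε (p<p+q (fromℕ n) (ℚ.positive⁻¹ 1ℚ)) ⟩
    (fromℕ n + fromℕ 1) * ε       ≡⟨ cong (_* ε) (≡.trans (cong fromℕ (ℕ.+-comm 1 n)) (fromℕ-+ n 1)) ⟨
    fromℕ (suc n) * ε             ∎)
    where
    instance
      ε>0 : ℚ.Positive ε
      ε>0 = positive 0<ε
      ε≢0 : ℚ.NonZero ε
      ε≢0 = ℚ.pos⇒nonZero ε
    N = proj₁ (archimedean (ℚ.1/ ε))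

  -- As x = step n x - cosSum n x, the contraction gives d ≤ d / 2 + |cosSum n x - cosSum n y|.
  -- Points with small cosine are therefore close.
  anti-Lipschitz : ∀ {n x y} → 5 ℕ.≤ n → I x → I y → ∣ x - y ∣ ≤ fromℕ 2 * ∣ cosSum n x - cosSum n y ∣
  anti-Lipschitz {n} {x} {y} 5≤n x∈ y∈ = +-cancelʳ-≤ d (begin
    d + d
      ≡⟨ solve 1 (λ d → d :+ d := con (fromℕ 2) :* d) ≡.refl d ⟩
    fromℕ 2 * d
      ≡⟨ cong (λ z → fromℕ 2 * ∣ z ∣) (solve 4 (λ x y a b → x :- y := ((x :+ a) :- (y :+ b)) :+ (b :- a)) ≡.refl x y (cosSum n x) (cosSum n y)) ⟩
    fromℕ 2 * ∣ (step n x - step n y) + (cosSum n y - cosSum n x) ∣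
      ≤⟨ ℚ.*-monoˡ-≤-nonNeg (fromℕ 2) (ℚ.≤-trans (ℚ.∣p+q∣≤∣p∣+∣q∣ (step n x - step n y) (cosSum n y - cosSum n x))
           (ℚ.+-mono-≤ (step-contracts {n} 5≤n x∈ y∈) (ℚ.≤-reflexive (∣p-q∣≡∣q-p∣ (cosSum n y) (cosSum n x))))) ⟩
    fromℕ 2 * (½ * d + ∣ cosSum n x - cosSum n y ∣)
      ≡⟨ solve 2 (λ d c → con (fromℕ 2) :* (con ½ :* d :+ c) := con (fromℕ 2) :* c :+ d) ≡.refl d ∣ cosSum n x - cosSum n y ∣ ⟩
    fromℕ 2 * ∣ cosSum n x - cosSum n y ∣ + d ∎)
    where
    d = ∣ x - y ∣

  zeroSeq-isCauchy : IsCauchy zeroSeq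
  zeroSeq-isCauchy ε 0<ε =
    -- Eight δ are spent: `anti-Lipschitz` doubles the sum of two values, each below 2δ.
    let δ = ε * (+ 1 / 8)
        0<δ = *-pos 0<ε (ℚ.positive⁻¹ (+ 1 / 8))
        N₁ , 5≤N₁ , residual< = residual-small δ 0<δ
        N₂ , 2≤N₂ , tail< = majorant-small 2 0<δ
        N = N₁ ℕ.⊔ N₂
        N₁≤N = ℕ.m≤m⊔n N₁ N₂
        2≤N = ℕ.≤-trans 2≤N₂ (ℕ.m≤n⊔m N₁ N₂)
        M≤ = majorant-antitone 2 2≤N₂ (ℕ.m≤n⊔m N₁ N₂)
        close : ∀ n → N ℕ.≤ n → ∣ cosSum N (zeroSeq n) ∣ < δ + δ
        close n N≤n = begin-strict
          ∣ cosSum N (zeroSeq n) ∣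
            ≡⟨ cong ∣_∣ (solve 2 (λ a b → a := (a :- b) :+ b) ≡.refl (cosSum N (zeroSeq n)) (cosSum n (zeroSeq n))) ⟩
          ∣ (cosSum N (zeroSeq n) - cosSum n (zeroSeq n)) + cosSum n (zeroSeq n) ∣
            ≤⟨ ℚ.∣p+q∣≤∣p∣+∣q∣ (cosSum N (zeroSeq n) - cosSum n (zeroSeq n)) (cosSum n (zeroSeq n)) ⟩
          ∣ cosSum N (zeroSeq n) - cosSum n (zeroSeq n) ∣ + ∣ cosSum n (zeroSeq n) ∣
            <⟨ ℚ.+-mono-<
                 (ℚ.≤-<-trans (ℚ.≤-trans (ℚ.≤-reflexive (∣p-q∣≡∣q-p∣ (cosSum N (zeroSeq n)) (cosSum n (zeroSeq n))))
                   (ℚ.≤-trans (cosSum-tail 2 N 2≤N N≤n (I⇒∣∣≤2 (zeroSeq-I (ℕ.≤-trans 5≤N₁ (ℕ.≤-trans N₁≤N N≤n))))) (ℚ.+-mono-≤ M≤ M≤))) tail<)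
                 (residual< n (ℕ.≤-trans N₁≤N N≤n)) ⟩
          δ + δ ∎
    in N , λ m n N≤m N≤n →
      let 5≤N = ℕ.≤-trans 5≤N₁ N₁≤N
          x = zeroSeq m
          y = zeroSeq n
      in begin-strict
        ∣ x - y ∣
          ≤⟨ anti-Lipschitz {N} 5≤N (zeroSeq-I (ℕ.≤-trans 5≤N N≤m)) (zeroSeq-I (ℕ.≤-trans 5≤N N≤n)) ⟩
        fromℕ 2 * ∣ cosSum N x - cosSum N y ∣
          <⟨ ℚ.*-monoʳ-<-pos (fromℕ 2) (ℚ.≤-<-trans (ℚ.∣p+q∣≤∣p∣+∣q∣ (cosSum N x) (- cosSum N y))
               (ℚ.+-mono-< (close m N≤m) (subst (_< δ + δ) (≡.sym (ℚ.∣-p∣≡∣p∣ (cosSum N y))) (close n N≤n)))) ⟩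
        fromℕ 2 * ((δ + δ) + (δ + δ))
          ≡⟨ solve 1 (λ e → con (fromℕ 2) :* ((e :* con (+ 1 / 8) :+ e :* con (+ 1 / 8)) :+ (e :* con (+ 1 / 8) :+ e :* con (+ 1 / 8))) := e) ≡.refl ε ⟩
        ε ∎

  cosineZero : ℝ
  cosineZero = mkℝ zeroSeq zeroSeq-isCauchy

  cos[cosineZero]≃0 : cos cosineZero ≃ 0ℝ
  cos[cosineZero]≃0 ε 0<ε =
    let N , _ , small = residual-small ε 0<ε
    in N , λ n N≤n → subst (λ q → ∣ q ∣ < ε) (≡.sym (ℚ.+-identityʳ (cosSum n (zeroSeq n)))) (small n N≤n)

  cosineZero-positive : 0ℝ Defs.< cosineZero
  cosineZero-positive = 1ℚ , ℚ.positive⁻¹ 1ℚ , 5 , λ n 5≤n →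
    ℚ.<-≤-trans (from-yes (0ℚ + 1ℚ ℚ.<? + 3 / 2)) (proj₁ (zeroSeq-I 5≤n))

  -- An approximation above 87/50 would put the constructed zero below π / 2: of its distance to
  -- 17/10, 1/100 covers later fluctuation and 1/100 is the gap required by `<`. Otherwise later
  -- terms stay within 87/50 + 1/100 = 7/4.
  half-π-bound : ∀ {π} → IsPi π → ∃ λ N → ∀ n → N ℕ.≤ n → seq π n * ½ ≤ + 7 / 4
  half-π-bound {π} isPi =
    let N , close = isCauchy (π Defs.* fromℚ ½) (+ 1 / 100) (ℚ.positive⁻¹ (+ 1 / 100))
    in N , bound N close (seq π N * ½ ℚ.≤? + 87 / 50)
    where
    bound : ∀ N → (∀ m n → N ℕ.≤ m → N ℕ.≤ n → ∣ seq π m * ½ - seq π n * ½ ∣ < + 1 / 100) →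
            Dec (seq π N * ½ ≤ + 87 / 50) → ∀ n → N ℕ.≤ n → seq π n * ½ ≤ + 7 / 4
    bound N close (yes small) n N≤n = begin
      seq π n * ½                                ≡⟨ solve 2 (λ a b → a := b :+ (a :- b)) ≡.refl (seq π n * ½) (seq π N * ½) ⟩
      seq π N * ½ + (seq π n * ½ - seq π N * ½)  ≤⟨ ℚ.+-mono-≤ small (ℚ.≤-trans (p≤∣p∣ (seq π n * ½ - seq π N * ½)) (ℚ.<⇒≤ (close n N N≤n ℕ.≤-refl))) ⟩
      + 87 / 50 + + 1 / 100                      ≡⟨⟩
      + 7 / 4                                    ∎
    bound N close (no large) _ _ = contradiction cos[cosineZero]≃0
      (IsPi.leastZero isPi cosineZero cosineZero-positive
        (+ 1 / 100 , ℚ.positive⁻¹ (+ 1 / 100) , 5 ℕ.⊔ N , below))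
      where
      below : ∀ n → 5 ℕ.⊔ N ℕ.≤ n → zeroSeq n + + 1 / 100 < seq π n * ½
      below n n≥ = +-cancelʳ-< (+ 1 / 100) (begin-strict
        zeroSeq n + + 1 / 100 + + 1 / 100          ≤⟨ ℚ.+-monoˡ-≤ (+ 1 / 100) (ℚ.+-monoˡ-≤ (+ 1 / 100) (proj₂ (zeroSeq-I (ℕ.m⊔n≤o⇒m≤o 5 N n≥)))) ⟩
        + 17 / 10 + + 1 / 100 + + 1 / 100          ≤⟨ from-yes (+ 17 / 10 + + 1 / 100 + + 1 / 100 ℚ.≤? + 87 / 50) ⟩
        + 87 / 50                                  <⟨ ℚ.≰⇒> large ⟩
        seq π N * ½                                ≡⟨ solve 2 (λ a b → b := a :+ (b :- a)) ≡.refl (seq π n * ½) (seq π N * ½) ⟩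
        seq π n * ½ + (seq π N * ½ - seq π n * ½)  ≤⟨ ℚ.+-monoʳ-≤ (seq π n * ½) (ℚ.≤-trans (p≤∣p∣ (seq π N * ½ - seq π n * ½)) (ℚ.<⇒≤ (close N n ℕ.≤-refl (ℕ.m⊔n≤o⇒n≤o 5 N n≥)))) ⟩
        seq π n * ½ + + 1 / 100                    ∎)

open CharacteristicZero Reals.+-*-commutativeRing fromℤ Reals.fromℤ-isRingMonomorphism
  using (TwiceCosine; module Domain)
open Algebra.Properties.Semiring.Exp (CommutativeRing.semiring Reals.+-*-commutativeRing) using (^-congˡ)
open Domain (λ {x} {y} → Reals.cancel {x} {y}) using (SmallMultiple; c[2]-smallMultiple; integral-power-small)

-- The angles nπ / 2p and the final contradiction

module Angles (π : ℝ) (isPi : IsPi π) where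

  open import Data.Rational.Base using (_+_; _*_; _-_; -_; _≤_; _<_; _/_; nonNegative; positive)
  open Estimates
  open Reals
  open Convolution using (cos-product; p≤∣p∣)
  open CosineZero using (half-π-bound; ∣∣≤; ^-mono-≤)
  open ℚ.≤-Reasoning
  open ℚSolver.+-*-Solver using (solve; _:+_; _:*_; _:-_; :-_; _:=_; con)

  multiples-< : ∀ {q r} → q < r → (π Defs.* fromℚ q) Defs.< (π Defs.* fromℚ r)
  multiples-< {q} {r} q<r =
    let ε , 0<ε , N , ε<π = IsPi.positive isPi
        0<r-q = subst (_< r - q) (ℚ.+-inverseʳ q) (ℚ.+-monoˡ-< (- q) q<r)
    in ε * (r - q) , *-pos 0<ε 0<r-q , N , λ n N≤n → begin-strict
      seq π n * q + ε * (r - q)             ≡⟨ cong (λ e → seq π n * q + e * (r - q)) (ℚ.+-identityˡ ε) ⟨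
      seq π n * q + (0ℚ + ε) * (r - q)      <⟨ ℚ.+-monoʳ-< (seq π n * q) (ℚ.*-monoˡ-<-pos (r - q) {{positive 0<r-q}} (ε<π n N≤n)) ⟩
      seq π n * q + seq π n * (r - q)       ≡⟨ solve 3 (λ p q r → p :* q :+ p :* (r :- q) := p :* r) ≡.refl (seq π n) q r ⟩
      seq π n * r                           ∎

  cos[qπ]≄0 : ∀ q → 0ℚ < q → q < ½ → ¬ cos (π Defs.* fromℚ q) ≃ 0ℝ
  cos[qπ]≄0 q 0<q q<½ =
    let ε , 0<ε , N , below = multiples-< 0<q
    in IsPi.leastZero isPi (π Defs.* fromℚ q)
         (ε , 0<ε , N , λ n N≤n → subst (λ z → z + ε < seq π n * q) (ℚ.*-zeroʳ (seq π n)) (below n N≤n))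
         (multiples-< q<½)

  2≄0 : ¬ 2ℝ ≃ 0ℝ
  2≄0 eq with fromℚ-injective {fromℕ 2} {0ℚ} eq
  ... | ()

  fromℕ-p*1/p : ∀ p .{{_ : ℕ.NonZero p}} → fromℕ p * (+ 1 / p) ≡ 1ℚ
  fromℕ-p*1/p p@(suc p-1) = ℚ.toℚᵘ-injective
    (ℚᵘ.≃-trans (ℚ.toℚᵘ-homo-* (fromℕ p) (+ 1 / p))
      (ℚᵘ.≃-trans (ℚᵘ.*-cong (toℚᵘ-fromℕ p) (ℚ.toℚᵘ-fromℚᵘ (ℚᵘ.mkℚᵘ (+ 1) p-1)))
        (ℚᵘ.*≡* (cong +_ (≡.trans (ℕ.*-identityʳ (p ℕ.* 1)) (≡.trans (ℕ.*-comm p 1) (≡.sym (ℕ.*-identityˡ (1 ℕ.* p)))))))))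

  cosSum-0 : ∀ n → cosSum (suc n) 0ℚ ≡ 1ℚ
  cosSum-0 zero    = ≡.refl
  cosSum-0 (suc n) = ≡.trans (cong (λ z → z + cosTerm (suc n) 0ℚ) (cosSum-0 n))
    (cong (λ z → 1ℚ + z) (≡.trans (cong (λ z → s * (z * i)) (ℚ.*-zeroˡ (0ℚ ^ℚ (n ℕ.+ 1 ℕ.* suc n))))
      (solve 2 (λ s i → s :* (con 0ℚ :* i) := con 0ℚ) ≡.refl s i)))
    where
    s = (- 1ℚ) ^ℚ suc n
    i = invFact (2 ℕ.* suc n)

  -- 1 - (7/10) ^ 2 / 2 = 0.755, and the excess over 3/4 absorbs the tail bound 2 / 6!.
  cosSum-bound : ∀ n {x} → 3 ℕ.≤ n → 0ℚ ≤ x → x ≤ + 7 / 10 → + 3 / 4 ≤ cosSum n x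
  cosSum-bound n {x} 3≤n 0≤x x≤ = begin
    + 3 / 4
      ≤⟨ from-yes (+ 3 / 4 ℚ.≤? 1ℚ - ½ * (+ 49 / 100) - (majorant 1 3 + majorant 1 3)) ⟩
    1ℚ - ½ * (+ 49 / 100) - M
      ≤⟨ ℚ.+-monoˡ-≤ (- M) (ℚ.+-monoʳ-≤ 1ℚ (ℚ.neg-antimono-≤ (ℚ.*-monoˡ-≤-nonNeg ½ (*-mono-≤-nonNeg 0≤x (from-yes (0ℚ ℚ.≤? + 7 / 10)) x≤ x≤)))) ⟩
    1ℚ - ½ * (x * x) - M
      ≤⟨ ℚ.+-monoˡ-≤ (- M) (p≤p+q (1ℚ - ½ * (x * x)) (*-nonNeg (0≤invFact 4) (*-nonNeg (*-nonNeg 0≤x 0≤x) (*-nonNeg 0≤x 0≤x)))) ⟩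
    1ℚ - ½ * (x * x) + invFact 4 * (x * x * (x * x)) - M
      ≡⟨ cong (_- M) (solve 1 (λ x → con 1ℚ :- con ½ :* (x :* x) :+ con (invFact 4) :* (x :* x :* (x :* x))
           := con 0ℚ :+ con 1ℚ :* (con 1ℚ :* con 1ℚ) :+ con (- 1ℚ) :* (x :* (x :* con 1ℚ) :* con ½)
              :+ con 1ℚ :* (x :* (x :* (x :* (x :* con 1ℚ))) :* con (invFact 4))) ≡.refl x) ⟩
    cosSum 3 x - M
      ≤⟨ ℚ.+-monoʳ-≤ (cosSum 3 x) (ℚ.neg-antimono-≤ tail) ⟩
    cosSum 3 x - ∣ cosSum n x - cosSum 3 x ∣
      ≤⟨ ℚ.+-monoʳ-≤ (cosSum 3 x) (ℚ.neg-antimono-≤ (ℚ.≤-trans (p≤∣p∣ (cosSum 3 x - cosSum n x)) (ℚ.≤-reflexive (∣p-q∣≡∣q-p∣ (cosSum 3 x) (cosSum n x))))) ⟩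
    cosSum 3 x - (cosSum 3 x - cosSum n x)
      ≡⟨ solve 2 (λ a b → a :- (a :- b) := b) ≡.refl (cosSum 3 x) (cosSum n x) ⟩
    cosSum n x ∎
    where
    M = majorant 1 3 + majorant 1 3
    tail : ∣ cosSum n x - cosSum 3 x ∣ ≤ M
    tail = cosSum-tail 1 3 (ℕ.m≤m+n 1 2) 3≤n
      (ℚ.≤-trans (ℚ.≤-reflexive (ℚ.0≤p⇒∣p∣≡p 0≤x)) (ℚ.≤-trans x≤ (from-yes (+ 7 / 10 ℚ.≤? fromℕ 1))))

  -- If r ^ m exceeded k, the gap r ^ m - k would be an ε that the terms of x ^ m never come within.
  power-lowerBound : ∀ {x r k} m → 0ℚ ≤ r → (∃ λ N → ∀ n → N ℕ.≤ n → r ≤ seq x n) →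
                     (x Defs.^ m) ≃ fromℤ k → r ^ℚ m ≤ k / 1
  power-lowerBound {x} {r} {k} m 0≤r (N , r≤x) xᵐ≃k = ℚ.≮⇒≥ λ k<rᵐ →
    let 0<δ = subst (_< r ^ℚ m - k / 1) (ℚ.+-inverseʳ (k / 1)) (ℚ.+-monoˡ-< (- (k / 1)) k<rᵐ)
        N′ , close = xᵐ≃k (r ^ℚ m - k / 1) 0<δ
        n = N ℕ.⊔ N′
    in ℚ.<-irrefl ≡.refl (ℚ.<-≤-trans (close n (ℕ.m≤n⊔m N N′))
         (ℚ.≤-trans (ℚ.+-monoˡ-≤ (- (k / 1)) (ℚ.≤-trans (^-mono-≤ 0≤r (r≤x n (ℕ.m≤m⊔n N N′)) m) (ℚ.≤-reflexive (≡.sym (seq-^ m n)))))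
           (p≤∣p∣ (seq (x Defs.^ m) n - k / 1))))
    where
    seq-^ : ∀ m n → seq (x Defs.^ m) n ≡ seq x n ^ℚ m
    seq-^ zero    n = ≡.refl
    seq-^ (suc m) n = cong (seq x n *_) (seq-^ m n)

  fromℕ-^ : ∀ a m → fromℕ (a ℕ.^ m) ≡ fromℕ a ^ℚ m
  fromℕ-^ a zero    = ≡.refl
  fromℕ-^ a (suc m) = ≡.trans (fromℕ-* a (a ℕ.^ m)) (cong (fromℕ a *_) (fromℕ-^ a m))

  fromℕ-cancel-≤ : ∀ {m n} → fromℕ m ≤ fromℕ n → m ℕ.≤ n
  fromℕ-cancel-≤ {m} {n} m≤n = ℕ.≮⇒≥ λ n<m → ℚ.<-irrefl ≡.refl (begin-strict
    fromℕ n             <⟨ p<p+q (fromℕ n) (ℚ.positive⁻¹ 1ℚ) ⟩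
    fromℕ n + fromℕ 1   ≡⟨ ≡.trans (cong fromℕ (ℕ.+-comm 1 n)) (fromℕ-+ n 1) ⟨
    fromℕ (suc n)       ≤⟨ fromℕ-mono-≤ n<m ⟩
    fromℕ m             ≤⟨ m≤n ⟩
    fromℕ n             ∎)

  [3/2]^m≤k⇒3^m≤k*2^m : ∀ m k → (+ 3 / 2) ^ℚ m ≤ fromℕ k → 3 ℕ.^ m ℕ.≤ k ℕ.* 2 ℕ.^ m
  [3/2]^m≤k⇒3^m≤k*2^m m k bound = fromℕ-cancel-≤ (begin
    fromℕ (3 ℕ.^ m)                        ≡⟨ fromℕ-^ 3 m ⟩
    fromℕ 3 ^ℚ m                           ≡⟨ ^-distrib m ⟩
    (+ 3 / 2) ^ℚ m * fromℕ 2 ^ℚ m          ≤⟨ ℚ.*-monoʳ-≤-nonNeg (fromℕ 2 ^ℚ m) {{nonNegative (0≤^ (0≤fromℕ 2) m)}} bound ⟩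
    fromℕ k * fromℕ 2 ^ℚ m                 ≡⟨ cong (fromℕ k *_) (fromℕ-^ 2 m) ⟨
    fromℕ k * fromℕ (2 ℕ.^ m)              ≡⟨ fromℕ-* k (2 ℕ.^ m) ⟨
    fromℕ (k ℕ.* 2 ℕ.^ m)                  ∎)
    where
    ^-distrib : ∀ m → fromℕ 3 ^ℚ m ≡ (+ 3 / 2) ^ℚ m * fromℕ 2 ^ℚ m
    ^-distrib zero    = ≡.refl
    ^-distrib (suc m) = ≡.trans (cong (fromℕ 3 *_) (^-distrib m))
      (solve 2 (λ a b → con (fromℕ 3) :* (a :* b) := con (+ 3 / 2) :* a :* (con (fromℕ 2) :* b)) ≡.refl ((+ 3 / 2) ^ℚ m) (fromℕ 2 ^ℚ m))

  -- Divisibility gives k < (3/2) ^ m and size gives (3/2) ^ m ≤ k; the latter also rules out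
  -- negative k. `x` and `y` are kept apart because the termwise bound belongs to one
  -- representative.
  power-not-integer : ∀ {x y} → SmallMultiple x → x ≃ y → (∃ λ N → ∀ n → N ℕ.≤ n → + 3 / 2 ≤ seq y n) →
                      ∀ n k → ¬ (y Defs.^ suc n) ≃ fromℤ k
  power-not-integer {x} {y} multiple x≃y 3/2≤y n k yᵐ≃k = impossible k yᵐ≃k
    (power-lowerBound {y} {+ 3 / 2} {k} m (from-yes (0ℚ ℚ.≤? + 3 / 2)) 3/2≤y yᵐ≃k)
    where
    m = suc n
    impossible : ∀ k → (y Defs.^ m) ≃ fromℤ k → ¬ (+ 3 / 2) ^ℚ m ≤ k / 1
    impossible (+ j) yᵐ≃j bound = ℕ.<⇒≱ (integral-power-small multiple n j xᵐ≃j) ([3/2]^m≤k⇒3^m≤k*2^m m j bound)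
      where
      xᵐ≃j : (x Defs.^ m) ≃ fromℤ (+ j)
      xᵐ≃j = ≃-trans {x Defs.^ m} {y Defs.^ m} {fromℤ (+ j)} (^-congˡ m {x} {y} x≃y) yᵐ≃j
    impossible ℤ.-[1+ j ] _ bound = ℚ.<-irrefl ≡.refl (ℚ.≤-<-trans
      (ℚ.≤-trans (0≤^ (from-yes (0ℚ ℚ.≤? + 3 / 2)) m) bound)
      (ℚ.negative⁻¹ (ℤ.-[1+ j ] / 1) {{ℚ.neg-pos {+ suc j / 1} (ℚ.normalize-pos (suc j) 1)}}))

  module _ (p : ℕ) .{{p≢0 : ℕ.NonZero p}} where

    -- Half of 1/p, so that λ is `c 2` and the first zero of `c` has index p.
    φ : ℚ
    φ = ½ * (+ 1 / p)

    angle : ℕ → ℝ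
    angle n = π Defs.* fromℚ (fromℕ n * φ)

    c : ℕ → ℝ
    c n = 2ℝ Defs.* cos (angle n)

    0<1/p : 0ℚ < + 1 / p
    0<1/p = ℚ.positive⁻¹ (+ 1 / p) {{ℚ.normalize-pos 1 p}}

    0<φ : 0ℚ < φ
    0<φ = *-pos (ℚ.positive⁻¹ ½) 0<1/p

    p*φ≡½ : fromℕ p * φ ≡ ½
    p*φ≡½ = ≡.trans (solve 2 (λ p r → p :* (con ½ :* r) := con ½ :* (p :* r)) ≡.refl (fromℕ p) (+ 1 / p))
      (cong (½ *_) (fromℕ-p*1/p p))

    c[2]≃ : c 2 ≃ 2cos[ π / p ]
    c[2]≃ = pointwise {c 2} {2cos[ π / p ]} λ n → cong (λ r → fromℕ 2 * cosSum n (seq π n * r))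
      (solve 1 (λ r → con (fromℕ 2) :* (con ½ :* r) := r) ≡.refl (+ 1 / p))

    c[p]≃0 : c p ≃ 0ℝ
    c[p]≃0 = ≃-trans {c p} {2ℝ Defs.* 0ℝ} {0ℝ}
      (*-cong {2ℝ} {2ℝ} {cos (angle p)} {0ℝ} (≃-refl {2ℝ})
        (≃-trans {cos (angle p)} {cos (π Defs.* fromℚ ½)} {0ℝ}
          (pointwise {cos (angle p)} {cos (π Defs.* fromℚ ½)} λ n → cong (λ r → cosSum n (seq π n * r)) p*φ≡½)
          (IsPi.cos[π/2] isPi)))
      (pointwise {2ℝ Defs.* 0ℝ} {0ℝ} λ _ → ≡.refl)

    c[0]≃2 : c 0 ≃ 2ℝ
    -- Only from index 1 on, since `cosSum 0` is the empty sum.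
    c[0]≃2 ε 0<ε = 1 , λ { (suc n) _ → subst (λ q → ∣ q ∣ < ε) (≡.sym (difference n)) 0<ε }
      where
      difference : ∀ n → seq (c 0) (suc n) - fromℕ 2 ≡ 0ℚ
      difference n = cong (λ z → fromℕ 2 * z - fromℕ 2) (≡.trans
        (cong (cosSum (suc n)) (solve 2 (λ a r → a :* (con 0ℚ :* r) := con 0ℚ) ≡.refl (seq π (suc n)) φ)) (cosSum-0 n))

    c≄0 : ∀ n → n ℕ.< p → ¬ c n ≃ 0ℝ
    c≄0 zero      _   c[0]≃0 = 2≄0 (≃-trans {2ℝ} {c 0} {0ℝ} (≃-sym {c 0} {2ℝ} c[0]≃2) c[0]≃0)
    c≄0 n@(suc k) n<p c[n]≃0 = cos[qπ]≄0 (fromℕ n * φ) (*-pos (0<fromℕ-suc k) 0<φ)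
      (subst (fromℕ n * φ <_) p*φ≡½ (ℚ.*-monoˡ-<-pos φ {{positive 0<φ}}
        (ℚ.<-≤-trans (p<p+q (fromℕ n) (ℚ.positive⁻¹ 1ℚ))
          (ℚ.≤-trans (ℚ.≤-reflexive (≡.sym (≡.trans (cong fromℕ (ℕ.+-comm 1 n)) (fromℕ-+ n 1)))) (fromℕ-mono-≤ n<p)))))
      (cancel {2ℝ} {cos (angle n)} c[n]≃0 2≄0)

    c-twiceCosine : TwiceCosine c
    c-twiceCosine = record
      { c[0]    = c[0]≃2
      ; product = λ m n → let x = angle (m ℕ.+ n); y = angle n; z = angle m in
          ≃-trans {c (m ℕ.+ n ℕ.+ n) Defs.+ c m} {2ℝ Defs.* (cos (x Defs.+ y) Defs.+ cos z)} {c (m ℕ.+ n) Defs.* c n}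
            (pointwise {c (m ℕ.+ n ℕ.+ n) Defs.+ c m} {2ℝ Defs.* (cos (x Defs.+ y) Defs.+ cos z)} λ i → ≡.trans
              (cong (λ a → fromℕ 2 * cosSum i a + fromℕ 2 * cosSum i (seq z i)) (angle-+ (m ℕ.+ n) n i))
              (≡.sym (ℚ.*-distribˡ-+ (fromℕ 2) (cosSum i (seq x i + seq y i)) (cosSum i (seq z i)))))
            (≃-trans {2ℝ Defs.* (cos (x Defs.+ y) Defs.+ cos z)} {2ℝ Defs.* (2ℝ Defs.* (cos x Defs.* cos y))} {c (m ℕ.+ n) Defs.* c n}
              (*-cong {2ℝ} {2ℝ} {cos (x Defs.+ y) Defs.+ cos z} {2ℝ Defs.* (cos x Defs.* cos y)} (≃-refl {2ℝ})
                (cos-product x y z λ i → ≡.trans (cong (_- seq y i) (angle-+ m n i))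
                  (solve 2 (λ a b → a :+ b :- b := a) ≡.refl (seq z i) (seq y i))))
              (pointwise {2ℝ Defs.* (2ℝ Defs.* (cos x Defs.* cos y))} {c (m ℕ.+ n) Defs.* c n} λ i →
                solve 3 (λ t a b → t :* (t :* (a :* b)) := t :* a :* (t :* b)) ≡.refl (fromℕ 2) (cosSum i (seq x i)) (cosSum i (seq y i))))
      }
      where
      angle-+ : ∀ m n i → seq (angle (m ℕ.+ n)) i ≡ seq (angle m) i + seq (angle n) i
      angle-+ m n i = ≡.trans (cong (λ k → seq π i * (k * φ)) (fromℕ-+ m n))
        (solve 4 (λ t m n r → t :* ((m :+ n) :* r) := t :* (m :* r) :+ t :* (n :* r)) ≡.refl (seq π i) (fromℕ m) (fromℕ n) φ)

    -- π / p = (π / 2) (2 / p) ≤ (7/4) (2/5) = 7/10, where the cosine is at least 3/4.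
    2cos[π/p]-bound : 5 ℕ.≤ p → ∃ λ N → ∀ n → N ℕ.≤ n → + 3 / 2 ≤ seq 2cos[ π / p ] n
    2cos[π/p]-bound 5≤p =
      let N₁ , π/2≤ = half-π-bound isPi
          ε , 0<ε , N₂ , ε<π = IsPi.positive isPi
          0≤2/p = *-nonNeg (0≤fromℕ 2) (ℚ.<⇒≤ 0<1/p)
          2/p≤ = begin
            fromℕ 2 * (+ 1 / p)                      ≡⟨ solve 1 (λ r → con (fromℕ 2) :* r := con (fromℕ 5) :* r :* con (+ 2 / 5)) ≡.refl (+ 1 / p) ⟩
            fromℕ 5 * (+ 1 / p) * (+ 2 / 5)          ≤⟨ ℚ.*-monoʳ-≤-nonNeg (+ 2 / 5) (ℚ.*-monoʳ-≤-nonNeg (+ 1 / p) {{nonNegative (ℚ.<⇒≤ 0<1/p)}} (fromℕ-mono-≤ 5≤p)) ⟩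
            fromℕ p * (+ 1 / p) * (+ 2 / 5)          ≡⟨ cong (_* (+ 2 / 5)) (fromℕ-p*1/p p) ⟩
            1ℚ * (+ 2 / 5)                           ≡⟨⟩
            + 2 / 5                                  ∎
      in N₁ ℕ.⊔ N₂ ℕ.⊔ 3 , λ n n≥ →
        let N₁≤n = ℕ.m⊔n≤o⇒m≤o N₁ N₂ (ℕ.m⊔n≤o⇒m≤o (N₁ ℕ.⊔ N₂) 3 n≥)
            N₂≤n = ℕ.m⊔n≤o⇒n≤o N₁ N₂ (ℕ.m⊔n≤o⇒m≤o (N₁ ℕ.⊔ N₂) 3 n≥)
            3≤n  = ℕ.m⊔n≤o⇒n≤o (N₁ ℕ.⊔ N₂) 3 n≥
            0≤π  = ℚ.<⇒≤ (ℚ.<-trans 0<ε (subst (_< seq π n) (ℚ.+-identityˡ ε) (ε<π n N₂≤n)))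
            θ≤   = begin
              seq π n * (+ 1 / p)                   ≡⟨ solve 2 (λ t r → t :* r := t :* con ½ :* (con (fromℕ 2) :* r)) ≡.refl (seq π n) (+ 1 / p) ⟩
              seq π n * ½ * (fromℕ 2 * (+ 1 / p))   ≤⟨ *-mono-≤-nonNeg (*-nonNeg 0≤π (from-yes (0ℚ ℚ.≤? ½))) (from-yes (0ℚ ℚ.≤? + 2 / 5)) (π/2≤ n N₁≤n) 2/p≤ ⟩
              + 7 / 4 * (+ 2 / 5)                   ≡⟨⟩
              + 7 / 10                              ∎
        in ℚ.*-monoˡ-≤-nonNeg (fromℕ 2) (cosSum-bound n 3≤n (*-nonNeg 0≤π (ℚ.<⇒≤ 0<1/p)) θ≤)

    c[2]-multiple : 3 ℕ.< p → p ≢ 4 → p ≢ 6 → SmallMultiple (c 2)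
    c[2]-multiple = c[2]-smallMultiple {c} c-twiceCosine p c[p]≃0 c≄0

    2cos[π/p]-power-not-integer : 3 ℕ.< p → p ≢ 4 → p ≢ 6 →
                                  ∀ n k → ¬ (2cos[ π / p ] Defs.^ suc n) ≃ fromℤ k
    2cos[π/p]-power-not-integer 3<p p≢4 p≢6 = power-not-integer {c 2} {2cos[_/_] π p {{p≢0}}}
      -- Excluding 4 turns 3 < p into 5 ≤ p, as the size bound requires.
      (c[2]-multiple 3<p p≢4 p≢6) c[2]≃ (2cos[π/p]-bound (ℕ.≤∧≢⇒< 3<p λ 4≡p → p≢4 (≡.sym 4≡p)))

open import Defs using (_^_)

lemma14 : (π : ℝ) → IsPi π →
    (p : ℕ) .{{_ : ℕ.NonZero p}} → 3 ℕ.< p → p ≢ 4 → p ≢ 6 →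
    (m : ℕ) → 1 ℕ.≤ m → ¬ IsInteger (2cos[ π / p ] ^ m)
lemma14 π isPi p {{p≢0}} 3<p p≢4 p≢6 (suc n) _ (k , λᵐ≃k) =
  Angles.2cos[π/p]-power-not-integer π isPi p {{p≢0}} 3<p p≢4 p≢6 n k λᵐ≃k
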